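{- Let \(P\) be a rational polygon of denominator \(k \geq 2\) with \(i \geq 1\) interior lattice points and \(b\) boundary lattice points. Then \(b \leq (k+1)(i+1)+3\), and equality holds if and only if \(P\) is affine unimodular equivalent to the triangle \(\operatorname{conv}\left((0,\tfrac{1}{k}),(0,-1),((k+1)(i+1),-1)\right)\).
   Context: A rational polygon is the convex hull of finitely many points of \(\mathbb{Q}^2\). Its denominator is the smallest positive integer \(k\) such that \(kP\) has integral vertices. Lattice points are the points of \(\mathbb{Z}^2\); interior and boundary refer to the interior and boundary of \(P\) in \(\mathbb{R}^2\). Two polygons \(P,Q\) are affine unimodular equivalent if \(P = UQ+z\) for some unimodular matrix \(U \in \mathbb{Z}^{2\times 2}\) and some \(z \in \mathbb{Z}^2\). -}

module Defs where

open import Data.Nat as ℕ using (ℕ; zero; suc)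
open import Data.Integer as ℤ using (ℤ; +_)
open import Data.Rational as ℚ using (ℚ; 0ℚ; 1ℚ; _+_; _*_; _-_; _≤_; _<_; _/_)
open import Data.Fin using (Fin; zero; suc)
open import Data.Product using (_×_; _,_; Σ; ∃; proj₁; proj₂)
open import Data.Sum using (_⊎_)
open import Relation.Binary.PropositionalEquality using (_≡_)
open import Function.Bundles using (_⇔_)

Point : Set
Point = ℚ × ℚ

ℤ→ℚ : ℤ → ℚ
ℤ→ℚ z = z / 1

lat : ℤ × ℤ → Point
lat (a , b) = (ℤ→ℚ a , ℤ→ℚ b)

ℕ→ℚ : ℕ → ℚ
ℕ→ℚ n = + n / 1

-- 1/n for n ≥ 1 (value at 0 is irrelevant; only used with n ≥ 2)
recipℕ : ℕ → ℚ
recipℕ zero    = 0ℚ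
recipℕ (suc m) = + 1 / suc m

_⊕_ : Point → Point → Point
(a , b) ⊕ (c , d) = (a + c , b + d)

_·_ : ℚ → Point → Point
t · (a , b) = (t * a , t * b)

sumP : (n : ℕ) → (Fin n → Point) → Point
sumP zero    f = (0ℚ , 0ℚ)
sumP (suc n) f = f zero ⊕ sumP n (λ j → f (suc j))

sumQ : (n : ℕ) → (Fin n → ℚ) → ℚ
sumQ zero    f = 0ℚ
sumQ (suc n) f = f zero + sumQ n (λ j → f (suc j))

InHull : {n : ℕ} → (Fin n → Point) → Point → Set
InHull {n} vs p =
  Σ (Fin n → ℚ) λ λs →
    ((j : Fin n) → 0ℚ ≤ λs j) × (sumQ n λs ≡ 1ℚ) × (sumP n (λ j → λs j · vs j) ≡ p)

-- p is an interior point of the polygon: some rational ε > 0 with the four points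
-- p ± ε e₁, p ± ε e₂ in P (for a convex set this means a neighbourhood of p lies in P)
Interior : {n : ℕ} → (Fin n → Point) → Point → Set
Interior vs (x , y) =
  InHull vs (x , y) ×
  Σ ℚ λ ε → (0ℚ < ε) ×
    InHull vs (x + ε , y) × InHull vs (x - ε , y) ×
    InHull vs (x , y + ε) × InHull vs (x , y - ε)

Boundary : {n : ℕ} → (Fin n → Point) → Point → Set
Boundary vs p = InHull vs p × (Interior vs p → Data.Empty.⊥)
  where import Data.Empty

IsVertex : {n : ℕ} → (Fin n → Point) → Point → Set
IsVertex vs v =
  InHull vs v ×
  ((x y : Point) (t : ℚ) → InHull vs x → InHull vs y → 0ℚ < t → t < 1ℚ →
     v ≡ (t · x) ⊕ ((1ℚ - t) · y) → x ≡ y)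

IsIntegral : ℚ → Set
IsIntegral q = ℚ.denominatorℕ q ≡ 1

ScaledIntegral : ℕ → Point → Set
ScaledIntegral k (a , b) = IsIntegral (ℕ→ℚ k * a) × IsIntegral (ℕ→ℚ k * b)

HasIntegralVertices : {n : ℕ} → (Fin n → Point) → ℕ → Set
HasIntegralVertices vs k = (v : Point) → IsVertex vs v → ScaledIntegral k v

IsDenominator : {n : ℕ} → (Fin n → Point) → ℕ → Set
IsDenominator vs k =
  (1 ℕ.≤ k) × HasIntegralVertices vs k ×
  ((m : ℕ) → 1 ℕ.≤ m → HasIntegralVertices vs m → k ℕ.≤ m)

record Unimodular : Set where
  constructor mkU
  field
    a b c d : ℤ
    det±1 : (a ℤ.* d ℤ.- b ℤ.* c ≡ ℤ.+ 1) ⊎ (a ℤ.* d ℤ.- b ℤ.* c ≡ ℤ.- (ℤ.+ 1))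

applyAff : Unimodular → ℤ × ℤ → Point → Point
applyAff U (z₁ , z₂) (x , y) =
  (ℤ→ℚ a * x + ℤ→ℚ b * y + ℤ→ℚ z₁ , ℤ→ℚ c * x + ℤ→ℚ d * y + ℤ→ℚ z₂)
  where open Unimodular U

AffUnimodEquiv : {n m : ℕ} → (Fin n → Point) → (Fin m → Point) → Set
AffUnimodEquiv vs ws =
  Σ Unimodular λ U → Σ (ℤ × ℤ) λ z →
    (p : Point) → InHull vs p ⇔ (Σ Point λ q → InHull ws q × (p ≡ applyAff U z q))

extremalTriangle : ℕ → ℕ → Fin 3 → Point
extremalTriangle k i zero             = (0ℚ , recipℕ k)
extremalTriangle k i (suc zero)       = (0ℚ , ℚ.- 1ℚ)
extremalTriangle k i (suc (suc zero)) = (ℕ→ℚ ((suc k) ℕ.* (suc i)) , ℚ.- 1ℚ)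

{-# OPTIONS --safe #-}

-- A polygon is handled through the cone of integral vectors (x , y , n), n > 0, with (x/n , y/n) in it.
--
-- Call a polygon flat if its lattice points lie on two adjacent lattice lines. A polygon that is not
-- flat has b ≤ 3 i + 5, unless i = 1 and it is the lattice triangle 3Δ, which has denominator 1.
-- For i = 1 and b ≥ 9, two boundary points are congruent mod 3 relative to the interior point, which
-- produces an edge of lattice length ≥ 3 at height -1, and then few shapes remain. For i ≥ 2, cut off
-- everything beyond the line through an edge of the hull of the interior lattice points: beyond it
-- lies a single row of lattice points, controlled by the interior points on the edge, so the bound
-- follows by induction on i.
--
-- In a flat polygon the i interior lattice points lie on y = 0 and all but two of the boundary lattice
-- points lie on y = -1. The highest vertex has height at least 1/k above y = 0, so the chord at y = 0,
-- of length at most i + 1, is at least 1/(k+1) times the length of the bottom edge. Equality pins down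
-- the triangle.
module Submission where

open import Defs
open import Data.Nat as ℕ using (ℕ; zero; suc)
import Data.Nat.Properties as ℕP
import Data.Nat.Tactic.RingSolver as ℕS
open import Data.Empty using (⊥; ⊥-elim)
open import Data.List using (List; []; _∷_; _++_; length; map; upTo; concatMap; filter)
open import Data.List.Properties using (length-++; length-map; length-upTo)
open import Data.List.Membership.Propositional using (_∈_; find; lose)
open import Data.List.Membership.Propositional.Properties using (∈-∃++; ∈-++⁻; ∈-++⁺ˡ; ∈-++⁺ʳ; ∈-map⁺; ∈-map⁻; ∈-upTo⁺; ∈-upTo⁻; ∈-filter⁺; ∈-filter⁻)
open import Data.List.Relation.Unary.Any as Any using (here; there)
open import Data.List.Relation.Unary.Unique.Propositional using (Unique)
open import Data.List.Relation.Unary.Unique.Propositional.Properties using (map⁺; upTo⁺; ++⁺; filter⁺)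
open import Data.Product using (_×_; _,_; proj₁; proj₂; Σ; ∃)
open import Data.Product.Properties using (≡-dec)
open import Data.Sum using (_⊎_; inj₁; inj₂; [_,_]′)
open import Function.Bundles using (_⇔_; Equivalence; mk⇔)
open import Relation.Nullary using (¬_; yes; no; Dec; contradiction)
open import Relation.Nullary.Decidable using (¬?; _×-dec_)
open import Relation.Binary.Definitions using (DecidableEquality; Tri; tri<; tri≈; tri>)
open import Relation.Binary.PropositionalEquality

-- For k ≥ 2 the bound (k + 1)(i + 1) + 3 is at least 3 i + 6, so 3 i + 5 is strictly below it and
-- equality has to be analysed for flat polygons only. The classification itself is proved for
-- arbitrary convex sets with listed lattice points (`Config`): a cut gives no control over the
-- denominator, and the induction needs none. Its obstacle is that the piece left by a cut may be
-- flat although the whole is not; then induction yields no bound, and the case is settled directly,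
-- according to whether the two lines are parallel to the cut. The exception 3Δ has nine boundary
-- points, one more than 3 i + 5; each cut passes through at least two interior lattice points, and
-- this gain absorbs the excess. Interior points come from two principles: a combination with
-- positive weight on an interior point is interior, and if the set has points on both sides of a
-- line, every point strictly between two of its points on that line is interior.

module LatticeGeometry where

  open import Data.Integer hiding (suc)
  open import Data.Integer.Properties
  open import Data.Integer.DivMod using (_/_; _%_; a≡a%n+[a/n]*n; n%d<d)
  open import Data.Integer.Tactic.RingSolver using (solve; solve-∀)
  open import Data.Nat.ListAction using (sum)
  open import Data.Nat.Divisibility using (divides)
  open import Data.Nat.GCD using (module GCD; module Bézout)
  open import Data.List.Membership.DecPropositional using () renaming (_∈?_ to mem)

  -- Inequalities are proved by certificates: lin and lin< take the difference of the two sides written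
  -- as a combination (_⊹_, _⊠_) of nonnegative terms, and shift does the same for equations.
  NN : ℤ → Set
  NN x = 0ℤ ≤ x

  infixl 6 _⊹_
  infixl 7 _⊠_

  _⊹_ : ∀ {a b} → NN a → NN b → NN (a + b)
  _⊹_ = +-mono-≤

  _⊠_ : ∀ {a b} → NN a → NN b → NN (a * b)
  _⊠_ {+ m} {+ n} (+≤+ _) (+≤+ _) = subst NN (pos-* m n) (+≤+ ℕ.z≤n)

  nat : ∀ n → NN (+ n)
  nat n = +≤+ ℕ.z≤n

  Δ : ∀ {a b} → a ≤ b → NN (b - a)
  Δ = i≤j⇒0≤j-i

  Δ< : ∀ {a b} → a < b → NN (b - a - 1ℤ)
  Δ< {a} {b} a<b = subst NN (lemma a b) (i≤j⇒0≤j-i (i<j⇒suc[i]≤j a<b))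
    where
    lemma : ∀ a b → b - (1ℤ + a) ≡ b - a - 1ℤ
    lemma = solve-∀

  lin : ∀ {a b e} → NN e → b - a ≡ e → a ≤ b
  lin p refl = 0≤i-j⇒j≤i p

  lin< : ∀ {a b e} → NN e → b - a - 1ℤ ≡ e → a < b
  lin< {a} {b} p refl = suc[i]≤j⇒i<j (0≤i-j⇒j≤i (subst NN (lemma a b) p))
    where
    lemma : ∀ a b → b - a - 1ℤ ≡ b - (1ℤ + a)
    lemma = solve-∀

  absurd : ∀ {e} → NN e → e ≡ -1ℤ → ⊥
  absurd () refl

  shift : ∀ {a b x y} → a ≡ b → x - y ≡ a - b → x ≡ y
  shift {a} {x = x} {y} refl eq = i-j≡0⇒i≡j x y (trans eq (+-inverseʳ a))

  *-pos : ∀ {a b} → 0ℤ < a → 0ℤ < b → 0ℤ < a * b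
  *-pos {a} {b} a>0 b>0 = lin< ((Δ< a>0 ⊹ nat 1) ⊠ Δ< b>0 ⊹ Δ< a>0) (solve (a ∷ b ∷ []))

  0<1 : 0ℤ < 1ℤ
  0<1 = +<+ (ℕ.s≤s ℕ.z≤n)

  *-cancel-pos : ∀ {a b} → 0ℤ < a → 0ℤ < a * b → 0ℤ < b
  *-cancel-pos {+[1+ m ]} {b} _ p = *-cancelˡ-<-nonNeg +[1+ m ] (subst (_< +[1+ m ] * b) (sym (*-zeroʳ +[1+ m ])) p)
  *-cancel-pos {+0} (+<+ ())

  zero⊎pos : ∀ {a} → NN a → a ≡ 0ℤ ⊎ 0ℤ < a
  zero⊎pos {+0} _ = inj₁ refl
  zero⊎pos {+[1+ _ ]} _ = inj₂ (+<+ (ℕ.s≤s ℕ.z≤n))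

  -- Counting with duplicate-free lists of integers and lattice points.

  module UniqueLists where

    open import Data.List.Relation.Unary.All as All using (All; []; _∷_)
    open import Data.List.Relation.Unary.AllPairs using ([]; _∷_)

    module _ {A : Set} where

      unique-⊆-length : ∀ {xs ys : List A} → Unique xs → (∀ {x} → x ∈ xs → x ∈ ys) →
                        length xs ℕ.≤ length ys
      unique-⊆-length [] _ = ℕ.z≤n
      unique-⊆-length {x ∷ xs} {ys} (x≢ ∷ u) sub with ∈-∃++ (sub (here refl))
      ... | as , bs , refl = subst (suc (length xs) ℕ.≤_) (sym eq)
                                   (ℕ.s≤s (unique-⊆-length u sub′))
        where
        eq : length (as ++ x ∷ bs) ≡ suc (length (as ++ bs))
        eq = trans (length-++ as) (trans (ℕP.+-suc (length as) (length bs))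
                                         (cong suc (sym (length-++ as))))
        sub′ : ∀ {y} → y ∈ xs → y ∈ as ++ bs
        sub′ {y} y∈ with ∈-++⁻ as (sub (there y∈))
        ... | inj₁ p = ∈-++⁺ˡ p
        ... | inj₂ (here refl) = contradiction refl (All.lookup x≢ y∈)
        ... | inj₂ (there p) = ∈-++⁺ʳ as p

      collision : ∀ {B : Set} → DecidableEquality B → (f : A → B) → (xs : List A) → Unique xs →
                  Unique (map f xs) ⊎ (∃ λ x → ∃ λ y → x ∈ xs × y ∈ xs × x ≢ y × f x ≡ f y)
      collision _≟_ f [] [] = inj₁ []
      collision _≟_ f (x ∷ xs) (x≢ ∷ u) with collision _≟_ f xs u
      ... | inj₂ (a , b , a∈ , b∈ , ne , eq) = inj₂ (a , b , there a∈ , there b∈ , ne , eq)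
      ... | inj₁ u′ with Any.any? (f x ≟_) (map f xs)
      ...   | no none = inj₁ (All.tabulate (λ b∈ eq → none (lose b∈ eq)) ∷ u′)
      ...   | yes some with find some
      ...     | b , b∈ , eq with ∈-map⁻ f b∈
      ...       | y , y∈ , refl = inj₂ (x , y , here refl , there y∈ , All.lookup x≢ y∈ , eq)

    interval : ℤ → ℕ → List ℤ
    interval a m = map (λ j → a + + j) (upTo m)

    length-interval : ∀ a m → length (interval a m) ≡ m
    length-interval a m = trans (length-map _ (upTo m)) (length-upTo m)

    unique-interval : ∀ a m → Unique (interval a m)
    unique-interval a m = map⁺ (λ {i} {j} eq → +-injective (shift eq (l a (+ i) (+ j)))) (upTo⁺ m)
      where
      l : ∀ a i j → i - j ≡ a + i - (a + j)
      l = solve-∀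

    ∈-interval⁻ : ∀ {a m x} → x ∈ interval a m → a ≤ x × x < a + + m
    ∈-interval⁻ {a} {m} x∈ with ∈-map⁻ (λ j → a + + j) x∈
    ... | j , j∈ , refl = lin (nat j) (l a (+ j)) , +-monoʳ-< a (+<+ (∈-upTo⁻ j∈))
      where
      l : ∀ a j → a + j - a ≡ j
      l = solve-∀

    ∈-interval⁺ : ∀ {a m x} → a ≤ x → x < a + + m → x ∈ interval a m
    ∈-interval⁺ {a} {m} {x} p q with x - a | l a x | Δ p
      where
      l : ∀ a x → x ≡ a + (x - a)
      l = solve-∀
    ... | + j | refl | _ = ∈-map⁺ (λ j → a + + j) (∈-upTo⁺ (drop‿+<+ (+-cancelˡ-< a q)))
      where
      +-cancelˡ-< : ∀ a {x y} → a + x < a + y → x < y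
      +-cancelˡ-< a {x} {y} h = lin< (Δ< h) (l a x y)
        where
        l : ∀ a x y → y - x - 1ℤ ≡ a + y - (a + x) - 1ℤ
        l = solve-∀

    minimum : ∀ x xs → ∃ λ a → a ∈ x ∷ xs × (∀ {y} → y ∈ x ∷ xs → a ≤ y)
    minimum x [] = x , here refl , λ { (here refl) → ≤-refl }
    minimum x (x′ ∷ xs) with minimum x′ xs
    ... | a , a∈ , lb with x ≤? a
    ...   | yes x≤a = x , here refl , λ { (here refl) → ≤-refl ; (there y∈) → ≤-trans x≤a (lb y∈) }
    ...   | no x≰a = a , there a∈ , λ { (here refl) → <⇒≤ (≰⇒> x≰a) ; (there y∈) → lb y∈ }

    maximum : ∀ x xs → ∃ λ a → a ∈ x ∷ xs × (∀ {y} → y ∈ x ∷ xs → y ≤ a)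
    maximum x [] = x , here refl , λ { (here refl) → ≤-refl }
    maximum x (x′ ∷ xs) with maximum x′ xs
    ... | a , a∈ , ub with a ≤? x
    ...   | yes a≤x = x , here refl , λ { (here refl) → ≤-refl ; (there y∈) → ≤-trans (ub y∈) a≤x }
    ...   | no a≰x = a , there a∈ , λ { (here refl) → <⇒≤ (≰⇒> a≰x) ; (there y∈) → ub y∈ }

    record Span (xs : List ℤ) : Set where
      field
        low : ℤ
        width : ℕ
        low∈ : low ∈ xs
        high∈ : low + + width ∈ xs
        low≤ : ∀ {x} → x ∈ xs → low ≤ x
        ≤high : ∀ {x} → x ∈ xs → x ≤ low + + width
        length≤ : length xs ℕ.≤ suc width

    span : ∀ xs → Unique xs → xs ≡ [] ⊎ Span xs
    span [] _ = inj₁ refl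
    span (x ∷ xs) u with minimum x xs | maximum x xs
    ... | a , a∈ , lb | c , c∈ , ub with c - a | l a c | Δ (lb c∈)
      where
      l : ∀ a c → c ≡ a + (c - a)
      l = solve-∀
    ...   | + m | refl | _ = inj₂ record
      { low = a ; width = m ; low∈ = a∈ ; high∈ = c∈ ; low≤ = lb ; ≤high = ub
      ; length≤ = subst (suc (length xs) ℕ.≤_) (length-interval a (suc m))
                    (unique-⊆-length u λ y∈ → ∈-interval⁺ (lb y∈) (lin< (Δ (ub y∈)) (l′ a _ (+ m)))) }
      where
      l′ : ∀ a y m → a + (1ℤ + m) - y - 1ℤ ≡ a + m - y
      l′ = solve-∀

    three : ∀ xs → Unique xs → length xs ℕ.≤ 2 ⊎
            (∃ λ a → ∃ λ b → ∃ λ c → a ∈ xs × b ∈ xs × c ∈ xs × a < b × b < c)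
    three xs u with span xs u
    ... | inj₁ refl = inj₁ ℕ.z≤n
    ... | inj₂ s with Any.any? (λ b → ¬? (b ≟ Span.low s) ×-dec ¬? (b ≟ Span.low s + + Span.width s)) xs
    ...   | yes some with find some
    ...     | b , b∈ , b≢a , b≢c = inj₂ (_ , b , _ , low∈ , b∈ , high∈ ,
                ≤∧≢⇒< (low≤ b∈) (λ e → b≢a (sym e)) , ≤∧≢⇒< (≤high b∈) b≢c)
      where open Span s
    three xs u | inj₂ s | no none = inj₁ (unique-⊆-length u sub)
      where
      open Span s
      sub : ∀ {y} → y ∈ xs → y ∈ low ∷ low + + width ∷ []
      sub {y} y∈ with y ≟ low | y ≟ low + + width
      ... | yes e | _ = here e
      ... | no _ | yes e = there (here e)
      ... | no n₁ | no n₂ = ⊥-elim (none (lose y∈ (n₁ , n₂)))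

    row : ℤ → List (ℤ × ℤ) → List ℤ
    row y [] = []
    row y ((x , y′) ∷ L) with y′ ≟ y
    ... | yes _ = x ∷ row y L
    ... | no _ = row y L

    ∈-row⁺ : ∀ {x y} {L : List (ℤ × ℤ)} → (x , y) ∈ L → x ∈ row y L
    ∈-row⁺ {x} {y} {(x′ , y′) ∷ L} p with y′ ≟ y | p
    ... | yes _ | here refl = here refl
    ... | yes _ | there q = there (∈-row⁺ q)
    ... | no n | here refl = contradiction refl n
    ... | no _ | there q = ∈-row⁺ q

    ∈-row⁻ : ∀ {x y} {L : List (ℤ × ℤ)} → x ∈ row y L → (x , y) ∈ L
    ∈-row⁻ {x} {y} {(x′ , y′) ∷ L} p with y′ ≟ y | p
    ... | yes refl | here refl = here refl
    ... | yes _ | there q = there (∈-row⁻ q)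
    ... | no _ | q = there (∈-row⁻ q)

    unique-row : ∀ y {L} → Unique L → Unique (row y L)
    unique-row y [] = []
    unique-row y {(x , y′) ∷ L} (≢s ∷ u) with y′ ≟ y
    ... | yes refl = All.tabulate (λ x′∈ eq → All.lookup ≢s (∈-row⁻ x′∈) (cong (_, y) eq)) ∷ unique-row y u
    ... | no _ = unique-row y u

    length-row≤ : ∀ y L → length (row y L) ℕ.≤ length L
    length-row≤ y [] = ℕ.z≤n
    length-row≤ y ((x , y′) ∷ L) with y′ ≟ y
    ... | yes _ = ℕ.s≤s (length-row≤ y L)
    ... | no _ = ℕP.m≤n⇒m≤1+n (length-row≤ y L)

    length≤rows : ∀ ys {L} → Unique L → (∀ {x y} → (x , y) ∈ L → y ∈ ys) →
                  length L ℕ.≤ sum (map (λ y → length (row y L)) ys)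
    length≤rows ys {L} u cover = subst (length L ℕ.≤_) (len ys) (unique-⊆-length u λ z∈ → sub ys z∈ (cover z∈))
      where
      line : ℤ → List (ℤ × ℤ)
      line y = map (_, y) (row y L)
      len : ∀ ys → length (concatMap line ys) ≡ sum (map (λ y → length (row y L)) ys)
      len [] = refl
      len (y ∷ ys) = trans (length-++ (line y)) (cong₂ ℕ._+_ (length-map _ (row y L)) (len ys))
      sub : ∀ ys {x y} → (x , y) ∈ L → y ∈ ys → (x , y) ∈ concatMap line ys
      sub (y ∷ ys) z∈ (here refl) = ∈-++⁺ˡ (∈-map⁺ _ (∈-row⁺ z∈))
      sub (y ∷ ys) z∈ (there p) = ∈-++⁺ʳ (line y) (sub ys z∈ p)

    divide : ∀ a N → 0ℤ < N → ∃ λ q → ∃ λ r → a ≡ + r + q * N × + r < N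
    divide a +[1+ n ] _ = a / +[1+ n ] , a % +[1+ n ] , a≡a%n+[a/n]*n a +[1+ n ] , +<+ (n%d<d a +[1+ n ])
    divide a +0 (+<+ ())

    module Gap {xs : List ℤ} {N lo hi : ℤ} (N>0 : 0ℤ < N)
               (full : ∀ X → lo < N * X → N * X < hi → X ∈ xs) where

      private
        ℓ = length xs

        too-many : ∀ X → lo < N * X → N * (X + + ℓ) < hi → ⊥
        too-many X p q = ℕP.<-irrefl refl
          (subst (ℕ._≤ ℓ) (length-interval X (suc ℓ)) (unique-⊆-length (unique-interval X (suc ℓ)) sub))
          where
          l₁ : ∀ N X Y lo → N * Y - lo - 1ℤ ≡ N * X - lo - 1ℤ + (N - 0ℤ - 1ℤ + 1ℤ) * (Y - X)
          l₁ = solve-∀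
          l₂ : ∀ N X Y hi ℓ → hi - N * Y - 1ℤ
               ≡ hi - N * (X + ℓ) - 1ℤ + (N - 0ℤ - 1ℤ + 1ℤ) * (X + (1ℤ + ℓ) - Y - 1ℤ)
          l₂ = solve-∀
          sub : ∀ {Y} → Y ∈ interval X (suc ℓ) → Y ∈ xs
          sub {Y} Y∈ with ∈-interval⁻ {X} {suc ℓ} Y∈
          ... | X≤Y , Y< = full Y
            (lin< (Δ< p ⊹ (Δ< N>0 ⊹ nat 1) ⊠ Δ X≤Y) (l₁ N X Y lo))
            (lin< (Δ< q ⊹ (Δ< N>0 ⊹ nat 1) ⊠ Δ< Y<) (l₂ N X Y hi (+ ℓ)))

      -- An open interval longer than ℓ + 1 contains the ℓ + 1 consecutive integers after the floor
      -- of its left end. The interval is (lo/N, hi/N), written without division.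
      bound : hi ≤ lo + N * (1ℤ + + ℓ)
      bound with hi ≤? lo + N * (1ℤ + + ℓ)
      ... | yes p = p
      ... | no ¬p with divide lo N N>0
      ...   | α , r , eq , r<N = ⊥-elim (too-many (1ℤ + α)
              (lin< (Δ< r<N) (trans (cong (λ t → N * (1ℤ + α) - t - 1ℤ) eq) (l₁ N α (+ r))))
              (lin< (Δ< (≰⇒> ¬p) ⊹ nat r)
                (trans (l₂ hi N α (+ ℓ) (+ r)) (cong (λ t → hi - (t + N * (1ℤ + + ℓ)) - 1ℤ + + r) (sym eq)))))
        where
        l₁ : ∀ N α r → N * (1ℤ + α) - (r + α * N) - 1ℤ ≡ N - r - 1ℤ
        l₁ = solve-∀
        l₂ : ∀ hi N α ℓ r → hi - N * (1ℤ + α + ℓ) - 1ℤ ≡ hi - (r + α * N + N * (1ℤ + ℓ)) - 1ℤ + r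
        l₂ = solve-∀

      -- If lo/N were not an integer, an open interval of length exactly ℓ + 1 would still contain ℓ
      -- + 1 integers.
      tight : hi ≡ lo + N * (1ℤ + + ℓ) → ∃ λ α → lo ≡ N * α
      tight hi≡ with divide lo N N>0
      ... | α , zero , eq , _ = α , trans eq (l N α)
        where
        l : ∀ N α → 0ℤ + α * N ≡ N * α
        l = solve-∀
      ... | α , suc r , eq , r<N = ⊥-elim (too-many (1ℤ + α)
              (lin< (Δ< r<N) (trans (cong (λ t → N * (1ℤ + α) - t - 1ℤ) eq) (l₁ N α (+ suc r))))
              (lin< (nat r) (trans (cong (λ t → t - N * (1ℤ + α + + ℓ) - 1ℤ)
                                      (trans hi≡ (cong (λ t → t + N * (1ℤ + + ℓ)) eq)))
                              (l₂ N α (+ ℓ) (+ r)))))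
        where
        l₁ : ∀ N α r → N * (1ℤ + α) - (r + α * N) - 1ℤ ≡ N - r - 1ℤ
        l₁ = solve-∀
        l₂ : ∀ N α ℓ r → (1ℤ + r + α * N) + N * (1ℤ + ℓ) - N * (1ℤ + α + ℓ) - 1ℤ ≡ r
        l₂ = solve-∀

  open UniqueLists

  -- Homogeneous cones of convex sets and their interiors.

  variable
    x y n x₁ y₁ n₁ x₂ y₂ n₂ x₃ y₃ n₃ : ℤ

  -- C x y n stands for "n > 0 and (x/n, y/n) lies in the convex set".
  record Cone : Set₁ where
    field
      C : ℤ → ℤ → ℤ → Set
      C-pos : C x y n → 0ℤ < n
      add : C x₁ y₁ n₁ → C x₂ y₂ n₂ → C (x₁ + x₂) (y₁ + y₂) (n₁ + n₂)
      scale : ∀ {a} → 0ℤ < a → C x y n → C (a * x) (a * y) (a * n)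
      unscale : ∀ {a} → 0ℤ < a → C (a * x) (a * y) (a * n) → C x y n

  det : ℤ → ℤ → ℤ → ℤ → ℤ → ℤ → ℤ → ℤ → ℤ → ℤ
  det x₁ y₁ n₁ x₂ y₂ n₂ x₃ y₃ n₃ =
    x₁ * (y₂ * n₃ - n₂ * y₃) - y₁ * (x₂ * n₃ - n₂ * x₃) + n₁ * (x₂ * y₃ - y₂ * x₃)

  module Interior (K : Cone) where
    open Cone K public

    -- The point stays in the convex set after a small enough displacement in any direction.
    record O (x y n : ℤ) : Set where
      constructor mkO
      field
        move : ∀ p q → ∃ λ a → 0ℤ < a × C (a * x + p) (a * y + q) (a * n)
    open O public

    cast : x ≡ x₁ → y ≡ y₁ → n ≡ n₁ → C x y n → C x₁ y₁ n₁
    cast refl refl refl c = c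

    castO : x ≡ x₁ → y ≡ y₁ → n ≡ n₁ → O x y n → O x₁ y₁ n₁
    castO refl refl refl o = o

    -- The zero vector has n = 0 and is not in the cone, so a coefficient may vanish only next to a
    -- summand that is present anyway.
    add* : ∀ {a} → C x₁ y₁ n₁ → NN a → C x₂ y₂ n₂ → C (x₁ + a * x₂) (y₁ + a * y₂) (n₁ + a * n₂)
    add* {x₁} {y₁} {n₁} {x₂} {y₂} {n₂} {+0} c _ d =
      cast (l x₁ x₂) (l y₁ y₂) (l n₁ n₂) c
      where
      l : ∀ x z → x ≡ x + 0ℤ * z
      l = solve-∀
    add* {a = +[1+ a ]} c _ d = add c (scale {a = +[1+ a ]} (+<+ (ℕ.s≤s ℕ.z≤n)) d)

    O⇒C : O x y n → C x y n
    O⇒C {x} {y} {n} o with move o 0ℤ 0ℤ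
    ... | a , a>0 , c = unscale a>0 (cast (+-identityʳ _) (+-identityʳ _) refl c)

    -- Absorption: the room that the first vector has for displacements survives the addition of
    -- cone vectors.
    O-add* : ∀ {a} → O x₁ y₁ n₁ → NN a → C x₂ y₂ n₂ → O (x₁ + a * x₂) (y₁ + a * y₂) (n₁ + a * n₂)
    O-add* {x₁} {y₁} {n₁} {x₂} {y₂} {n₂} {b} o b≥0 d = mkO λ p q → go p q (move o p q)
      where
      go : ∀ p q → (∃ λ a → 0ℤ < a × C (a * x₁ + p) (a * y₁ + q) (a * n₁)) → _
      go p q (a , a>0 , c) = a , a>0 ,
        cast (l a x₁ b x₂ p) (l a y₁ b y₂ q) (l′ a n₁ b n₂) (add* c (<⇒≤ a>0 ⊠ b≥0) d)
        where
        l : ∀ a x b z p → a * x + p + a * b * z ≡ a * (x + b * z) + p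
        l = solve-∀
        l′ : ∀ a x b z → a * x + a * b * z ≡ a * (x + b * z)
        l′ = solve-∀

    O-unscale : ∀ {a} → 0ℤ < a → O (a * x) (a * y) (a * n) → O x y n
    O-unscale {x} {y} {n} {b} b>0 o = mkO λ p q → go p q (move o p q)
      where
      go : ∀ p q → (∃ λ a → 0ℤ < a × C (a * (b * x) + p) (a * (b * y) + q) (a * (b * n))) → _
      go p q (a , a>0 , c) = a * b , *-pos a>0 b>0 ,
        cast (cong (_+ p) (sym (*-assoc a b x))) (cong (_+ q) (sym (*-assoc a b y))) (sym (*-assoc a b n)) c

    combineC : ∀ {a b d} → C x₁ y₁ n₁ → C x₂ y₂ n₂ → 0ℤ < a → NN b → 0ℤ < d →
               a * x₁ + b * x₂ ≡ d * x → a * y₁ + b * y₂ ≡ d * y → a * n₁ + b * n₂ ≡ d * n → C x y n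
    combineC c₁ c₂ a>0 b≥0 d>0 ex ey en = unscale d>0 (cast ex ey en (add* (scale a>0 c₁) b≥0 c₂))

    -- One coefficient must be positive to start from. They cannot all vanish, because the last
    -- equation sums to d n > 0.
    combine₃ : ∀ {a b c d} → C x₁ y₁ n₁ → C x₂ y₂ n₂ → C x₃ y₃ n₃ → NN a → NN b → NN c → 0ℤ < d → 0ℤ < n →
               a * x₁ + b * x₂ + c * x₃ ≡ d * x → a * y₁ + b * y₂ + c * y₃ ≡ d * y →
               a * n₁ + b * n₂ + c * n₃ ≡ d * n → C x y n
    combine₃ {a = a} {b} {c} {d} c₁ c₂ c₃ a≥0 b≥0 c≥0 d>0 n>0 ex ey en =
      unscale d>0 (cast ex ey en (total (zero⊎pos a≥0) (zero⊎pos b≥0) (zero⊎pos c≥0)))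
      where
      drop : ∀ {a x} y → a ≡ 0ℤ → a * x + y ≡ y
      drop {x = x} y refl = +-identityˡ y
      total : a ≡ 0ℤ ⊎ 0ℤ < a → b ≡ 0ℤ ⊎ 0ℤ < b → c ≡ 0ℤ ⊎ 0ℤ < c → C (a * _ + b * _ + c * _) (a * _ + b * _ + c * _) (a * _ + b * _ + c * _)
      total (inj₂ a>0) _ _ = add* (add* (scale a>0 c₁) b≥0 c₂) c≥0 c₃
      total (inj₁ a≡0) (inj₂ b>0) _ = add* (cast (sym (drop _ a≡0)) (sym (drop _ a≡0)) (sym (drop _ a≡0)) (scale b>0 c₂)) c≥0 c₃
      total (inj₁ a≡0) (inj₁ b≡0) (inj₂ c>0) = cast (sym (drop₂ _ _ _)) (sym (drop₂ _ _ _)) (sym (drop₂ _ _ _)) (scale c>0 c₃)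
        where
        drop₂ : ∀ x y z → a * x + b * y + z ≡ z
        drop₂ x y z = trans (cong₂ (λ a b → a * x + b * y + z) a≡0 b≡0) (+-identityˡ z)
      total (inj₁ a≡0) (inj₁ b≡0) (inj₁ c≡0) = contradiction (trans (sym (vanish _ _ _)) en) (<⇒≢ (*-pos d>0 n>0))
        where
        vanish : ∀ x y z → a * x + b * y + c * z ≡ 0ℤ
        vanish x y z = trans (cong₂ (λ a b → a * x + b * y + c * z) a≡0 b≡0) (cong (λ c → 0ℤ * x + 0ℤ * y + c * z) c≡0)

    -- The barycentric weights are a/d, b/d, c/d with denominators cleared; only the weight on the
    -- interior point has to be positive.
    combineO : ∀ {a b c d} → O x₁ y₁ n₁ → C x₂ y₂ n₂ → C x₃ y₃ n₃ → 0ℤ < a → NN b → NN c → 0ℤ < d →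
               a * x₁ + b * x₂ + c * x₃ ≡ d * x → a * y₁ + b * y₂ + c * y₃ ≡ d * y →
               a * n₁ + b * n₂ + c * n₃ ≡ d * n → O x y n
    combineO {x₁} {y₁} {n₁} {x₂} {y₂} {n₂} {x₃} {y₃} {n₃} {a = a} {b} {c} o c₂ c₃ a>0 b≥0 c≥0 d>0 ex ey en =
      O-unscale d>0
        (castO (trans (l a x₁ b x₂ c x₃) ex) (trans (l a y₁ b y₂ c y₃) ey) (trans (l a n₁ b n₂ c n₃) en)
          (O-add* (O-add* (O-add* o (Δ< a>0) (O⇒C o)) b≥0 c₂) c≥0 c₃))
      where
      l : ∀ a x b y c z → x + (a - 0ℤ - 1ℤ) * x + b * y + c * z ≡ a * x + b * y + c * z
      l = solve-∀

    private
      square-pos : ∀ a → a ≢ 0ℤ → 0ℤ < a * a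
      square-pos +0 h = contradiction refl h
      square-pos +[1+ m ] _ = +<+ (ℕ.s≤s ℕ.z≤n)
      square-pos -[1+ m ] _ = +<+ (ℕ.s≤s ℕ.z≤n)

      abs-bound : ∀ a → NN (+ ∣ a ∣ + a)
      abs-bound (+ m) = +≤+ ℕ.z≤n
      abs-bound -[1+ m ] = ≤-reflexive (sym (n⊖n≡0 (suc m)))

      displace : ∀ {E a₁ a₂ a₃ p q} → 0ℤ < E → C x₁ y₁ n₁ → C x₂ y₂ n₂ → C x₃ y₃ n₃ →
        a₁ * x₁ + a₂ * x₂ + a₃ * x₃ ≡ E * p → a₁ * y₁ + a₂ * y₂ + a₃ * y₃ ≡ E * q →
        a₁ * n₁ + a₂ * n₂ + a₃ * n₃ ≡ 0ℤ →
        ∃ λ a → 0ℤ < a × C (a * (x₁ + x₂ + x₃) + p) (a * (y₁ + y₂ + y₃) + q) (a * (n₁ + n₂ + n₃))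
      displace {x₁} {y₁} {n₁} {x₂} {y₂} {n₂} {x₃} {y₃} {n₃} {E} {a₁} {a₂} {a₃} {p} {q} E>0 c₁ c₂ c₃ ex ey en =
        a , a>0 , unscale E>0
          (cast (trans (sum₃ E a a₁ x₁ a₂ x₂ a₃ x₃) (trans (cong (_+_ (E * (a * (x₁ + x₂ + x₃)))) ex)
                         (sym (*-distribˡ-+ E (a * (x₁ + x₂ + x₃)) p))))
                (trans (sum₃ E a a₁ y₁ a₂ y₂ a₃ y₃) (trans (cong (_+_ (E * (a * (y₁ + y₂ + y₃)))) ey)
                         (sym (*-distribˡ-+ E (a * (y₁ + y₂ + y₃)) q))))
                (trans (sum₃ E a a₁ n₁ a₂ n₂ a₃ n₃) (trans (cong (_+_ (E * (a * (n₁ + n₂ + n₃)))) en)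
                         (+-identityʳ _)))
                (add (add (scale w₁ c₁) (scale w₂ c₂)) (scale w₃ c₃)))
        where
        m₁ = + ∣ a₁ ∣
        m₂ = + ∣ a₂ ∣
        m₃ = + ∣ a₃ ∣
        -- Large enough for every coefficient E a + aᵢ to be positive, since E ≥ 1.
        a = 1ℤ + m₁ + m₂ + m₃
        a>0 : 0ℤ < a
        a>0 = lin< (nat ∣ a₁ ∣ ⊹ nat ∣ a₂ ∣ ⊹ nat ∣ a₃ ∣) (l m₁ m₂ m₃)
          where
          l : ∀ r s t → 1ℤ + r + s + t - 0ℤ - 1ℤ ≡ r + s + t
          l = solve-∀
        w : ∀ {E e r s t} → 0ℤ < E → NN (r + e) → NN r → NN s → NN t → 0ℤ < E * (1ℤ + r + s + t) + e
        w {E} {e} {r} {s} {t} E>0 re r≥0 s≥0 t≥0 =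
          lin< (Δ< E>0 ⊠ (nat 1 ⊹ r≥0 ⊹ s≥0 ⊹ t≥0) ⊹ re ⊹ s≥0 ⊹ t≥0) (solve (E ∷ e ∷ r ∷ s ∷ t ∷ []))
        w₁ : 0ℤ < E * a + a₁
        w₁ = w E>0 (abs-bound a₁) (nat _) (nat _) (nat _)
        w₂ : 0ℤ < E * a + a₂
        w₂ = subst (λ t → 0ℤ < E * t + a₂) (l m₁ m₂ m₃) (w E>0 (abs-bound a₂) (nat _) (nat ∣ a₁ ∣) (nat ∣ a₃ ∣))
          where
          l : ∀ r s t → 1ℤ + s + r + t ≡ 1ℤ + r + s + t
          l = solve-∀
        w₃ : 0ℤ < E * a + a₃
        w₃ = subst (λ t → 0ℤ < E * t + a₃) (l m₁ m₂ m₃) (w E>0 (abs-bound a₃) (nat _) (nat ∣ a₁ ∣) (nat ∣ a₂ ∣))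
          where
          l : ∀ r s t → 1ℤ + t + r + s ≡ 1ℤ + r + s + t
          l = solve-∀
        sum₃ : ∀ E a a₁ x₁ a₂ x₂ a₃ x₃ → (E * a + a₁) * x₁ + (E * a + a₂) * x₂ + (E * a + a₃) * x₃
               ≡ E * (a * (x₁ + x₂ + x₃)) + (a₁ * x₁ + a₂ * x₂ + a₃ * x₃)
        sum₃ = solve-∀

    -- By Cramer's rule D (p , q , 0) is an integral combination of the three vectors.
    simplex : C x₁ y₁ n₁ → C x₂ y₂ n₂ → C x₃ y₃ n₃ → det x₁ y₁ n₁ x₂ y₂ n₂ x₃ y₃ n₃ ≢ 0ℤ →
              O (x₁ + x₂ + x₃) (y₁ + y₂ + y₃) (n₁ + n₂ + n₃)
    simplex {x₁} {y₁} {n₁} {x₂} {y₂} {n₂} {x₃} {y₃} {n₃} c₁ c₂ c₃ D≢0 = mkO λ p q →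
      displace {a₁ = D * b₁ p q} {D * b₂ p q} {D * b₃ p q} (square-pos D D≢0) c₁ c₂ c₃
        (factor D p (b₁ p q) x₁ (b₂ p q) x₂ (b₃ p q) x₃ (cramer-x x₁ y₁ n₁ x₂ y₂ n₂ x₃ y₃ n₃ p q))
        (factor D q (b₁ p q) y₁ (b₂ p q) y₂ (b₃ p q) y₃ (cramer-y x₁ y₁ n₁ x₂ y₂ n₂ x₃ y₃ n₃ p q))
        (factor₀ D (b₁ p q) n₁ (b₂ p q) n₂ (b₃ p q) n₃ (cramer-n x₁ y₁ n₁ x₂ y₂ n₂ x₃ y₃ n₃ p q))
      where
      D = det x₁ y₁ n₁ x₂ y₂ n₂ x₃ y₃ n₃
      b₁ b₂ b₃ : ℤ → ℤ → ℤ
      b₁ p q = p * (y₂ * n₃ - n₂ * y₃) - q * (x₂ * n₃ - n₂ * x₃)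
      b₂ p q = p * (y₃ * n₁ - n₃ * y₁) - q * (x₃ * n₁ - n₃ * x₁)
      b₃ p q = p * (y₁ * n₂ - n₁ * y₂) - q * (x₁ * n₂ - n₁ * x₂)
      factor : ∀ D p b₁ x₁ b₂ x₂ b₃ x₃ → b₁ * x₁ + b₂ * x₂ + b₃ * x₃ ≡ D * p →
               D * b₁ * x₁ + D * b₂ * x₂ + D * b₃ * x₃ ≡ D * D * p
      factor D p b₁ x₁ b₂ x₂ b₃ x₃ eq = trans (l D b₁ x₁ b₂ x₂ b₃ x₃)
        (trans (cong (D *_) eq) (sym (*-assoc D D p)))
        where
        l : ∀ D b₁ x₁ b₂ x₂ b₃ x₃ → D * b₁ * x₁ + D * b₂ * x₂ + D * b₃ * x₃ ≡ D * (b₁ * x₁ + b₂ * x₂ + b₃ * x₃)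
        l = solve-∀
      factor₀ : ∀ D b₁ x₁ b₂ x₂ b₃ x₃ → b₁ * x₁ + b₂ * x₂ + b₃ * x₃ ≡ D * 0ℤ →
                D * b₁ * x₁ + D * b₂ * x₂ + D * b₃ * x₃ ≡ 0ℤ
      factor₀ D b₁ x₁ b₂ x₂ b₃ x₃ eq = trans (factor D 0ℤ b₁ x₁ b₂ x₂ b₃ x₃ eq) (*-zeroʳ (D * D))
      cramer-x : ∀ x₁ y₁ n₁ x₂ y₂ n₂ x₃ y₃ n₃ p q →
        (p * (y₂ * n₃ - n₂ * y₃) - q * (x₂ * n₃ - n₂ * x₃)) * x₁
        + (p * (y₃ * n₁ - n₃ * y₁) - q * (x₃ * n₁ - n₃ * x₁)) * x₂
        + (p * (y₁ * n₂ - n₁ * y₂) - q * (x₁ * n₂ - n₁ * x₂)) * x₃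
        ≡ (x₁ * (y₂ * n₃ - n₂ * y₃) - y₁ * (x₂ * n₃ - n₂ * x₃) + n₁ * (x₂ * y₃ - y₂ * x₃)) * p
      cramer-x = solve-∀
      cramer-y : ∀ x₁ y₁ n₁ x₂ y₂ n₂ x₃ y₃ n₃ p q →
        (p * (y₂ * n₃ - n₂ * y₃) - q * (x₂ * n₃ - n₂ * x₃)) * y₁
        + (p * (y₃ * n₁ - n₃ * y₁) - q * (x₃ * n₁ - n₃ * x₁)) * y₂
        + (p * (y₁ * n₂ - n₁ * y₂) - q * (x₁ * n₂ - n₁ * x₂)) * y₃
        ≡ (x₁ * (y₂ * n₃ - n₂ * y₃) - y₁ * (x₂ * n₃ - n₂ * x₃) + n₁ * (x₂ * y₃ - y₂ * x₃)) * q
      cramer-y = solve-∀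
      cramer-n : ∀ x₁ y₁ n₁ x₂ y₂ n₂ x₃ y₃ n₃ p q →
        (p * (y₂ * n₃ - n₂ * y₃) - q * (x₂ * n₃ - n₂ * x₃)) * n₁
        + (p * (y₃ * n₁ - n₃ * y₁) - q * (x₃ * n₁ - n₃ * x₁)) * n₂
        + (p * (y₁ * n₂ - n₁ * y₂) - q * (x₁ * n₂ - n₁ * x₂)) * n₃
        ≡ (x₁ * (y₂ * n₃ - n₂ * y₃) - y₁ * (x₂ * n₃ - n₂ * x₃) + n₁ * (x₂ * y₃ - y₂ * x₃)) * 0ℤ
      cramer-n = solve-∀

    insideTriangle : ∀ {a b c d} → C x₁ y₁ n₁ → C x₂ y₂ n₂ → C x₃ y₃ n₃ → det x₁ y₁ n₁ x₂ y₂ n₂ x₃ y₃ n₃ ≢ 0ℤ →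
               0ℤ < a → 0ℤ < b → 0ℤ < c → 0ℤ < d →
               a * x₁ + b * x₂ + c * x₃ ≡ d * x → a * y₁ + b * y₂ + c * y₃ ≡ d * y →
               a * n₁ + b * n₂ + c * n₃ ≡ d * n → O x y n
    insideTriangle {x₁} {y₁} {n₁} {x₂} {y₂} {n₂} {x₃} {y₃} {n₃} {a = a} {b} {c} c₁ c₂ c₃ D≢0 a>0 b>0 c>0 d>0 ex ey en =
      O-unscale d>0 (castO (trans (l a b c x₁ x₂ x₃) ex) (trans (l a b c y₁ y₂ y₃) ey) (trans (l a b c n₁ n₂ n₃) en)
        (O-add* (O-add* (O-add* (simplex c₁ c₂ c₃ D≢0) (Δ< a>0) c₁) (Δ< b>0) c₂) (Δ< c>0) c₃))
      where
      l : ∀ a b c x y z → x + y + z + (a - 0ℤ - 1ℤ) * x + (b - 0ℤ - 1ℤ) * y + (c - 0ℤ - 1ℤ) * z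
          ≡ a * x + b * y + c * z
      l = solve-∀

    O-pos : O x y n → 0ℤ < n
    O-pos o = C-pos (O⇒C o)

    -- Absorption along a horizontal line: a point of the segment keeps a positive weight on the
    -- interior end as long as it differs from the other end.
    between : ∀ h → O x₁ (h * n₁) n₁ → C x₂ (h * n₂) n₂ → 0ℤ < n → x₁ * n ≤ x * n₁ → x * n₂ < x₂ * n →
              O x (h * n) n
    between {x₁} {n₁} {x₂} {n₂} {n} {x} h o c n>0 p q =
      combineO o c c e>0 (Δ p) (nat 0) d>0
        (solve (x ∷ n ∷ x₁ ∷ n₁ ∷ x₂ ∷ n₂ ∷ h ∷ []))
        (solve (x ∷ n ∷ x₁ ∷ n₁ ∷ x₂ ∷ n₂ ∷ h ∷ []))
        (solve (x ∷ n ∷ x₁ ∷ n₁ ∷ x₂ ∷ n₂ ∷ h ∷ []))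
      where
      e>0 : 0ℤ < x₂ * n - x * n₂
      e>0 = lin< (Δ< q) (solve (x ∷ n ∷ x₂ ∷ n₂ ∷ []))
      d>0 : 0ℤ < x₂ * n₁ - x₁ * n₂
      d>0 = *-cancel-pos n>0 (lin< ((Δ< e>0 ⊹ nat 1) ⊠ Δ< (O-pos o) ⊹ Δ< e>0 ⊹ Δ p ⊠ (<⇒≤ (C-pos c)))
              (solve (x ∷ n ∷ x₁ ∷ n₁ ∷ x₂ ∷ n₂ ∷ [])))

    between′ : ∀ h → O x₁ (h * n₁) n₁ → C x₂ (h * n₂) n₂ → 0ℤ < n → x * n₁ ≤ x₁ * n → x₂ * n < x * n₂ →
               O x (h * n) n
    between′ {x₁} {n₁} {x₂} {n₂} {n} {x} h o c n>0 p q =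
      combineO o c c e>0 (Δ p) (nat 0) d>0
        (solve (x ∷ n ∷ x₁ ∷ n₁ ∷ x₂ ∷ n₂ ∷ h ∷ []))
        (solve (x ∷ n ∷ x₁ ∷ n₁ ∷ x₂ ∷ n₂ ∷ h ∷ []))
        (solve (x ∷ n ∷ x₁ ∷ n₁ ∷ x₂ ∷ n₂ ∷ h ∷ []))
      where
      e>0 : 0ℤ < x * n₂ - x₂ * n
      e>0 = lin< (Δ< q) (solve (x ∷ n ∷ x₂ ∷ n₂ ∷ []))
      d>0 : 0ℤ < x₁ * n₂ - x₂ * n₁
      d>0 = *-cancel-pos n>0 (lin< ((Δ< e>0 ⊹ nat 1) ⊠ Δ< (O-pos o) ⊹ Δ< e>0 ⊹ Δ p ⊠ (<⇒≤ (C-pos c)))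
              (solve (x ∷ n ∷ x₁ ∷ n₁ ∷ x₂ ∷ n₂ ∷ [])))

    private
      meeting : ∀ {h u w a b x₁ y₁ n₁ x₂ y₂ n₂ x n} → C u (h * a) a → C w (h * b) b → 0ℤ < n →
        u * n < x * a → x * b < w * n →
        C x₁ y₁ n₁ → h * n₁ < y₁ → C x₂ y₂ n₂ → y₂ < h * n₂ →
        let r = h * n₂ - y₂
            s = y₁ - h * n₁
            N = r * (a + b + n₁) + s * (a + b + n₂) + 0ℤ * a
        in O (r * (u + w + x₁) + s * (u + w + x₂) + 0ℤ * u) (h * N) N
      meeting {h} {u} {w} {a} {b} {x₁} {y₁} {n₁} {x₂} {y₂} {n₂} {x} {n} cu cw n>0 u<x x<w c₁ above c₂ below =
        combineO (simplex cu cw c₁ D≢0) (add (add cu cw) c₂) cu r>0 (<⇒≤ s>0) (nat 0) 0<1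
          (sym (*-identityˡ _)) (l h u w a b y₁ n₁ y₂ n₂) (sym (*-identityˡ _))
        where
        l : ∀ h u w a b y₁ n₁ y₂ n₂ →
          (h * n₂ - y₂) * (h * a + h * b + y₁) + (y₁ - h * n₁) * (h * a + h * b + y₂) + 0ℤ * (h * a)
          ≡ 1ℤ * (h * ((h * n₂ - y₂) * (a + b + n₁) + (y₁ - h * n₁) * (a + b + n₂) + 0ℤ * a))
        l = solve-∀
        r>0 : 0ℤ < h * n₂ - y₂
        r>0 = lin< (Δ< below) (solve (h ∷ n₂ ∷ y₂ ∷ []))
        s>0 : 0ℤ < y₁ - h * n₁
        s>0 = lin< (Δ< above) (solve (h ∷ n₁ ∷ y₁ ∷ []))
        -- The terms in x cancel and leave n (w a - u b). The determinant is (w a - u b) `s`, chord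
        -- times height, so it cannot vanish.
        Z>0 : 0ℤ < (w * n - x * b) * a + (x * a - u * n) * b
        Z>0 = +-mono-< (*-pos right (C-pos cu)) (*-pos left (C-pos cw))
          where
          right : 0ℤ < w * n - x * b
          right = lin< (Δ< x<w) (solve (w ∷ n ∷ x ∷ b ∷ []))
          left : 0ℤ < x * a - u * n
          left = lin< (Δ< u<x) (solve (x ∷ a ∷ u ∷ n ∷ []))
        e : ∀ h u w a b x₁ y₁ n₁ x n →
          (y₁ - h * n₁) * ((w * n - x * b) * a + (x * a - u * n) * b)
          ≡ n * (u * (h * b * n₁ - b * y₁) - h * a * (w * n₁ - b * x₁) + a * (w * y₁ - h * b * x₁))
        e = solve-∀
        D≢0 : det u (h * a) a w (h * b) b x₁ y₁ n₁ ≢ 0ℤ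
        D≢0 D≡0 = <-irrefl refl (subst (0ℤ <_)
          (trans (e h u w a b x₁ y₁ n₁ x n) (trans (cong (n *_) D≡0) (*-zeroʳ n))) (*-pos s>0 Z>0))

    -- The segment joining (x₁, y₁, n₁) above the line to (x₂, y₂, n₂) below it meets the line in a
    -- point that becomes interior after averaging with the endpoints u and w; then absorb towards u or w.
    crossing : ∀ h {u w a b x₁ y₁ n₁ x₂ y₂ n₂ x n} → C u (h * a) a → C w (h * b) b → 0ℤ < n →
               u * n < x * a → x * b < w * n →
               C x₁ y₁ n₁ → h * n₁ < y₁ → C x₂ y₂ n₂ → y₂ < h * n₂ → O x (h * n) n
    crossing h {u} {w} {a} {b} {x₁} {y₁} {n₁} {x₂} {y₂} {n₂} {x} {n} cu cw n>0 u<x x<w c₁ above c₂ below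
      with G * n ≤? x * N
      where
      r = h * n₂ - y₂
      s = y₁ - h * n₁
      G = r * (u + w + x₁) + s * (u + w + x₂) + 0ℤ * u
      N = r * (a + b + n₁) + s * (a + b + n₂) + 0ℤ * a
    ... | yes p = between h (meeting {h} {x = x} cu cw n>0 u<x x<w c₁ above c₂ below) cw n>0 p x<w
    ... | no ¬p = between′ h (meeting {h} {x = x} cu cw n>0 u<x x<w c₁ above c₂ below) cu n>0 (<⇒≤ (≰⇒> ¬p)) u<x

    -- Bridges to an interior tested in the four axis directions only: m horizontal and m′ vertical
    -- steps, padded with copies of the centre, add up to e times the displaced point.
    axes⇒O : ∀ {e f} → 0ℤ < e → 0ℤ < f → C x y n →
      C (f * x + e) (f * y) (f * n) → C (f * x - e) (f * y) (f * n) →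
      C (f * x) (f * y + e) (f * n) → C (f * x) (f * y - e) (f * n) → O x y n
    axes⇒O {x} {y} {n} {e} {f} e>0 f>0 c right left up down = mkO λ p q → go p q (horizontal p) (vertical q)
      where
      horizontal : ∀ p → ∃ λ m → ∃ λ d → NN m × C (f * x + d) (f * y) (f * n) × m * d ≡ e * p
      horizontal (+ m) = + m , e , nat m , right , *-comm (+ m) e
      horizontal -[1+ m ] = + suc m , - e , nat (suc m) , left , l (+ suc m) e
        where
        l : ∀ m e → m * - e ≡ e * - m
        l = solve-∀
      vertical : ∀ q → ∃ λ m → ∃ λ d → NN m × C (f * x) (f * y + d) (f * n) × m * d ≡ e * q
      vertical (+ m) = + m , e , nat m , up , *-comm (+ m) e
      vertical -[1+ m ] = + suc m , - e , nat (suc m) , down , l (+ suc m) e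
        where
        l : ∀ m e → m * - e ≡ e * - m
        l = solve-∀
      go : ∀ p q → (∃ λ m → ∃ λ d → NN m × C (f * x + d) (f * y) (f * n) × m * d ≡ e * p) →
           (∃ λ m → ∃ λ d → NN m × C (f * x) (f * y + d) (f * n) × m * d ≡ e * q) →
           ∃ λ a → 0ℤ < a × C (a * x + p) (a * y + q) (a * n)
      go p q (m , d , m≥0 , ch , eh) (m′ , d′ , m′≥0 , cv , ev) = a , a>0 , unscale e>0
        (cast (trans (lx e m m′ f x d) (trans (cong (_+_ (e * (a * x))) eh) (sym (*-distribˡ-+ e (a * x) p))))
              (trans (ly e m m′ f y d′) (trans (cong (_+_ (e * (a * y))) ev) (sym (*-distribˡ-+ e (a * y) q))))
              (ln e m m′ f n)
              (add* (add* (scale t>0 c) m≥0 ch) m′≥0 cv))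
        where
        a = (m + m′) * f + 1ℤ
        t = e * a - (m + m′) * f
        a>0 : 0ℤ < a
        a>0 = lin< ((m≥0 ⊹ m′≥0) ⊠ <⇒≤ f>0) (l m m′ f)
          where
          l : ∀ m m′ f → (m + m′) * f + 1ℤ - 0ℤ - 1ℤ ≡ (m + m′) * f
          l = solve-∀
        t>0 : 0ℤ < t
        t>0 = lin< (Δ< e>0 ⊠ ((m≥0 ⊹ m′≥0) ⊠ <⇒≤ f>0) ⊹ Δ< e>0) (l e m m′ f)
          where
          l : ∀ e m m′ f → e * ((m + m′) * f + 1ℤ) - (m + m′) * f - 0ℤ - 1ℤ ≡ (e - 0ℤ - 1ℤ) * ((m + m′) * f) + (e - 0ℤ - 1ℤ)
          l = solve-∀
        lx : ∀ e m m′ f x d → (e * ((m + m′) * f + 1ℤ) - (m + m′) * f) * x + m * (f * x + d) + m′ * (f * x)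
             ≡ e * (((m + m′) * f + 1ℤ) * x) + m * d
        lx = solve-∀
        ly : ∀ e m m′ f y d → (e * ((m + m′) * f + 1ℤ) - (m + m′) * f) * y + m * (f * y) + m′ * (f * y + d)
             ≡ e * (((m + m′) * f + 1ℤ) * y) + m′ * d
        ly = solve-∀
        ln : ∀ e m m′ f n → (e * ((m + m′) * f + 1ℤ) - (m + m′) * f) * n + m * (f * n) + m′ * (f * n)
             ≡ e * (((m + m′) * f + 1ℤ) * n)
        ln = solve-∀

    O⇒axes : O x y n → ∃ λ a → 0ℤ < a ×
      C (a * x + 1ℤ) (a * y) (a * n) × C (a * x - 1ℤ) (a * y) (a * n) ×
      C (a * x) (a * y + 1ℤ) (a * n) × C (a * x) (a * y - 1ℤ) (a * n)
    O⇒axes {x} {y} {n} o = collect (move o 1ℤ 0ℤ) (move o -1ℤ 0ℤ) (move o 0ℤ 1ℤ) (move o 0ℤ -1ℤ)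
      where
      extend : ∀ a p q b → NN b → C (a * x + p) (a * y + q) (a * n) → C ((a + b) * x + p) ((a + b) * y + q) ((a + b) * n)
      extend a p q b b≥0 c = cast (l a b x p) (l a b y q) (sym (*-distribʳ-+ n a b)) (add* c b≥0 (O⇒C o))
        where
        l : ∀ a b x p → a * x + p + b * x ≡ (a + b) * x + p
        l = solve-∀
      collect : (∃ λ a → 0ℤ < a × C (a * x + 1ℤ) (a * y + 0ℤ) (a * n)) → (∃ λ a → 0ℤ < a × C (a * x + -1ℤ) (a * y + 0ℤ) (a * n)) →
                (∃ λ a → 0ℤ < a × C (a * x + 0ℤ) (a * y + 1ℤ) (a * n)) → (∃ λ a → 0ℤ < a × C (a * x + 0ℤ) (a * y + -1ℤ) (a * n)) →
                ∃ λ a → 0ℤ < a ×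
                C (a * x + 1ℤ) (a * y) (a * n) × C (a * x - 1ℤ) (a * y) (a * n) ×
                C (a * x) (a * y + 1ℤ) (a * n) × C (a * x) (a * y - 1ℤ) (a * n)
      collect (a₁ , p₁ , c₁) (a₂ , p₂ , c₂) (a₃ , p₃ , c₃) (a₄ , p₄ , c₄) =
        s , +-mono-<-≤ p₁ (<⇒≤ p₂ ⊹ <⇒≤ p₃ ⊹ <⇒≤ p₄) ,
        cast refl (+-identityʳ (s * y)) refl (extend a₁ 1ℤ 0ℤ (a₂ + a₃ + a₄) (<⇒≤ p₂ ⊹ <⇒≤ p₃ ⊹ <⇒≤ p₄) c₁) ,
        cast (cong (λ t → t * x + -1ℤ) (e₂ a₁ a₂ a₃ a₄)) (trans (cong (λ t → t * y + 0ℤ) (e₂ a₁ a₂ a₃ a₄)) (+-identityʳ (s * y)))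
          (cong (_* n) (e₂ a₁ a₂ a₃ a₄)) (extend a₂ -1ℤ 0ℤ (a₁ + a₃ + a₄) (<⇒≤ p₁ ⊹ <⇒≤ p₃ ⊹ <⇒≤ p₄) c₂) ,
        cast (trans (cong (λ t → t * x + 0ℤ) (e₃ a₁ a₂ a₃ a₄)) (+-identityʳ (s * x))) (cong (λ t → t * y + 1ℤ) (e₃ a₁ a₂ a₃ a₄))
          (cong (_* n) (e₃ a₁ a₂ a₃ a₄)) (extend a₃ 0ℤ 1ℤ (a₁ + a₂ + a₄) (<⇒≤ p₁ ⊹ <⇒≤ p₂ ⊹ <⇒≤ p₄) c₃) ,
        cast (trans (cong (λ t → t * x + 0ℤ) (e₄ a₁ a₂ a₃ a₄)) (+-identityʳ (s * x))) (cong (λ t → t * y + -1ℤ) (e₄ a₁ a₂ a₃ a₄))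
          (cong (_* n) (e₄ a₁ a₂ a₃ a₄)) (extend a₄ 0ℤ -1ℤ (a₁ + a₂ + a₃) (<⇒≤ p₁ ⊹ <⇒≤ p₂ ⊹ <⇒≤ p₃) c₄)
        where
        s = a₁ + (a₂ + a₃ + a₄)
        e₂ : ∀ a b c d → b + (a + c + d) ≡ a + (b + c + d)
        e₂ = solve-∀
        e₃ : ∀ a b c d → c + (a + b + d) ≡ a + (b + c + d)
        e₃ = solve-∀
        e₄ : ∀ a b c d → d + (a + b + c) ≡ a + (b + c + d)
        e₄ = solve-∀

  -- Unimodular changes of coordinates.

  -- The affine map (x , y) ↦ (a x + b y + e , c x + d y + f) of determinant s = ± 1.
  record Frame : Set where
    constructor frame
    field
      a b c d e f s : ℤ
      det≡s : a * d - b * c ≡ s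
      s²≡1 : s * s ≡ 1ℤ

    X Y : ℤ → ℤ → ℤ → ℤ
    X x y n = a * x + b * y + e * n
    Y x y n = c * x + d * y + f * n

  _⁻¹ : Frame → Frame
  frame a b c d e f s det≡s s²≡1 ⁻¹ = record
    { a = s * d ; b = - (s * b) ; c = - (s * c) ; d = s * a
    ; e = s * (b * f - d * e) ; f = s * (c * e - a * f) ; s = s
    ; det≡s = trans (l s a b c d) (trans (cong₂ _*_ s²≡1 det≡s) (*-identityˡ s)) ; s²≡1 = s²≡1 }
    where
    l : ∀ s a b c d → s * d * (s * a) - - (s * b) * - (s * c) ≡ s * s * (a * d - b * c)
    l = solve-∀

  module _ (φ : Frame) where
    open Frame φ
    private
      module ψ = Frame (φ ⁻¹)
      δ : s * (a * d - b * c) ≡ 1ℤ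
      δ = trans (cong (s *_) det≡s) s²≡1
      -- The inverse formulas hold modulo s (a d - b c) = 1. The ring solver proves them with the
      -- multiple of the difference made explicit, and that multiple vanishes.
      unit : ∀ {t u v} → t ≡ u + (s * (a * d - b * c) - 1ℤ) * v → t ≡ u
      unit {t} {u} {v} eq = trans eq (trans (cong (λ w → u + (w - 1ℤ) * v) δ) (+-identityʳ u))

    X-right : ∀ x y n → X (ψ.X x y n) (ψ.Y x y n) n ≡ x
    X-right x y n = unit (l a b c d e f s x y n)
      where
      l : ∀ a b c d e f s x y n →
        a * (s * d * x + - (s * b) * y + s * (b * f - d * e) * n)
        + b * (- (s * c) * x + s * a * y + s * (c * e - a * f) * n) + e * n
        ≡ x + (s * (a * d - b * c) - 1ℤ) * (x - e * n)
      l = solve-∀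

    Y-right : ∀ x y n → Y (ψ.X x y n) (ψ.Y x y n) n ≡ y
    Y-right x y n = unit (l a b c d e f s x y n)
      where
      l : ∀ a b c d e f s x y n →
        c * (s * d * x + - (s * b) * y + s * (b * f - d * e) * n)
        + d * (- (s * c) * x + s * a * y + s * (c * e - a * f) * n) + f * n
        ≡ y + (s * (a * d - b * c) - 1ℤ) * (y - f * n)
      l = solve-∀

    X-left : ∀ x y n → ψ.X (X x y n) (Y x y n) n ≡ x
    X-left x y n = unit (l a b c d e f s x y n)
      where
      l : ∀ a b c d e f s x y n →
        s * d * (a * x + b * y + e * n) + - (s * b) * (c * x + d * y + f * n) + s * (b * f - d * e) * n
        ≡ x + (s * (a * d - b * c) - 1ℤ) * x
      l = solve-∀

    Y-left : ∀ x y n → ψ.Y (X x y n) (Y x y n) n ≡ y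
    Y-left x y n = unit (l a b c d e f s x y n)
      where
      l : ∀ a b c d e f s x y n →
        - (s * c) * (a * x + b * y + e * n) + s * a * (c * x + d * y + f * n) + s * (c * e - a * f) * n
        ≡ y + (s * (a * d - b * c) - 1ℤ) * y
      l = solve-∀

  _∘ᶠ_ : Frame → Frame → Frame
  frame a b c d e f s det≡s s²≡1 ∘ᶠ frame a′ b′ c′ d′ e′ f′ s′ det≡s′ s²≡1′ = record
    { a = a * a′ + b * c′ ; b = a * b′ + b * d′ ; c = c * a′ + d * c′ ; d = c * b′ + d * d′
    ; e = a * e′ + b * f′ + e ; f = c * e′ + d * f′ + f ; s = s * s′
    ; det≡s = trans (l a b c d a′ b′ c′ d′) (cong₂ _*_ det≡s det≡s′)
    ; s²≡1 = trans (l′ s s′) (cong₂ _*_ s²≡1 s²≡1′) }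
    where
    l : ∀ a b c d a′ b′ c′ d′ → (a * a′ + b * c′) * (c * b′ + d * d′) - (a * b′ + b * d′) * (c * a′ + d * c′)
        ≡ (a * d - b * c) * (a′ * d′ - b′ * c′)
    l = solve-∀
    l′ : ∀ s s′ → s * s′ * (s * s′) ≡ s * s * (s′ * s′)
    l′ = solve-∀

  X-∘ : ∀ φ ψ x y n → Frame.X (φ ∘ᶠ ψ) x y n ≡ Frame.X φ (Frame.X ψ x y n) (Frame.Y ψ x y n) n
  X-∘ (frame a b c d e f s _ _) (frame a′ b′ c′ d′ e′ f′ s′ _ _) x y n = l a b e a′ b′ c′ d′ e′ f′ x y n
    where
    l : ∀ a b e a′ b′ c′ d′ e′ f′ x y n →
      (a * a′ + b * c′) * x + (a * b′ + b * d′) * y + (a * e′ + b * f′ + e) * n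
      ≡ a * (a′ * x + b′ * y + e′ * n) + b * (c′ * x + d′ * y + f′ * n) + e * n
    l = solve-∀

  Y-∘ : ∀ φ ψ x y n → Frame.Y (φ ∘ᶠ ψ) x y n ≡ Frame.Y φ (Frame.X ψ x y n) (Frame.Y ψ x y n) n
  Y-∘ (frame a b c d e f s _ _) (frame a′ b′ c′ d′ e′ f′ s′ _ _) x y n = l c d f a′ b′ c′ d′ e′ f′ x y n
    where
    l : ∀ a b e a′ b′ c′ d′ e′ f′ x y n →
      (a * a′ + b * c′) * x + (a * b′ + b * d′) * y + (a * e′ + b * f′ + e) * n
      ≡ a * (a′ * x + b′ * y + e′ * n) + b * (c′ * x + d′ * y + f′ * n) + e * n
    l = solve-∀

  -- A frame maps new coordinates to old ones, so the cone is composed with it, while given points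
  -- reach the new coordinates through the inverse.
  pullback : Cone → Frame → Cone
  pullback K φ = record
    { C = λ x y n → C (X x y n) (Y x y n) n
    ; C-pos = C-pos
    ; add = λ {x₁} {y₁} {n₁} {x₂} {y₂} {n₂} p q →
        cast (l a b e x₁ y₁ n₁ x₂ y₂ n₂) (l c d f x₁ y₁ n₁ x₂ y₂ n₂) refl (add p q)
    ; scale = λ {x} {y} {n} {t} t>0 p → cast (m t a b e x y n) (m t c d f x y n) refl (scale t>0 p)
    ; unscale = λ {x} {y} {n} {t} t>0 p →
        unscale t>0 (cast (sym (m t a b e x y n)) (sym (m t c d f x y n)) refl p)
    }
    where
    open Interior K using (C; C-pos; add; scale; unscale; cast)
    open Frame φ
    l : ∀ a b e x₁ y₁ n₁ x₂ y₂ n₂ → a * x₁ + b * y₁ + e * n₁ + (a * x₂ + b * y₂ + e * n₂)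
        ≡ a * (x₁ + x₂) + b * (y₁ + y₂) + e * (n₁ + n₂)
    l = solve-∀
    m : ∀ t a b e x y n → t * (a * x + b * y + e * n) ≡ a * (t * x) + b * (t * y) + e * (t * n)
    m = solve-∀

  module _ (K : Cone) (φ : Frame) where
    open Frame φ
    private
      module K = Interior K using (C; O; mkO; move; cast)
      module L = Interior (pullback K φ) using (C; O; mkO; move)

    O-pullback⁺ : K.O (X x y n) (Y x y n) n → L.O x y n
    O-pullback⁺ {x} {y} {n} o = L.mkO λ p q → go p q (K.move o (a * p + b * q) (c * p + d * q))
      where
      l : ∀ t a b e x y n p q → t * (a * x + b * y + e * n) + (a * p + b * q)
          ≡ a * (t * x + p) + b * (t * y + q) + e * (t * n)
      l = solve-∀
      go : ∀ p q → (∃ λ t → 0ℤ < t × K.C (t * X x y n + (a * p + b * q)) (t * Y x y n + (c * p + d * q)) (t * n)) →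
           ∃ λ t → 0ℤ < t × L.C (t * x + p) (t * y + q) (t * n)
      go p q (t , t>0 , h) = t , t>0 , K.cast (l t a b e x y n p q) (l t c d f x y n p q) refl h

    O-pullback⁻ : L.O x y n → K.O (X x y n) (Y x y n) n
    O-pullback⁻ {x} {y} {n} o = K.mkO λ p q → go p q (L.move o (s * (d * p - b * q)) (s * (a * q - c * p)))
      where
      unit : ∀ {t u v} → t ≡ u + (s * (a * d - b * c) - 1ℤ) * v → t ≡ u
      unit {t} {u} {v} eq = trans eq (trans (cong (λ w → u + (w - 1ℤ) * v) (trans (cong (s *_) det≡s) s²≡1))
                                            (+-identityʳ u))
      l : ∀ t s a b c d e x y n p q → a * (t * x + s * (d * p - b * q)) + b * (t * y + s * (a * q - c * p)) + e * (t * n)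
          ≡ t * (a * x + b * y + e * n) + p + (s * (a * d - b * c) - 1ℤ) * p
      l = solve-∀
      l′ : ∀ t s a b c d f x y n p q → c * (t * x + s * (d * p - b * q)) + d * (t * y + s * (a * q - c * p)) + f * (t * n)
          ≡ t * (c * x + d * y + f * n) + q + (s * (a * d - b * c) - 1ℤ) * q
      l′ = solve-∀
      go : ∀ p q → (∃ λ t → 0ℤ < t × L.C (t * x + s * (d * p - b * q)) (t * y + s * (a * q - c * p)) (t * n)) →
           ∃ λ t → 0ℤ < t × K.C (t * X x y n + p) (t * Y x y n + q) (t * n)
      go p q (t , t>0 , h) = t , t>0 ,
        K.cast (unit (l t s a b c d e x y n p q)) (unit (l′ t s a b c d f x y n p q)) refl h

  -- Convex sets with their lattice points listed.

  -- A convex set together with its finitely many interior (I) and boundary (B) lattice points.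
  record Config : Set₁ where
    field
      cone : Cone
    open Interior cone public
    field
      I B : List (ℤ × ℤ)
      I! : Unique I
      B! : Unique B
      I⇒O : (x , y) ∈ I → O x y 1ℤ
      O⇒I : O x y 1ℤ → (x , y) ∈ I
      B⇒C : (x , y) ∈ B → C x y 1ℤ
      B⇒¬O : (x , y) ∈ B → ¬ O x y 1ℤ
      ¬O⇒B : C x y 1ℤ → ¬ O x y 1ℤ → (x , y) ∈ B

    -- Decidable by searching the list, although `O` quantifies over all displacements.
    O? : ∀ x y → Dec (O x y 1ℤ)
    O? x y with mem (≡-dec _≟_ _≟_) (x , y) I
    ... | yes p = yes (I⇒O p)
    ... | no ¬p = no λ o → ¬p (O⇒I o)

    C⇒O⊎B : C x y 1ℤ → O x y 1ℤ ⊎ (x , y) ∈ B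
    C⇒O⊎B {x} {y} c with O? x y
    ... | yes o = inj₁ o
    ... | no ¬o = inj₂ (¬O⇒B c ¬o)

  module _ (K : Config) (φ : Frame) where
    open Config K using (cone; I; B; I!; B!; I⇒O; O⇒I; B⇒C; B⇒¬O; ¬O⇒B)
    open Frame φ
    private
      module ψ = Frame (φ ⁻¹)
      back : ℤ × ℤ → ℤ × ℤ
      back (x , y) = ψ.X x y 1ℤ , ψ.Y x y 1ℤ
      forth : ℤ × ℤ → ℤ × ℤ
      forth (x , y) = X x y 1ℤ , Y x y 1ℤ
      forth-back : ∀ z → forth (back z) ≡ z
      forth-back (x , y) = cong₂ _,_ (X-right φ x y 1ℤ) (Y-right φ x y 1ℤ)
      back-forth : ∀ z → back (forth z) ≡ z
      back-forth (x , y) = cong₂ _,_ (X-left φ x y 1ℤ) (Y-left φ x y 1ℤ)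
      ∈-back⁺ : ∀ {z L} → forth z ∈ L → z ∈ map back L
      ∈-back⁺ {z} {L} p = subst (_∈ map back L) (back-forth z) (∈-map⁺ back p)
      ∈-back⁻ : ∀ {z L} → z ∈ map back L → forth z ∈ L
      ∈-back⁻ {z} {L} p with ∈-map⁻ back p
      ... | w , w∈ , refl = subst (_∈ L) (sym (forth-back w)) w∈
      unique : ∀ {L} → Unique L → Unique (map back L)
      unique = map⁺ λ {z} {w} eq → trans (sym (forth-back z)) (trans (cong forth eq) (forth-back w))

    reframe : Config
    reframe = record
      { cone = pullback cone φ
      ; I = map back I ; B = map back B ; I! = unique I! ; B! = unique B!
      ; I⇒O = λ p → O-pullback⁺ cone φ (I⇒O (∈-back⁻ p))
      ; O⇒I = λ o → ∈-back⁺ (O⇒I (O-pullback⁻ cone φ o))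
      ; B⇒C = λ p → B⇒C (∈-back⁻ p)
      ; B⇒¬O = λ p o → B⇒¬O (∈-back⁻ p) (O-pullback⁻ cone φ o)
      ; ¬O⇒B = λ c ¬o → ∈-back⁺ (¬O⇒B c λ o → ¬o (O-pullback⁺ cone φ o))
      }

    length-I-reframe : length (Config.I reframe) ≡ length I
    length-I-reframe = length-map back I

    length-B-reframe : length (Config.B reframe) ≡ length B
    length-B-reframe = length-map back B

  -- Rows of lattice points and chords.

  module RowProperties (K : Config) where
    open Config K public

    crossing₁ : ∀ {h a b c x₁ y₁ n₁ x₂ y₂ n₂} → C a h 1ℤ → C c h 1ℤ → a < b → b < c →
                C x₁ y₁ n₁ → h * n₁ < y₁ → C x₂ y₂ n₂ → y₂ < h * n₂ → O b h 1ℤ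
    crossing₁ {h} {a} {b} {c} ca cc a<b b<c c₁ above c₂ below =
      castO refl (*-identityʳ h) refl
        (crossing h (cast refl (sym (*-identityʳ h)) refl ca) (cast refl (sym (*-identityʳ h)) refl cc) 0<1
          (subst₂ _<_ (sym (*-identityʳ a)) (sym (*-identityʳ b)) a<b)
          (subst₂ _<_ (sym (*-identityʳ b)) (sym (*-identityʳ c)) b<c) c₁ above c₂ below)

    -- A line with points of the set on both sides would make b interior. So a non-interior point
    -- strictly inside a chord turns its line into a supporting line; this is how edges are
    -- recognised.
    support : ∀ {h a b c x₁ y₁ n₁} → C a h 1ℤ → C c h 1ℤ → a < b → b < c → ¬ O b h 1ℤ →
              C x₁ y₁ n₁ → h * n₁ < y₁ → C x y n → h * n ≤ y
    support ca cc a<b b<c ¬o c₁ above c = ≮⇒≥ λ below → ¬o (crossing₁ ca cc a<b b<c c₁ above c below)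

    -- Of three boundary points on a line with points of the set on both sides, the middle one would
    -- be interior.
    row-B≤2 : ∀ {h x₁ y₁ n₁ x₂ y₂ n₂} → C x₁ y₁ n₁ → h * n₁ < y₁ → C x₂ y₂ n₂ → y₂ < h * n₂ →
              length (row h B) ℕ.≤ 2
    row-B≤2 {h} c₁ above c₂ below with three (row h B) (unique-row h B!)
    ... | inj₁ p = p
    ... | inj₂ (a , b , c , a∈ , b∈ , c∈ , a<b , b<c) = contradiction
      (crossing₁ (B⇒C (∈-row⁻ a∈)) (B⇒C (∈-row⁻ c∈)) a<b b<c c₁ above c₂ below) (B⇒¬O (∈-row⁻ b∈))

    O⇒above : O x y 1ℤ → ∃ λ x₁ → ∃ λ y₁ → ∃ λ n₁ → C x₁ y₁ n₁ × y * n₁ < y₁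
    O⇒above {x} {y} o with move o 0ℤ 1ℤ
    ... | t , t>0 , c = _ , _ , _ , c , lin< (nat 0) (l t y)
      where
      l : ∀ t y → t * y + 1ℤ - y * (t * 1ℤ) - 1ℤ ≡ 0ℤ
      l = solve-∀

    O⇒below : O x y 1ℤ → ∃ λ x₁ → ∃ λ y₁ → ∃ λ n₁ → C x₁ y₁ n₁ × y₁ < y * n₁
    O⇒below {x} {y} o with move o 0ℤ -1ℤ
    ... | t , t>0 , c = _ , _ , _ , c , lin< (nat 0) (l t y)
      where
      l : ∀ t y → y * (t * 1ℤ) - (t * y + -1ℤ) - 1ℤ ≡ 0ℤ
      l = solve-∀

    O⇒row-B≤2 : O x y 1ℤ → length (row y B) ℕ.≤ 2
    O⇒row-B≤2 o with O⇒above o | O⇒below o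
    ... | _ , _ , _ , c₁ , p | _ , _ , _ , c₂ , q = row-B≤2 c₁ p c₂ q

    meet : ∀ {h g} → C x₁ h n₁ → 0ℤ < h → C x₂ (- g) n₂ → 0ℤ < g →
           C (h * x₂ + g * x₁) 0ℤ (h * n₂ + g * n₁)
    meet {x₁} {n₁} {x₂} {n₂} {h} {g} c₁ h>0 c₂ g>0 =
      cast refl (l h g) refl (add (scale h>0 c₂) (scale g>0 c₁))
      where
      l : ∀ h g → h * - g + g * h ≡ 0ℤ
      l = solve-∀

    -- The open chord on the line y = 0 between the segments from (s , - g , l) to (t , h , k) and
    -- from (s′ , - g , l) to (t′ , h , k) is interior, so it contains at most |I| lattice points.
    module Chord {t t′ h k s s′ g l : ℤ} (h>0 : 0ℤ < h) (g>0 : 0ℤ < g)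
                 (ct : C t h k) (ct′ : C t′ h k) (cs : C s (- g) l) (cs′ : C s′ (- g) l) where

      private
        -- The segment from (s , - g , l) to (t , h , k) meets y = 0 at x = (h s + g t)/N.
        N = h * l + g * k
        N>0 : 0ℤ < N
        N>0 = C-pos (meet ct h>0 cs g>0)

      inside : ∀ X → h * s + g * t < N * X → N * X < h * s′ + g * t′ → O X 0ℤ 1ℤ
      inside X p q = crossing 0ℤ (meet ct h>0 cs g>0) (meet ct′ h>0 cs′ g>0) 0<1
        (subst₂ _<_ (sym (*-identityʳ (h * s + g * t))) (*-comm N X) p)
        (subst₂ _<_ (*-comm N X) (sym (*-identityʳ (h * s′ + g * t′))) q)
        ct h>0 cs (neg-mono-< g>0)

      open Gap {row 0ℤ I} {N} {h * s + g * t} {h * s′ + g * t′} N>0 (λ X p q → ∈-row⁺ (O⇒I (inside X p q))) public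
        using (bound; tight)

  Flat : Cone → Set
  Flat K = Σ Frame λ φ → ∀ {x y} → Cone.C (pullback K φ) x y 1ℤ → y ≡ 0ℤ ⊎ y ≡ -1ℤ

  identity : Frame
  identity = frame 1ℤ 0ℤ 0ℤ 1ℤ 0ℤ 0ℤ 1ℤ refl refl

  translate : ℤ → ℤ → Frame
  translate e f = frame 1ℤ 0ℤ 0ℤ 1ℤ e f 1ℤ refl refl

  flat-pullback : ∀ K φ → Flat (pullback K φ) → Flat K
  flat-pullback K φ (ψ , rows) = φ ∘ᶠ ψ , λ {x} {y} c → rows (cast (X-∘ φ ψ x y 1ℤ) (Y-∘ φ ψ x y 1ℤ) refl c)
    where open Interior K

  -- Lattice points on three consecutive rows.

  module ThreeRows (K : Config) where
    open RowProperties K using (cone; C; cast; O⇒C; I; B; I!; B!; I⇒O; O⇒I; B⇒C; B⇒¬O; C⇒O⊎B; row-B≤2; module Chord)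

    L : List (ℤ × ℤ)
    L = I ++ B

    L! : Unique L
    L! = ++⁺ I! B! λ { (i∈ , b∈) → B⇒¬O b∈ (I⇒O i∈) }

    ∈L⇒C : (x , y) ∈ L → C x y 1ℤ
    ∈L⇒C p with ∈-++⁻ I p
    ... | inj₁ i∈ = O⇒C (I⇒O i∈)
    ... | inj₂ b∈ = B⇒C b∈

    C⇒∈L : C x y 1ℤ → (x , y) ∈ L
    C⇒∈L c with C⇒O⊎B c
    ... | inj₁ o = ∈-++⁺ˡ (O⇒I o)
    ... | inj₂ b∈ = ∈-++⁺ʳ I b∈

    row-B≤row-L : ∀ h → length (row h B) ℕ.≤ length (row h L)
    row-B≤row-L h = unique-⊆-length (unique-row h B!) λ x∈ → ∈-row⁺ (∈-++⁺ʳ I (∈-row⁻ {L = B} x∈))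

    -- An empty outer row means flat. Otherwise, for outer rows of widths u and d, the chord at y =
    -- 0 has length at least (u + d)/2, so u + d ≤ 2 i + 2; the boundary has at most (u + 1) + 2 +
    -- (d + 1) points.
    three-rows : (∀ {x y} → C x y 1ℤ → y ∈ 1ℤ ∷ 0ℤ ∷ -1ℤ ∷ []) →
                 Flat cone ⊎ length B ℕ.≤ 2 ℕ.* length I ℕ.+ 6
    three-rows rows with span (row 1ℤ L) (unique-row 1ℤ L!) | span (row -1ℤ L) (unique-row -1ℤ L!)
    ... | inj₁ empty | _ = inj₁ (identity , λ {x} {y} c → low (rows (cast (lx x y) (ly x y) refl c)) (cast (lx x y) (ly x y) refl c))
      where
      lx : ∀ x y → 1ℤ * x + 0ℤ * y + 0ℤ * 1ℤ ≡ x
      lx = solve-∀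
      ly : ∀ x y → 0ℤ * x + 1ℤ * y + 0ℤ * 1ℤ ≡ y
      ly = solve-∀
      low : y ∈ 1ℤ ∷ 0ℤ ∷ -1ℤ ∷ [] → C x y 1ℤ → y ≡ 0ℤ ⊎ y ≡ -1ℤ
      low {x = x} (here refl) c with () ← subst (x ∈_) empty (∈-row⁺ (C⇒∈L c))
      low (there (here e)) _ = inj₁ e
      low (there (there (here e))) _ = inj₂ e
    ... | inj₂ _ | inj₁ empty = inj₁ (translate 0ℤ 1ℤ , λ {x} {y} c → high (rows (cast (lx x y) (ly x y) refl c)) (cast (lx x y) (ly x y) refl c))
      where
      lx : ∀ x y → 1ℤ * x + 0ℤ * y + 0ℤ * 1ℤ ≡ x
      lx = solve-∀
      ly : ∀ x y → 0ℤ * x + 1ℤ * y + 1ℤ * 1ℤ ≡ y + 1ℤ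
      ly = solve-∀
      e₁ : ∀ a b → a - b ≡ a + 1ℤ - (b + 1ℤ)
      e₁ = solve-∀
      high : y + 1ℤ ∈ 1ℤ ∷ 0ℤ ∷ -1ℤ ∷ [] → C x (y + 1ℤ) 1ℤ → y ≡ 0ℤ ⊎ y ≡ -1ℤ
      high {y = y} (here e) _ = inj₁ (shift e (e₁ y 0ℤ))
      high {y = y} (there (here e)) _ = inj₂ (shift e (e₁ y -1ℤ))
      high {x = x} (there (there (here e))) c with () ← subst (x ∈_) empty (∈-row⁺ (C⇒∈L (cast refl e refl c)))
    ... | inj₂ up | inj₂ down = inj₂ (begin
        length B ≤⟨ length≤rows (1ℤ ∷ 0ℤ ∷ -1ℤ ∷ []) B! (λ b∈ → rows (B⇒C b∈)) ⟩
        length (row 1ℤ B) ℕ.+ (length (row 0ℤ B) ℕ.+ (length (row -1ℤ B) ℕ.+ 0))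
          ≤⟨ ℕP.+-mono-≤ (ℕP.≤-trans (row-B≤row-L 1ℤ) U.length≤) (ℕP.+-mono-≤ (row-B≤2 cu 0<1 cd -<+)
               (ℕP.+-monoˡ-≤ 0 (ℕP.≤-trans (row-B≤row-L -1ℤ) D.length≤))) ⟩
        suc U.width ℕ.+ (2 ℕ.+ (suc D.width ℕ.+ 0)) ≡⟨ e U.width D.width ⟩
        U.width ℕ.+ D.width ℕ.+ 4 ≤⟨ ℕP.+-monoˡ-≤ 4 widths ⟩
        2 ℕ.* length I ℕ.+ 2 ℕ.+ 4 ≡⟨ ℕP.+-assoc (2 ℕ.* length I) 2 4 ⟩
        2 ℕ.* length I ℕ.+ 6 ∎)
      where
      open ℕP.≤-Reasoning
      module U = Span up
      module D = Span down
      cu = ∈L⇒C (∈-row⁻ U.low∈)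
      cu′ = ∈L⇒C (∈-row⁻ U.high∈)
      cd = ∈L⇒C (∈-row⁻ D.low∈)
      cd′ = ∈L⇒C (∈-row⁻ D.high∈)
      j = length (row 0ℤ I)
      e : ∀ u d → suc u ℕ.+ (2 ℕ.+ (suc d ℕ.+ 0)) ≡ u ℕ.+ d ℕ.+ 4
      e = ℕS.solve-∀
      e′ : ∀ a c u d j → 1ℤ * a + 1ℤ * c + (1ℤ * 1ℤ + 1ℤ * 1ℤ) * (1ℤ + j) - (1ℤ * (a + d) + 1ℤ * (c + u))
           ≡ + 2 * j + + 2 - (u + d)
      e′ = solve-∀
      widths : U.width ℕ.+ D.width ℕ.≤ 2 ℕ.* length I ℕ.+ 2
      widths = ℕP.≤-trans (drop‿+≤+ (subst (+ (U.width ℕ.+ D.width) ≤_) (cong (_+ + 2) (sym (pos-* 2 j)))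
          (lin (Δ (Chord.bound 0<1 0<1 cu cu′ cd cd′)) (sym (e′ D.low U.low (+ U.width) (+ D.width) (+ j))))))
        (ℕP.+-monoˡ-≤ 2 (ℕP.*-monoʳ-≤ 2 (length-row≤ 0ℤ I)))

  -- Cutting a convex set along y = 0.

  module Cut (K : Config) where
    open RowProperties K using (cone; C; C-pos; add; scale; unscale; O; mkO; move; cast; add*; O⇒C; I; B; I!; B!; I⇒O; O⇒I; B⇒C; B⇒¬O; ¬O⇒B; C⇒O⊎B)

    cut-cone : Cone
    cut-cone = record
      { C = λ x y n → C x y n × y ≤ 0ℤ
      ; C-pos = λ { (c , _) → C-pos c }
      ; add = λ { (c₁ , p₁) (c₂ , p₂) → add c₁ c₂ , +-mono-≤ p₁ p₂ }
      ; scale = λ { {y = y} {a = a} a>0 (c , p) → scale a>0 c , lin (<⇒≤ a>0 ⊠ Δ p) (l a y) }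
      ; unscale = λ { {y = y} a>0 (c , p) → unscale a>0 c , ≮⇒≥ (λ y>0 → <⇒≱ (*-pos a>0 y>0) p) }
      }
      where
      l : ∀ a y → 0ℤ - a * y ≡ a * (0ℤ - y)
      l = solve-∀

    private
      module K′ = Interior cut-cone using (C; O; mkO; move)

    O-cut⁻ : K′.O x y n → O x y n × y < 0ℤ
    O-cut⁻ {x} {y} {n} o = mkO (λ p q → forget (K′.move o p q)) , ≰⇒> λ y≥0 → too-high y≥0 (K′.move o 0ℤ 1ℤ)
      where
      forget : ∀ {p q} → (∃ λ t → 0ℤ < t × K′.C (t * x + p) (t * y + q) (t * n)) →
               ∃ λ t → 0ℤ < t × C (t * x + p) (t * y + q) (t * n)
      forget (t , t>0 , c , _) = t , t>0 , c
      too-high : 0ℤ ≤ y → ¬ ∃ λ t → 0ℤ < t × K′.C (t * x + 0ℤ) (t * y + 1ℤ) (t * n)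
      too-high y≥0 (t , t>0 , _ , le) = absurd (<⇒≤ t>0 ⊠ y≥0 ⊹ Δ le) (solve (t ∷ y ∷ []))

    O-cut⁺ : O x y n → y < 0ℤ → K′.O x y n
    O-cut⁺ {x} {y} {n} o y<0 = K′.mkO λ p q → go p q (move o p q)
      where
      l : ∀ t m x p → t * x + p + m * x ≡ (t + m) * x + p
      l = solve-∀
      abs : ∀ q → NN (+ ∣ q ∣ - q)
      abs (+ m) = ≤-reflexive (sym (+-inverseʳ (+ m)))
      abs -[1+ m ] = +≤+ ℕ.z≤n
      go : ∀ p q → (∃ λ t → 0ℤ < t × C (t * x + p) (t * y + q) (t * n)) →
           ∃ λ t → 0ℤ < t × K′.C (t * x + p) (t * y + q) (t * n)
      -- As y ≤ -1, raising the factor by |q| keeps the displaced point below the line.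
      go p q (t , t>0 , c) = t + + ∣ q ∣ , +-mono-<-≤ t>0 (nat ∣ q ∣) ,
        cast (l t m x p) (l t m y q) (l′ t m n) (add* c (nat ∣ q ∣) (O⇒C o)) ,
        lin ((<⇒≤ t>0 ⊹ nat ∣ q ∣) ⊠ Δ< y<0 ⊹ abs q ⊹ <⇒≤ t>0) (l″ t m y q)
        where
        m = + ∣ q ∣
        l′ : ∀ t m n → t * n + m * n ≡ (t + m) * n
        l′ = solve-∀
        l″ : ∀ t m y q → 0ℤ - ((t + m) * y + q) ≡ (t + m) * (0ℤ - y - 1ℤ) + (m - q) + t
        l″ = solve-∀

    private
      I₀ : List (ℤ × ℤ)
      I₀ = map (_, 0ℤ) (row 0ℤ I)

      ∈I₀⁻ : (x , y) ∈ I₀ → y ≡ 0ℤ × O x 0ℤ 1ℤ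
      ∈I₀⁻ p with ∈-map⁻ (_, 0ℤ) p
      ... | _ , q , refl = refl , I⇒O (∈-row⁻ q)

      I₀! : Unique I₀
      I₀! = map⁺ (cong proj₁) (unique-row 0ℤ I!)

      negative? : (z : ℤ × ℤ) → Dec (proj₂ z < 0ℤ)
      negative? z = proj₂ z <? 0ℤ

      nonpositive? : (z : ℤ × ℤ) → Dec (proj₂ z ≤ 0ℤ)
      nonpositive? z = proj₂ z ≤? 0ℤ

      B⁻ : List (ℤ × ℤ)
      B⁻ = filter nonpositive? B

    -- The interior lattice points on the cutting line become boundary points of the piece below it.
    cut : Config
    cut = record
      { cone = cut-cone
      ; I = filter negative? I
      ; B = B⁻ ++ I₀
      ; I! = filter⁺ negative? I!
      ; B! = ++⁺ (filter⁺ nonpositive? B!) I₀! disjoint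
      ; I⇒O = λ p → let q , y<0 = ∈-filter⁻ negative? p in O-cut⁺ (I⇒O q) y<0
      ; O⇒I = λ o → let o′ , y<0 = O-cut⁻ o in ∈-filter⁺ negative? (O⇒I o′) y<0
      ; B⇒C = B⇒C′
      ; B⇒¬O = B⇒¬O′
      ; ¬O⇒B = ¬O⇒B′
      }
      where
      disjoint : ∀ {z} → ¬ (z ∈ B⁻ × z ∈ I₀)
      disjoint (p , q) with ∈I₀⁻ q
      ... | refl , o = B⇒¬O (proj₁ (∈-filter⁻ nonpositive? p)) o
      B⇒C′ : (x , y) ∈ B⁻ ++ I₀ → K′.C x y 1ℤ
      B⇒C′ p with ∈-++⁻ B⁻ p
      ... | inj₁ q = let q′ , le = ∈-filter⁻ nonpositive? q in B⇒C q′ , le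
      ... | inj₂ q with ∈I₀⁻ q
      ...   | refl , o = O⇒C o , ≤-refl
      B⇒¬O′ : (x , y) ∈ B⁻ ++ I₀ → ¬ K′.O x y 1ℤ
      B⇒¬O′ p o with ∈-++⁻ B⁻ p
      ... | inj₁ q = B⇒¬O (proj₁ (∈-filter⁻ nonpositive? q)) (proj₁ (O-cut⁻ o))
      ... | inj₂ q with ∈I₀⁻ q
      ...   | refl , _ = <-irrefl refl (proj₂ (O-cut⁻ o))
      ¬O⇒B′ : K′.C x y 1ℤ → ¬ K′.O x y 1ℤ → (x , y) ∈ B⁻ ++ I₀
      ¬O⇒B′ {x} {y} (c , le) ¬o with C⇒O⊎B c
      ... | inj₂ q = ∈-++⁺ˡ (∈-filter⁺ nonpositive? q le)
      ... | inj₁ o with y <? 0ℤ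
      ...   | yes y<0 = contradiction (O-cut⁺ o y<0) ¬o
      ...   | no y≮0 with ≤-antisym le (≮⇒≥ y≮0)
      ...     | refl = ∈-++⁺ʳ B⁻ (∈-map⁺ _ (∈-row⁺ (O⇒I o)))

    cut-I : length (Config.I cut) ℕ.+ length (row 0ℤ I) ℕ.≤ length I
    cut-I = subst (ℕ._≤ length I) (trans (length-++ (Config.I cut)) (cong (length (Config.I cut) ℕ.+_) (length-map _ (row 0ℤ I))))
      (unique-⊆-length (++⁺ (Config.I! cut) I₀! disjoint) sub)
      where
      disjoint : ∀ {z} → ¬ (z ∈ filter negative? I × z ∈ I₀)
      disjoint (p , q) with ∈I₀⁻ q
      ... | refl , _ = <-irrefl refl (proj₂ (∈-filter⁻ negative? {xs = I} p))
      sub : ∀ {z} → z ∈ filter negative? I ++ I₀ → z ∈ I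
      sub p with ∈-++⁻ (filter negative? I) p
      ... | inj₁ q = proj₁ (∈-filter⁻ negative? q)
      ... | inj₂ q with ∈I₀⁻ q
      ...   | refl , o = O⇒I o

    -- Above the line only the boundary points of row 1 are lost, while the interior points on the
    -- line are gained.
    cut-B : (∀ {x y} → C x y 1ℤ → y ≤ 1ℤ) →
            length B ℕ.+ length (row 0ℤ I) ℕ.≤ length (Config.B cut) ℕ.+ length (row 1ℤ B)
    cut-B low = begin
      length B ℕ.+ length (row 0ℤ I)
        ≤⟨ ℕP.+-monoˡ-≤ (length (row 0ℤ I)) (unique-⊆-length B! sub) ⟩
      length (B⁻ ++ map (_, 1ℤ) (row 1ℤ B)) ℕ.+ length (row 0ℤ I)
        ≡⟨ cong (ℕ._+ length (row 0ℤ I)) (trans (length-++ B⁻) (cong (length B⁻ ℕ.+_) (length-map _ (row 1ℤ B)))) ⟩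
      length B⁻ ℕ.+ length (row 1ℤ B) ℕ.+ length (row 0ℤ I)
        ≡⟨ e (length B⁻) (length (row 1ℤ B)) (length (row 0ℤ I)) ⟩
      length B⁻ ℕ.+ length (row 0ℤ I) ℕ.+ length (row 1ℤ B)
        ≡⟨ cong (ℕ._+ length (row 1ℤ B))
             (sym (trans (length-++ B⁻) (cong (length B⁻ ℕ.+_) (length-map (_, 0ℤ) (row 0ℤ I))))) ⟩
      length (B⁻ ++ I₀) ℕ.+ length (row 1ℤ B) ∎
      where
      open ℕP.≤-Reasoning
      e : ∀ a b c → a ℕ.+ b ℕ.+ c ≡ a ℕ.+ c ℕ.+ b
      e = ℕS.solve-∀
      sub : ∀ {z} → z ∈ B → z ∈ B⁻ ++ map (_, 1ℤ) (row 1ℤ B)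
      sub {x , y} p with y ≤? 0ℤ
      ... | yes le = ∈-++⁺ˡ (∈-filter⁺ nonpositive? p le)
      ... | no ¬le with ≤-antisym (low (B⇒C p)) (i<j⇒suc[i]≤j (≰⇒> ¬le))
      ...   | refl = ∈-++⁺ʳ B⁻ (∈-map⁺ _ (∈-row⁺ p))

  -- An edge of the hull of the interior lattice points as coordinate axis.

  module HullEdges where

    open import Data.List.Relation.Unary.All as All using (All; []; _∷_)
    open import Data.List.Relation.Unary.AllPairs using ([]; _∷_)

    record Primitive (u v : ℤ) : Set where
      field
        g p q r t : ℤ
        g>0 : 0ℤ < g
        u≡ : u ≡ g * p
        v≡ : v ≡ g * q
        bézout : p * r + q * t ≡ 1ℤ

    primitiveVector : ∀ u v → ¬ (u ≡ 0ℤ × v ≡ 0ℤ) → Primitive u v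
    primitiveVector u v ≢0 with Bézout.lemma ∣ u ∣ ∣ v ∣
    ... | Bézout.result d gcd identity with GCD.commonDivisor gcd
    ...   | divides m um , divides n vn = build d {m} {n} um vn identity
      where
      signed : ∀ a → ∃ λ σ → σ * σ ≡ 1ℤ × a ≡ σ * + ∣ a ∣
      signed (+ k) = 1ℤ , refl , sym (*-identityˡ (+ k))
      signed -[1+ k ] = -1ℤ , refl , sym (-1*i≡-i +[1+ k ])
      factored : ∀ {a σ m d} → a ≡ σ * + ∣ a ∣ → ∣ a ∣ ≡ m ℕ.* d → a ≡ + d * (σ * + m)
      factored {a} {σ} {m} {d} e e′ = trans e (trans (cong (σ *_) (trans (cong +_ e′) (pos-* m d))) (l σ (+ m) (+ d)))
        where
        l : ∀ σ m d → σ * (m * d) ≡ d * (σ * m)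
        l = solve-∀
      coefficients : ∀ {d m n x y} .{{_ : ℕ.NonZero d}} → d ℕ.+ y ℕ.* (n ℕ.* d) ≡ x ℕ.* (m ℕ.* d) →
                     1ℤ ≡ + x * + m - + y * + n
      coefficients {d} {m} {n} {x} {y} eq = shift
        (*-cancelˡ-≡ (+ d) (1ℤ + + y * + n) (+ x * + m) (trans (l₁ (+ d) (+ y) (+ n)) (trans ℤeq (l₂ (+ d) (+ x) (+ m)))))
        (l₃ (+ x) (+ m) (+ y) (+ n))
        where
        l₁ : ∀ d y n → d * (1ℤ + y * n) ≡ d + y * (n * d)
        l₁ = solve-∀
        l₂ : ∀ d x m → x * (m * d) ≡ d * (x * m)
        l₂ = solve-∀
        l₃ : ∀ x m y n → 1ℤ - (x * m - y * n) ≡ 1ℤ + y * n - x * m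
        l₃ = solve-∀
        product : ∀ a b c → + (a ℕ.* (b ℕ.* c)) ≡ + a * (+ b * + c)
        product a b c = trans (pos-* a (b ℕ.* c)) (cong (+ a *_) (pos-* b c))
        ℤeq : + d + + y * (+ n * + d) ≡ + x * (+ m * + d)
        ℤeq = trans (cong (_+_ (+ d)) (sym (product y n d))) (trans (cong +_ eq) (product x m d))
      build : ∀ d {m n} → ∣ u ∣ ≡ m ℕ.* d → ∣ v ∣ ≡ n ℕ.* d → Bézout.Identity d ∣ u ∣ ∣ v ∣ → Primitive u v
      build zero {m} {n} um vn _ = contradiction
        (∣i∣≡0⇒i≡0 (trans um (ℕP.*-zeroʳ m)) , ∣i∣≡0⇒i≡0 (trans vn (ℕP.*-zeroʳ n))) ≢0
      build d@(suc _) {m} {n} um vn identity with signed u | signed v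
      ... | σ , σ² , eu | τ , τ² , ev = record
        { g = + d ; p = σ * + m ; q = τ * + n ; r = σ * ρ ; t = τ * θ
        ; g>0 = +<+ (ℕ.s≤s ℕ.z≤n) ; u≡ = factored {u} {σ} {m} eu um ; v≡ = factored {v} {τ} {n} ev vn
        ; bézout = trans (l σ τ (+ m) (+ n) ρ θ)
            (trans (cong₂ (λ a b → a * (+ m * ρ) + b * (+ n * θ)) σ² τ²)
              (trans (l′ (+ m) (+ n) ρ θ) (sym (proj₂ (proj₂ (solution identity))))))
        }
        where
        solution : Bézout.Identity d ∣ u ∣ ∣ v ∣ → ∃ λ ρ → ∃ λ θ → 1ℤ ≡ + m * ρ + + n * θ
        solution (Bézout.+- x y eq) = + x , - + y ,
          trans (coefficients {d} {m} {n} {x} {y}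
                  (subst₂ (λ a b → d ℕ.+ y ℕ.* b ≡ x ℕ.* a) um vn eq)) (l (+ x) (+ m) (+ y) (+ n))
          where
          l : ∀ x m y n → x * m - y * n ≡ m * x + n * - y
          l = solve-∀
        solution (Bézout.-+ x y eq) = - + x , + y ,
          trans (coefficients {d} {n} {m} {y} {x}
                  (subst₂ (λ a b → d ℕ.+ x ℕ.* a ≡ y ℕ.* b) um vn eq)) (l (+ x) (+ m) (+ y) (+ n))
          where
          l : ∀ x m y n → y * n - x * m ≡ m * - x + n * y
          l = solve-∀
        ρ = proj₁ (solution identity)
        θ = proj₁ (proj₂ (solution identity))
        l : ∀ σ τ m n ρ θ → σ * m * (σ * ρ) + τ * n * (τ * θ) ≡ σ * σ * (m * ρ) + τ * τ * (n * θ)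
        l = solve-∀
        l′ : ∀ m n ρ θ → 1ℤ * (m * ρ) + 1ℤ * (n * θ) ≡ m * ρ + n * θ
        l′ = solve-∀

    -- The new x-axis points along the primitive vector (p , q); the Bézout pair completes it to a
    -- basis of determinant 1.
    alongAxis : ∀ e f {u v} → Primitive u v → Frame
    alongAxis e f π = record
      { a = p ; b = - t ; c = q ; d = r ; e = e ; f = f ; s = 1ℤ
      ; det≡s = trans (l p q r t) bézout ; s²≡1 = refl }
      where
      open Primitive π
      l : ∀ p q r t → p * r - - t * q ≡ p * r + q * t
      l = solve-∀

    -- All vectors point into the open half-plane y < 0, where the sign of the determinant orders
    -- directions by angle; the result is an extreme direction.
    steepest : ∀ u us → All (λ u → proj₂ u < 0ℤ) (u ∷ us) →
               ∃ λ v → v ∈ u ∷ us × (∀ {w} → w ∈ u ∷ us → NN (proj₁ w * proj₂ v - proj₂ w * proj₁ v))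
    steepest u [] _ = u , here refl , λ { (here refl) → ≤-reflexive (l (proj₁ u) (proj₂ u)) }
      where
      l : ∀ x y → 0ℤ ≡ x * y - y * x
      l = solve-∀
    steepest u (u′ ∷ us) (u<0 ∷ us<0) with steepest u′ us us<0
    ... | v , v∈ , best with 0ℤ ≤? proj₁ u * proj₂ v - proj₂ u * proj₁ v
    ...   | yes p = v , there v∈ , λ { (here refl) → p ; (there w∈) → best w∈ }
    ...   | no ¬p = u , here refl , λ { (here refl) → ≤-reflexive (l (proj₁ u) (proj₂ u))
               ; {w} (there w∈) → compare (proj₁ v) (proj₂ v) (proj₁ u) (proj₂ u) (proj₁ w) (proj₂ w)
                                    (All.lookup us<0 v∈) u<0 (All.lookup us<0 w∈) (≰⇒> ¬p) (best w∈) }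
      where
      l : ∀ x y → 0ℤ ≡ x * y - y * x
      l = solve-∀
      -- Transitivity of the angular order. With [ab] for the determinant of the vectors a and b, y₁
      -- [32] = y₂ [31] - y₃ [21], and the signs on the right make it negative.
      compare : ∀ x₁ y₁ x₂ y₂ x₃ y₃ → y₁ < 0ℤ → y₂ < 0ℤ → y₃ < 0ℤ → x₂ * y₁ - y₂ * x₁ < 0ℤ → NN (x₃ * y₁ - y₃ * x₁) →
                NN (x₃ * y₂ - y₃ * x₂)
      compare x₁ y₁ x₂ y₂ x₃ y₃ n₁ n₂ n₃ h h′ with 0ℤ ≤? x₃ * y₂ - y₃ * x₂
      ... | yes p = p
      ... | no ¬p = ⊥-elim (absurd
        (Δ< n₁ ⊠ (Δ< (≰⇒> ¬p) ⊹ nat 1) ⊹ Δ< (≰⇒> ¬p) ⊹ h′ ⊠ (Δ< n₂ ⊹ nat 1) ⊹ (Δ< h ⊹ nat 1) ⊠ (Δ< n₃ ⊹ nat 1))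
        (plücker x₁ y₁ x₂ y₂ x₃ y₃))
        where
        plücker : ∀ x₁ y₁ x₂ y₂ x₃ y₃ →
          (0ℤ - y₁ - 1ℤ) * (0ℤ - (x₃ * y₂ - y₃ * x₂) - 1ℤ + 1ℤ) + (0ℤ - (x₃ * y₂ - y₃ * x₂) - 1ℤ)
          + (x₃ * y₁ - y₃ * x₁) * (0ℤ - y₂ - 1ℤ + 1ℤ)
          + (0ℤ - (x₂ * y₁ - y₂ * x₁) - 1ℤ + 1ℤ) * (0ℤ - y₃ - 1ℤ + 1ℤ) ≡ -1ℤ
        plücker = solve-∀

    module _ (K : Config) where
      open RowProperties K using (cone; O; castO; O⇒C; combineO; I; I!; I⇒O; O⇒I)

      -- An edge of the convex hull of the interior lattice points.
      record Edge : Set where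
        field
          x₀ y₀ u v : ℤ
          start : O x₀ y₀ 1ℤ
          end : O (x₀ + u) (y₀ + v) 1ℤ
          ≢0 : ¬ (u ≡ 0ℤ × v ≡ 0ℤ)
          side : ∀ {x y} → O x y 1ℤ → NN ((x - x₀) * v - (y - y₀) * u)

      -- If the highest row of interior lattice points has two of them, it contains an edge. If it
      -- has one, the extreme direction from that point to the others gives an edge.
      edge : 2 ℕ.≤ length I → Edge
      edge two with I in I≡
      edge (ℕ.s≤s ()) | _ ∷ []
      edge _ | z₁ ∷ z₂ ∷ zs = top (maximum (proj₂ z₁) (map proj₂ (z₂ ∷ zs)))
        where
        ∈I : ∀ {z} → z ∈ z₁ ∷ z₂ ∷ zs → z ∈ I
        ∈I {z} = subst (z ∈_) (sym I≡)
        I∈ : ∀ {z} → z ∈ I → z ∈ z₁ ∷ z₂ ∷ zs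
        I∈ {z} = subst (z ∈_) I≡
        z₁≢z₂ : z₁ ≢ z₂
        z₁≢z₂ with subst Unique I≡ I!
        ... | (z₁≢z₂ ∷ _) ∷ _ = z₁≢z₂
        top : (∃ λ h → h ∈ map proj₂ (z₁ ∷ z₂ ∷ zs) × (∀ {y} → y ∈ map proj₂ (z₁ ∷ z₂ ∷ zs) → y ≤ h)) → Edge
        top (h , h∈ , ≤h) with ∈-map⁻ proj₂ h∈
        ... | (x , _) , z∈ , refl with span (row h I) (unique-row h I!)
        ...   | inj₁ empty with () ← subst (x ∈_) empty (∈-row⁺ (∈I z∈))
        ...   | inj₂ record { low = low ; width = width ; low∈ = low∈ ; high∈ = high∈ ; low≤ = low≤ ; ≤high = ≤high } = go width high∈ ≤high
          where
          ≤top : ∀ {x y} → O x y 1ℤ → y ≤ h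
          ≤top o = ≤h (∈-map⁺ proj₂ (I∈ (O⇒I o)))
          lower? : (z : ℤ × ℤ) → Dec (proj₂ z < h)
          lower? z = proj₂ z <? h
          diff : ℤ × ℤ → ℤ × ℤ
          diff (x , y) = x - low , y - h
          go : ∀ w → low + + w ∈ row h I → (∀ {x} → x ∈ row h I → x ≤ low + + w) → Edge
          go (suc w) high∈ _ = record
            { x₀ = low ; y₀ = h ; u = + suc w ; v = 0ℤ ; start = I⇒O (∈-row⁻ low∈)
            ; end = castO refl (sym (+-identityʳ h)) refl (I⇒O (∈-row⁻ high∈))
            ; ≢0 = λ () ; side = λ {x} {y} o → subst NN (l x low y h (+ suc w)) (Δ (≤top o) ⊠ nat (suc w)) }
            where
            l : ∀ x low y h w → (h - y) * w ≡ (x - low) * 0ℤ - (y - h) * w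
            l = solve-∀
          go zero _ ≤low = choose _ refl
            where
            apex : ∀ {x} → (x , h) ∈ I → x ≡ low
            apex p = ≤-antisym (subst (_ ≤_) (+-identityʳ low) (≤low (∈-row⁺ p))) (low≤ (∈-row⁺ p))
            descend : ∀ z → z ∈ map diff (filter lower? I) → proj₂ z < 0ℤ
            descend _ p with ∈-map⁻ diff p
            ... | (x , y) , q , refl = lin< (Δ< (proj₂ (∈-filter⁻ lower? {xs = I} q))) (l y h)
              where
              l : ∀ y h → 0ℤ - (y - h) - 1ℤ ≡ h - y - 1ℤ
              l = solve-∀
            either : ∀ {x y} → (x , y) ∈ I → (x , y) ≡ (low , h) ⊎ diff (x , y) ∈ map diff (filter lower? I)
            either {x} {y} p with y <? h
            ... | yes y<h = inj₂ (∈-map⁺ diff (∈-filter⁺ lower? p y<h))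
            ... | no y≮h with ≤-antisym (≤top (I⇒O p)) (≮⇒≥ y≮h)
            ...   | refl = inj₁ (cong (_, h) (apex p))
            choose : ∀ ds → map diff (filter lower? I) ≡ ds → Edge
            choose [] eq with either (∈I (here refl)) | either (∈I (there (here refl)))
            ... | inj₁ e₁ | inj₁ e₂ = contradiction (trans e₁ (sym e₂)) z₁≢z₂
            ... | inj₂ p | _ with () ← subst (_ ∈_) eq p
            ... | inj₁ _ | inj₂ p with () ← subst (_ ∈_) eq p
            choose (d ∷ ds) eq with steepest d ds (All.tabulate λ {z} p → descend z (subst (z ∈_) (sym eq) p))
            ... | (u , v) , p , best = record
              { x₀ = low ; y₀ = h ; u = u ; v = v ; start = I⇒O (∈-row⁻ low∈)
              ; end = end (∈-map⁻ diff (subst (_ ∈_) (sym eq) p))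
              ; ≢0 = λ { (_ , v≡0) → <-irrefl v≡0 (descend (u , v) (subst ((u , v) ∈_) (sym eq) p)) }
              ; side = λ {x} {y} o → side x y (either (O⇒I o)) }
              where
              l : ∀ x low → x ≡ low + (x - low)
              l = solve-∀
              end : (∃ λ z → z ∈ filter lower? I × (u , v) ≡ diff z) → O (low + u) (h + v) 1ℤ
              end ((x , y) , q , refl) = castO (l x low) (l y h) refl (I⇒O (proj₁ (∈-filter⁻ lower? q)))
              l′ : ∀ low h u v → 0ℤ ≡ (low - low) * v - (h - h) * u
              l′ = solve-∀
              side : ∀ x y → (x , y) ≡ (low , h) ⊎ diff (x , y) ∈ map diff (filter lower? I) →
                     NN ((x - low) * v - (y - h) * u)
              side x y (inj₁ refl) = ≤-reflexive (l′ low h u v)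
              side x y (inj₂ q) = best (subst (_ ∈_) eq q)

      -- The edge becomes the segment from (0, 0) to (g, 0), which contains (1, 0), and its side
      -- inequality becomes - g y ≥ 0 by the Bézout identity.
      edge-frame : Edge → Σ Frame λ φ → let module K′ = Config (reframe K φ) in
                   K′.O 0ℤ 0ℤ 1ℤ × K′.O 1ℤ 0ℤ 1ℤ × (∀ {x y} → K′.O x y 1ℤ → y ≤ 0ℤ)
      edge-frame E = φ , o₀ , o₁ , below
        where
        open Edge E
        π = primitiveVector u v ≢0
        open Primitive π
        φ = alongAxis x₀ y₀ π
        module K′ = Config (reframe K φ) using (O; O⇒C; combineO)
        o₀ : K′.O 0ℤ 0ℤ 1ℤ
        o₀ = O-pullback⁺ cone φ (castO (l x₀ p (- t)) (l y₀ q r) refl start)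
          where
          l : ∀ x p t → x ≡ p * 0ℤ + t * 0ℤ + x * 1ℤ
          l = solve-∀
        og : K′.O g 0ℤ 1ℤ
        og = O-pullback⁺ cone φ (castO (trans (cong (_+_ x₀) u≡) (l x₀ p (- t) g))
                                       (trans (cong (_+_ y₀) v≡) (l y₀ q r g)) refl end)
          where
          l : ∀ x p t g → x + g * p ≡ p * g + t * 0ℤ + x * 1ℤ
          l = solve-∀
        o₁ : K′.O 1ℤ 0ℤ 1ℤ
        o₁ = K′.combineO og (K′.O⇒C o₀) (K′.O⇒C o₀) 0<1 (Δ< g>0) (nat 0) g>0 (l g) (l′ g) (l″ g)
          where
          l : ∀ g → 1ℤ * g + (g - 0ℤ - 1ℤ) * 0ℤ + 0ℤ * 0ℤ ≡ g * 1ℤ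
          l = solve-∀
          l′ : ∀ g → 1ℤ * 0ℤ + (g - 0ℤ - 1ℤ) * 0ℤ + 0ℤ * 0ℤ ≡ g * 0ℤ
          l′ = solve-∀
          l″ : ∀ g → 1ℤ * 1ℤ + (g - 0ℤ - 1ℤ) * 1ℤ + 0ℤ * 1ℤ ≡ g * 1ℤ
          l″ = solve-∀
        below : ∀ {x y} → K′.O x y 1ℤ → y ≤ 0ℤ
        below {x} {y} o = ≮⇒≥ λ y>0 → <⇒≱ (*-pos g>0 y>0)
          (lin (subst₂ (λ u v → NN ((p * x + - t * y + x₀ * 1ℤ - x₀) * v - (q * x + r * y + y₀ * 1ℤ - y₀) * u)) u≡ v≡
                  (side (O-pullback⁻ cone φ o)))
            (trans (cong (λ k → 0ℤ - k) (sym (*-identityʳ (g * y))))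
              (trans (cong (λ k → 0ℤ - g * y * k) (sym bézout)) (l p q r t g x y x₀ y₀))))
          where
          l : ∀ p q r t g x y x₀ y₀ → 0ℤ - g * y * (p * r + q * t)
              ≡ (p * x + - t * y + x₀ * 1ℤ - x₀) * (g * q) - (q * x + r * y + y₀ * 1ℤ - y₀) * (g * p)
          l = solve-∀

  -- One interior lattice point.

  open HullEdges

  -- A unimodular copy of 3Δ, placed with its interior lattice point at the origin: the corners
  -- bound the set from inside, the three edge inequalities from outside.
  record Tripled (K : Cone) : Set where
    field
      coords : Frame
    open Cone (pullback K coords) using (C)
    field
      corner₁ : C -1ℤ -1ℤ 1ℤ
      corner₂ : C (+ 2) -1ℤ 1ℤ
      corner₃ : C -1ℤ (+ 2) 1ℤ
      left : C x y n → - n ≤ x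
      bottom : C x y n → - n ≤ y
      right : C x y n → x + y ≤ n

  tripled-pullback : ∀ K φ → Tripled (pullback K φ) → Tripled K
  tripled-pullback K φ T = record
    { coords = φ ∘ᶠ coords
    ; corner₁ = from { -1ℤ} { -1ℤ} corner₁ ; corner₂ = from {+ 2} { -1ℤ} corner₂ ; corner₃ = from { -1ℤ} {+ 2} corner₃
    ; left = λ {x} {y} c → left {x} {y} (to {x} {y} c)
    ; bottom = λ {x} {y} c → bottom {x} {y} (to {x} {y} c) ; right = λ {x} {y} c → right {x} {y} (to {x} {y} c) }
    where
    open Tripled T
    open Interior K using (cast)
    to : Cone.C (pullback K (φ ∘ᶠ coords)) x y n → Cone.C (pullback (pullback K φ) coords) x y n
    to {x} {y} {n} = cast (X-∘ φ coords x y n) (Y-∘ φ coords x y n) refl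
    from : Cone.C (pullback (pullback K φ) coords) x y n → Cone.C (pullback K (φ ∘ᶠ coords)) x y n
    from {x} {y} {n} = cast (sym (X-∘ φ coords x y n)) (sym (Y-∘ φ coords x y n)) refl

  highest : ∀ {z : ℤ × ℤ} L → z ∈ L → ∃ λ (t : ℤ) → ∃ λ (h : ℤ) → (t , h) ∈ L × (∀ {x y} → (x , y) ∈ L → y ≤ h)
  highest (w ∷ ws) _ with maximum (proj₂ w) (map proj₂ ws)
  ... | h , h∈ , ≤h with ∈-map⁻ proj₂ {xs = w ∷ ws} h∈
  ...   | (t , _) , t∈ , refl = t , h , t∈ , λ {x} {y} p → ≤h (∈-map⁺ proj₂ {x = x , y} p)

  two-rows : -1ℤ ≤ y → y ≤ 0ℤ → y ≡ 0ℤ ⊎ y ≡ -1ℤ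
  two-rows {+0} _ _ = inj₁ refl
  two-rows {+[1+ _ ]} _ (+≤+ ())
  two-rows { -[1+ zero ]} _ _ = inj₂ refl
  two-rows { -[1+ suc _ ]} (-≤- ())

  -- The case i = 1: 8 is 3 i + 5, and 9 is the number of boundary lattice points of 3Δ.
  Conclusion₁ : Config → Set
  Conclusion₁ K = length B ℕ.≤ 8 ⊎ Flat cone ⊎ (length B ℕ.≤ 9 × Tripled cone)
    where open Config K

  conclusion₁-reframe : ∀ K φ → Conclusion₁ (reframe K φ) → Conclusion₁ K
  conclusion₁-reframe K φ (inj₁ le) = inj₁ (subst (ℕ._≤ 8) (length-B-reframe K φ) le)
  conclusion₁-reframe K φ (inj₂ (inj₁ flat)) = inj₂ (inj₁ (flat-pullback (Config.cone K) φ flat))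
  conclusion₁-reframe K φ (inj₂ (inj₂ (le , T))) =
    inj₂ (inj₂ (subst (ℕ._≤ 9) (length-B-reframe K φ) le , tripled-pullback (Config.cone K) φ T))

  OnlyOrigin : Config → Set
  OnlyOrigin K = O 0ℤ 0ℤ 1ℤ × (∀ {x y} → O x y 1ℤ → x ≡ 0ℤ × y ≡ 0ℤ)
    where open Config K

  origin-reframe : ∀ K φ → Frame.e φ ≡ 0ℤ → Frame.f φ ≡ 0ℤ → OnlyOrigin K → OnlyOrigin (reframe K φ)
  origin-reframe K φ e≡0 f≡0 (o , only) =
    O-pullback⁺ cone φ (castO (sym (vanish a b e≡0)) (sym (vanish c d f≡0)) refl o) ,
    λ {x} {y} h → let ex , ey = only (O-pullback⁻ cone φ h) in
      trans (sym (X-left φ x y 1ℤ)) (trans (cong₂ (λ u v → ψ.X u v 1ℤ) ex ey) (vanish ψ.a ψ.b ψe≡0)) ,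
      trans (sym (Y-left φ x y 1ℤ)) (trans (cong₂ (λ u v → ψ.Y u v 1ℤ) ex ey) (vanish ψ.c ψ.d ψf≡0))
    where
    open Config K using (cone; castO)
    open Frame φ
    module ψ = Frame (φ ⁻¹)
    vanish : ∀ a b {e} → e ≡ 0ℤ → a * 0ℤ + b * 0ℤ + e * 1ℤ ≡ 0ℤ
    vanish a b refl = l a b
      where
      l : ∀ a b → a * 0ℤ + b * 0ℤ + 0ℤ * 1ℤ ≡ 0ℤ
      l = solve-∀
    ψe≡0 : ψ.e ≡ 0ℤ
    ψe≡0 = trans (cong₂ (λ e f → s * (b * f - d * e)) e≡0 f≡0) (l s b d)
      where
      l : ∀ s b d → s * (b * 0ℤ - d * 0ℤ) ≡ 0ℤ
      l = solve-∀
    ψf≡0 : ψ.f ≡ 0ℤ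
    ψf≡0 = trans (cong₂ (λ e f → s * (c * e - a * f)) e≡0 f≡0) (l s c a)
      where
      l : ∀ s b d → s * (b * 0ℤ - d * 0ℤ) ≡ 0ℤ
      l = solve-∀

  -- Each edge has a lattice point strictly between its corners. It is not the origin, hence not
  -- interior, so `support` applies; `swap` and `slant` make the other two edges horizontal.
  module TripledTriangle (K : Config) (origin : OnlyOrigin K)
    (corner₁ : Config.C K -1ℤ -1ℤ 1ℤ) (corner₂ : Config.C K (+ 2) -1ℤ 1ℤ) (corner₃ : Config.C K -1ℤ (+ 2) 1ℤ) where
    open RowProperties K using (cone; C; O; cast; O⇒C; support)

    private
      o = proj₁ origin
      only : ∀ {x y} → O x y 1ℤ → x ≡ 0ℤ × y ≡ 0ℤ
      only = proj₂ origin

      negate : ∀ n → -1ℤ * n ≡ - n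
      negate = -1*i≡-i

      -1≢0 : -1ℤ ≢ 0ℤ
      -1≢0 ()

      1≢0 : 1ℤ ≢ 0ℤ
      1≢0 ()

      swap slant : Frame
      swap = frame 0ℤ 1ℤ 1ℤ 0ℤ 0ℤ 0ℤ -1ℤ refl refl
      slant = frame 1ℤ 0ℤ -1ℤ -1ℤ 0ℤ 1ℤ -1ℤ refl refl

    bottom : C x y n → - n ≤ y
    bottom {x} {y} {n} c = subst (_≤ y) (negate n)
      (support corner₁ corner₂ -<+ (+<+ (ℕ.s≤s ℕ.z≤n)) ¬o (O⇒C o) -<+ c)
      where
      ¬o : ¬ O 0ℤ -1ℤ 1ℤ
      ¬o h = -1≢0 (proj₂ (only h))

    left : C x y n → - n ≤ x
    left {x} {y} {n} c = subst (_≤ x) (negate n)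
      (K′.support {y} {x} {h = -1ℤ} { -1ℤ} {0ℤ} {+ 2} {0ℤ} {0ℤ} corner₁ corner₃ -<+ (+<+ (ℕ.s≤s ℕ.z≤n)) ¬o (O⇒C o) -<+ (cast (l y x n) (l′ y x n) refl c))
      where
      module K′ = RowProperties (reframe K swap) using (O; support)
      ¬o : ¬ K′.O 0ℤ -1ℤ 1ℤ
      ¬o h = -1≢0 (proj₁ (only (O-pullback⁻ cone swap h)))
      l : ∀ y x n → x ≡ 0ℤ * y + 1ℤ * x + 0ℤ * n
      l = solve-∀
      l′ : ∀ y x n → y ≡ 1ℤ * y + 0ℤ * x + 0ℤ * n
      l′ = solve-∀

    right : C x y n → x + y ≤ n
    right {x} {y} {n} c = lin
      (K′.support {x} {n - x - y} {h = 0ℤ} { -1ℤ} {1ℤ} {+ 2} {0ℤ} {1ℤ} corner₃ corner₂ -<+ (+<+ (ℕ.s≤s (ℕ.s≤s ℕ.z≤n))) ¬o (O⇒C o) 0<1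
        (cast (l x (n - x - y) n) (l′ x y n) refl c))
      (l″ x y n)
      where
      module K′ = RowProperties (reframe K slant) using (O; support)
      ¬o : ¬ K′.O 1ℤ 0ℤ 1ℤ
      ¬o h = 1≢0 (proj₁ (only (O-pullback⁻ cone slant h)))
      l : ∀ x y n → x ≡ 1ℤ * x + 0ℤ * y + 0ℤ * n
      l = solve-∀
      l′ : ∀ x y n → y ≡ -1ℤ * x + -1ℤ * (n - x - y) + 1ℤ * n
      l′ = solve-∀
      l″ : ∀ x y n → n - (x + y) ≡ n - x - y
      l″ = solve-∀

  -- P lies above the line y = -1, which contains a segment of lattice length 3.
  module LongEdge (K : Config) (origin : OnlyOrigin K)
    (bottom : ∀ {x y n} → Config.C K x y n → - n ≤ y)
    {a : ℤ} (ca : Config.C K a -1ℤ 1ℤ) (ca+3 : Config.C K (a + + 3) -1ℤ 1ℤ) where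
    open RowProperties K using (cone; C; O; cast; O⇒C; I; B; I!; B!; I⇒O; O⇒I; B⇒C; row-B≤2; O⇒row-B≤2; module Chord)
    open ThreeRows K using (L; L!; ∈L⇒C; C⇒∈L; row-B≤row-L; three-rows)

    private
      o = proj₁ origin
      only : ∀ {x y} → O x y 1ℤ → x ≡ 0ℤ × y ≡ 0ℤ
      only = proj₂ origin

      row-0 : length (row 0ℤ I) ≡ 1
      row-0 = ℕP.≤-antisym
        (unique-⊆-length {ys = 0ℤ ∷ []} (unique-row 0ℤ I!) λ p → here (proj₁ (only (I⇒O (∈-row⁻ p)))))
        (nonempty (∈-row⁺ (O⇒I o)))
        where
        nonempty : ∀ {x : ℤ} {xs} → x ∈ xs → 1 ℕ.≤ length xs
        nonempty (here _) = ℕ.s≤s ℕ.z≤n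
        nonempty (there _) = ℕ.s≤s ℕ.z≤n

      length-I : length I ℕ.≤ 1
      length-I = unique-⊆-length {ys = (0ℤ , 0ℤ) ∷ []} I! λ p → here (cong₂ _,_ (proj₁ (only (I⇒O p))) (proj₂ (only (I⇒O p))))

      a∈ : a ∈ row -1ℤ L
      a∈ = ∈-row⁺ (C⇒∈L ca)

      base : Span (row -1ℤ L)
      base with span (row -1ℤ L) (unique-row -1ℤ L!)
      ... | inj₁ empty with () ← subst (a ∈_) empty a∈
      base | inj₂ s = s

      open Span base renaming (low to A; width to m)

      m≥3 : + 3 ≤ + m
      m≥3 = lin (Δ (low≤ a∈) ⊹ Δ (≤high (∈-row⁺ (C⇒∈L ca+3)))) (l a A (+ m))
        where
        l : ∀ a A m → m - + 3 ≡ a - A + (A + m - (a + + 3))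
        l = solve-∀

      cA : C A -1ℤ 1ℤ
      cA = ∈L⇒C (∈-row⁻ low∈)

      cA′ : C (A + + m) -1ℤ 1ℤ
      cA′ = ∈L⇒C (∈-row⁻ high∈)

    module Apex {t h : ℤ} (ct : C t h 1ℤ) (h>0 : 0ℤ < h) where
      open Chord h>0 0<1 ct ct cA cA′

      -- The triangle over the base with a lattice apex at height h has a chord of length h m/(h +
      -- 1) at y = 0. Its interior contains no lattice point but the origin, so this length is at
      -- most 2.
      width-bound : h * + m ≤ + 2 * h + + 2
      width-bound = lin (Δ bound) (trans (l h (+ m) A t) (cong (λ j → h * A + 1ℤ * t + (h * 1ℤ + 1ℤ * 1ℤ) * (1ℤ + + j) - (h * (A + + m) + 1ℤ * t)) (sym row-0)))
        where
        l : ∀ h m A t → + 2 * h + + 2 - h * m ≡ h * A + 1ℤ * t + (h * 1ℤ + 1ℤ * 1ℤ) * (1ℤ + 1ℤ) - (h * (A + m) + 1ℤ * t)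
        l = solve-∀

      h≤2 : h ≤ + 2
      h≤2 = lin (Δ width-bound ⊹ <⇒≤ h>0 ⊠ Δ m≥3) (l h (+ m))
        where
        l : ∀ h m → + 2 - h ≡ + 2 * h + + 2 - h * m + h * (m - + 3)
        l = solve-∀

    module Height2 where

      m≡3 : ∀ {t} → C t (+ 2) 1ℤ → + m ≡ + 3
      m≡3 ct = ≤-antisym (*-cancelˡ-≤-pos (+ m) (+ 3) (+ 2) (Apex.width-bound ct (+<+ (ℕ.s≤s ℕ.z≤n)))) m≥3

      -- The chord at y = 0 has length exactly 2, the largest possible, so its ends are integers α
      -- and α + 2. The point between them is the origin, which gives α = -1 and determines t.
      apex : ∀ {t} → C t (+ 2) 1ℤ → t ≡ - (+ 2 * A) - + 3
      apex {t} ct = from-tight (tight tightness)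
        where
        open Chord {h = + 2} (+<+ (ℕ.s≤s ℕ.z≤n)) 0<1 ct ct cA cA′
        tightness : + 2 * (A + + m) + 1ℤ * t ≡ + 2 * A + 1ℤ * t + (+ 2 * 1ℤ + 1ℤ * 1ℤ) * (1ℤ + + length (row 0ℤ I))
        tightness = trans (cong (λ m → + 2 * (A + m) + 1ℤ * t) (m≡3 ct))
          (trans (l A t) (cong (λ j → + 2 * A + 1ℤ * t + (+ 2 * 1ℤ + 1ℤ * 1ℤ) * (1ℤ + + j)) (sym row-0)))
          where
          l : ∀ A t → + 2 * (A + + 3) + 1ℤ * t ≡ + 2 * A + 1ℤ * t + (+ 2 * 1ℤ + 1ℤ * 1ℤ) * (1ℤ + 1ℤ)
          l = solve-∀
        from-tight : (∃ λ α → + 2 * A + 1ℤ * t ≡ (+ 2 * 1ℤ + 1ℤ * 1ℤ) * α) → t ≡ - (+ 2 * A) - + 3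
        from-tight (α , eq) = shift (cong₂ (λ r s → r + + 3 * s) eq (proj₁ (only (inside (1ℤ + α) lower upper)))) (l A t α)
          where
          l : ∀ A t α → t - (- (+ 2 * A) - + 3) ≡ + 2 * A + 1ℤ * t + + 3 * (1ℤ + α) - ((+ 2 * 1ℤ + 1ℤ * 1ℤ) * α + + 3 * 0ℤ)
          l = solve-∀
          lower : + 2 * A + 1ℤ * t < (+ 2 * 1ℤ + 1ℤ * 1ℤ) * (1ℤ + α)
          lower = lin< (nat 2) (shift (sym eq) (l₁ A t α))
            where
            l₁ : ∀ A t α → (+ 2 * 1ℤ + 1ℤ * 1ℤ) * (1ℤ + α) - (+ 2 * A + 1ℤ * t) - 1ℤ - + 2
                 ≡ (+ 2 * 1ℤ + 1ℤ * 1ℤ) * α - (+ 2 * A + 1ℤ * t)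
            l₁ = solve-∀
          upper : (+ 2 * 1ℤ + 1ℤ * 1ℤ) * (1ℤ + α) < + 2 * (A + + m) + 1ℤ * t
          upper = lin< (nat 2) (shift (cong₂ (λ r m → r + + 2 * m) eq (m≡3 ct)) (l₁ A t α (+ m)))
            where
            l₁ : ∀ A t α m → + 2 * (A + m) + 1ℤ * t - (+ 2 * 1ℤ + 1ℤ * 1ℤ) * (1ℤ + α) - 1ℤ - + 2
                 ≡ + 2 * A + 1ℤ * t + + 2 * m - ((+ 2 * 1ℤ + 1ℤ * 1ℤ) * α + + 2 * + 3)
            l₁ = solve-∀

      tripled : ∀ {t} → C t (+ 2) 1ℤ → Tripled cone
      tripled {t} ct = record
        { coords = shear ; corner₁ = corner₁ ; corner₂ = corner₂ ; corner₃ = corner₃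
        ; left = λ {x} {y} c → T.left {x} {y} c ; bottom = λ {x} {y} c → T.bottom {x} {y} c
        ; right = λ {x} {y} c → T.right {x} {y} c }
        where
        -- The shear that takes the left end (A, -1) of the base to (-1, -1); it then takes the apex
        -- (-2 A - 3, 2) to (-1, 2).
        κ = -1ℤ - A
        shear : Frame
        shear = frame 1ℤ κ 0ℤ 1ℤ 0ℤ 0ℤ 1ℤ (l κ) refl
          where
          l : ∀ κ → 1ℤ * 1ℤ - κ * 0ℤ ≡ 1ℤ
          l = solve-∀
        module K′ = Config (reframe K shear) using (C)
        corner₁ : K′.C -1ℤ -1ℤ 1ℤ
        corner₁ = cast (l A) refl refl cA
          where
          l : ∀ A → A ≡ 1ℤ * -1ℤ + (-1ℤ - A) * -1ℤ + 0ℤ * 1ℤ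
          l = solve-∀
        corner₂ : K′.C (+ 2) -1ℤ 1ℤ
        corner₂ = cast (trans (cong (_+_ A) (m≡3 ct)) (l A)) refl refl cA′
          where
          l : ∀ A → A + + 3 ≡ 1ℤ * + 2 + (-1ℤ - A) * -1ℤ + 0ℤ * 1ℤ
          l = solve-∀
        corner₃ : K′.C -1ℤ (+ 2) 1ℤ
        corner₃ = cast (trans (apex ct) (l A)) refl refl ct
          where
          l : ∀ A → - (+ 2 * A) - + 3 ≡ 1ℤ * -1ℤ + (-1ℤ - A) * + 2 + 0ℤ * 1ℤ
          l = solve-∀
        module T = TripledTriangle (reframe K shear) (origin-reframe K shear refl refl origin) corner₁ corner₂ corner₃ using (left; bottom; right)

      -- One point at the apex, two in each of the rows 1 and 0, which have points of the set on
      -- both sides, and four on the base of length 3.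
      B≤9 : ∀ {t} → C t (+ 2) 1ℤ → (∀ {x y} → C x y 1ℤ → y ∈ + 2 ∷ 1ℤ ∷ 0ℤ ∷ -1ℤ ∷ []) → length B ℕ.≤ 9
      B≤9 ct rows = ℕP.≤-trans (length≤rows (+ 2 ∷ 1ℤ ∷ 0ℤ ∷ -1ℤ ∷ []) B! (λ b∈ → rows (B⇒C b∈)))
        (ℕP.+-mono-≤ row₂ (ℕP.+-mono-≤ (row-B≤2 ct (+<+ (ℕ.s≤s (ℕ.s≤s ℕ.z≤n))) cA -<+)
          (ℕP.+-mono-≤ (O⇒row-B≤2 o) (ℕP.+-monoˡ-≤ 0 row₋₁))))
        where
        row₂ : length (row (+ 2) B) ℕ.≤ 1
        row₂ = unique-⊆-length {ys = - (+ 2 * A) - + 3 ∷ []} (unique-row (+ 2) B!)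
          λ p → here (apex (B⇒C (∈-row⁻ p)))
        row₋₁ : length (row -1ℤ B) ℕ.≤ 4
        row₋₁ = ℕP.≤-trans (row-B≤row-L -1ℤ) (subst (λ m → length (row -1ℤ L) ℕ.≤ suc m) (+-injective (m≡3 ct)) length≤)

    private
      flat : ∀ {h} → h ≤ 0ℤ → (∀ {x y} → C x y 1ℤ → y ≤ h) → Flat cone
      flat h≤0 low = identity , λ {x} {y} c →
        let c′ = cast (lx x y) (ly x y) refl c in two-rows (bottom c′) (≤-trans (low c′) h≤0)
        where
        lx : ∀ x y → 1ℤ * x + 0ℤ * y + 0ℤ * 1ℤ ≡ x
        lx = solve-∀
        ly : ∀ x y → 0ℤ * x + 1ℤ * y + 0ℤ * 1ℤ ≡ y
        ly = solve-∀

      upto1 : -1ℤ ≤ y → y ≤ 1ℤ → y ∈ 1ℤ ∷ 0ℤ ∷ -1ℤ ∷ []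
      upto1 {+ 0} _ _ = there (here refl)
      upto1 {+ 1} _ _ = here refl
      upto1 {+ suc (suc _)} _ (+≤+ (ℕ.s≤s ()))
      upto1 { -[1+ zero ]} _ _ = there (there (here refl))
      upto1 { -[1+ suc _ ]} (-≤- ())

      upto2 : -1ℤ ≤ y → y ≤ + 2 → y ∈ + 2 ∷ 1ℤ ∷ 0ℤ ∷ -1ℤ ∷ []
      upto2 {+ 0} _ _ = there (there (here refl))
      upto2 {+ 1} _ _ = there (here refl)
      upto2 {+ 2} _ _ = here refl
      upto2 {+ suc (suc (suc _))} _ (+≤+ (ℕ.s≤s (ℕ.s≤s ())))
      upto2 { -[1+ zero ]} _ _ = there (there (there (here refl)))
      upto2 { -[1+ suc _ ]} (-≤- ())

      not-above-2 : ∀ {k} → ¬ + suc (suc (suc k)) ≤ + 2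
      not-above-2 (+≤+ (ℕ.s≤s (ℕ.s≤s ())))

      -- The highest lattice point decides: height at most 0 is flat, height 1 leaves three rows and
      -- b ≤ 2 + 6, height 2 forces 3Δ, and more is excluded by the chord.
      by-height : ∀ {t} h → C t h 1ℤ → (∀ {x y} → C x y 1ℤ → y ≤ h) → Conclusion₁ K
      by-height -[1+ _ ] _ low = inj₂ (inj₁ (flat -≤+ low))
      by-height +0 _ low = inj₂ (inj₁ (flat ≤-refl low))
      by-height (+ 1) _ low = [ (λ fl → inj₂ (inj₁ fl)) ,
        (λ le → inj₁ (ℕP.≤-trans le (ℕP.+-monoˡ-≤ 6 (ℕP.*-monoʳ-≤ 2 length-I)))) ]′
        (three-rows (λ c → upto1 (bottom c) (low c)))
      by-height (+ 2) ct low =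
        inj₂ (inj₂ (Height2.B≤9 ct (λ c → upto2 (bottom c) (low c)) , Height2.tripled ct))
      by-height (+ suc (suc (suc _))) ct low =
        ⊥-elim (not-above-2 (Apex.h≤2 ct (+<+ (ℕ.s≤s ℕ.z≤n))))

    conclusion : Conclusion₁ K
    conclusion = let _ , h , t∈ , ≤h = highest L (C⇒∈L (O⇒C o)) in
      by-height h (∈L⇒C t∈) λ c → ≤h (C⇒∈L c)

  module SingleInterior (K : Config) (origin : OnlyOrigin K) where
    open RowProperties K using (C; O; cast; O⇒C; combineC; combineO; crossing₁; support; O⇒above; O⇒below)

    private
      o = proj₁ origin
      only : ∀ {x y} → O x y 1ℤ → x ≡ 0ℤ × y ≡ 0ℤ
      only = proj₂ origin

    -- For h ≥ 2 the triangle with the origin meets y = 1 - h in a segment of length 3 (h - 1)/h >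
    -- 1. A lattice point on it has positive weight on the origin, so it is a second interior
    -- lattice point.
    height≡1 : ∀ {a h} → C a (- h) 1ℤ → C (a + + 3) (- h) 1ℤ → 0ℤ < h → h ≡ 1ℤ
    height≡1 {a} {h} c c′ h>0 with h ≟ 1ℤ
    ... | yes h≡1 = h≡1
    ... | no h≢1 with divide ((h - 1ℤ) * a) h h>0
    ...   | Q , r , eq , r<h = contradiction (shift (sym (proj₂ (only inside))) (l₀ h)) h≢1
      where
      l₀ : ∀ h → h - 1ℤ ≡ 0ℤ - (1ℤ - h)
      l₀ = solve-∀
      h>1 : 1ℤ < h
      h>1 = ≤∧≢⇒< (i<j⇒suc[i]≤j h>0) (λ e → h≢1 (sym e))
      X = 1ℤ + Q
      β = h * X - (h - 1ℤ) * a
      α = + 3 * (h - 1ℤ) - β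
      β≡ : β ≡ h - + r
      β≡ = shift (sym eq) (l h Q a (+ r))
        where
        l : ∀ h Q a r → h * (1ℤ + Q) - (h - 1ℤ) * a - (h - r) ≡ r + Q * h - (h - 1ℤ) * a
        l = solve-∀
      β≥0 : NN β
      β≥0 = subst NN (sym β≡) (lin (Δ< r<h ⊹ nat 1) (l h (+ r)))
        where
        l : ∀ h r → h - r - 0ℤ ≡ h - r - 1ℤ + 1ℤ
        l = solve-∀
      α≥0 : NN α
      α≥0 = subst (λ β → NN (+ 3 * (h - 1ℤ) - β)) (sym β≡) (lin (Δ< h>1 ⊹ Δ< h>1 ⊹ nat 1 ⊹ nat r) (l h (+ r)))
        where
        l : ∀ h r → + 3 * (h - 1ℤ) - (h - r) - 0ℤ ≡ h - 1ℤ - 1ℤ + (h - 1ℤ - 1ℤ) + 1ℤ + r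
        l = solve-∀
      inside : O X (1ℤ - h) 1ℤ
      inside = combineO {a = + 3} {α} {β} {+ 3 * h} o c c′ (+<+ (ℕ.s≤s ℕ.z≤n)) α≥0 β≥0
        (*-pos {+ 3} (+<+ (ℕ.s≤s ℕ.z≤n)) h>0) (lx h X a) (ly h X a) (ln h X a)
        where
        lx : ∀ h X a → + 3 * 0ℤ + (+ 3 * (h - 1ℤ) - (h * X - (h - 1ℤ) * a)) * a + (h * X - (h - 1ℤ) * a) * (a + + 3)
             ≡ + 3 * h * X
        lx = solve-∀
        ly : ∀ h X a → + 3 * 0ℤ + (+ 3 * (h - 1ℤ) - (h * X - (h - 1ℤ) * a)) * - h + (h * X - (h - 1ℤ) * a) * - h
             ≡ + 3 * h * (1ℤ - h)
        ly = solve-∀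
        ln : ∀ h X a → + 3 * 1ℤ + (+ 3 * (h - 1ℤ) - (h * X - (h - 1ℤ) * a)) * 1ℤ + (h * X - (h - 1ℤ) * a) * 1ℤ
             ≡ + 3 * h * 1ℤ
        ln = solve-∀

    module _ {a k g : ℤ} (g>0 : 0ℤ < g) (c : C a k 1ℤ) (c′ : C (a + + 3 * g) k 1ℤ) where

      private
        a<m : a < a + g
        a<m = lin< (Δ< g>0) (l a g)
          where
          l : ∀ a g → a + g - a - 1ℤ ≡ g - 0ℤ - 1ℤ
          l = solve-∀
        m<a′ : a + g < a + + 3 * g
        m<a′ = lin< (Δ< g>0 ⊹ <⇒≤ g>0) (l a g)
          where
          l : ∀ a g → a + + 3 * g - (a + g) - 1ℤ ≡ g - 0ℤ - 1ℤ + g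
          l = solve-∀

      -- Otherwise it is the origin, and the next point a + 2 g is the midpoint of the origin and
      -- the far end, hence also interior and also the origin.
      third-not-interior : ¬ O (a + g) k 1ℤ
      third-not-interior h = <-irrefl (sym g≡0) g>0
        where
        a+g≡0 = proj₁ (only h)
        k≡0 = proj₂ (only h)
        h′ : O (a + + 2 * g) k 1ℤ
        h′ = combineO {a = 1ℤ} {1ℤ} {0ℤ} {+ 2} o c′ c′ 0<1 (nat 1) (nat 0) (+<+ (ℕ.s≤s ℕ.z≤n))
          (shift (sym a+g≡0) (lx a g)) (shift (sym k≡0) (ly k)) refl
          where
          lx : ∀ a g → 1ℤ * 0ℤ + 1ℤ * (a + + 3 * g) + 0ℤ * (a + + 3 * g) - + 2 * (a + + 2 * g) ≡ 0ℤ - (a + g)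
          lx = solve-∀
          ly : ∀ k → 1ℤ * 0ℤ + 1ℤ * k + 0ℤ * k - + 2 * k ≡ 0ℤ - k
          ly = solve-∀
        g≡0 : g ≡ 0ℤ
        g≡0 = shift (cong₂ _-_ (proj₁ (only h′)) a+g≡0) (l a g)
          where
          l : ∀ a g → g - 0ℤ ≡ a + + 2 * g - (a + g) - (0ℤ - 0ℤ)
          l = solve-∀

      height≢0 : k ≢ 0ℤ
      height≢0 refl with O⇒above o | O⇒below o
      ... | _ , _ , _ , c₁ , p | _ , _ , _ , c₂ , q =
        third-not-interior (crossing₁ c c′ a<m m<a′ c₁ p c₂ q)

      below-origin : k < 0ℤ → Conclusion₁ K
      below-origin k<0 = finish (trans (l k) (cong -_ (height≡1 (cast refl (l k) refl c) (cast refl (l k) refl c₃) -k>0)))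
        where
        l : ∀ k → k ≡ - - k
        l = solve-∀
        -k>0 : 0ℤ < - k
        -k>0 = neg-mono-< k<0
        c₃ : C (a + + 3) k 1ℤ
        c₃ = combineC c′ c 0<1 (Δ< g>0) g>0 (lx a g) (ly k g) (ly 1ℤ g)
          where
          lx : ∀ a g → 1ℤ * (a + + 3 * g) + (g - 0ℤ - 1ℤ) * a ≡ g * (a + + 3)
          lx = solve-∀
          ly : ∀ k g → 1ℤ * k + (g - 0ℤ - 1ℤ) * k ≡ g * k
          ly = solve-∀
        finish : k ≡ -1ℤ → Conclusion₁ K
        finish k≡-1 = LongEdge.conclusion K origin bottom (cast refl k≡-1 refl c) (cast refl k≡-1 refl c₃)
          where
          bottom : ∀ {x y n} → C x y n → - n ≤ y
          bottom {x} {y} {n} d = subst (_≤ y) (trans (cong (_* n) k≡-1) (-1*i≡-i n))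
            (support c c′ a<m m<a′ third-not-interior (O⇒C o) (subst (_< 0ℤ) (sym (*-identityʳ k)) k<0) d)

  three-apart : ∀ K → OnlyOrigin K → let open Config K in
                ∀ {a k g} → 0ℤ < g → C a k 1ℤ → C (a + + 3 * g) k 1ℤ → Conclusion₁ K
  three-apart K origin {a} {k} {g} g>0 c c′ with <-cmp k 0ℤ
  ... | tri< k<0 _ _ = SingleInterior.below-origin K origin g>0 c c′ k<0
  ... | tri≈ _ k≡0 _ = contradiction k≡0 (SingleInterior.height≢0 K origin g>0 c c′)
  ... | tri> _ _ k>0 = conclusion₁-reframe K half-turn
      (SingleInterior.below-origin (reframe K half-turn) (origin-reframe K half-turn refl refl origin) {a = - (a + + 3 * g)} {k = - k} g>0
        (cast (lx (a + + 3 * g) k) (ly (a + + 3 * g) k) refl c′) (cast (lx′ a g k) (ly (a + + 3 * g) k) refl c) (neg-mono-< k>0))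
    where
    open Config K using (C; cast)
    half-turn : Frame
    half-turn = frame -1ℤ 0ℤ 0ℤ -1ℤ 0ℤ 0ℤ 1ℤ refl refl
    lx : ∀ a k → a ≡ -1ℤ * - a + 0ℤ * - k + 0ℤ * 1ℤ
    lx = solve-∀
    lx′ : ∀ a g k → a ≡ -1ℤ * (- (a + + 3 * g) + + 3 * g) + 0ℤ * - k + 0ℤ * 1ℤ
    lx′ = solve-∀
    ly : ∀ a k → k ≡ 0ℤ * - a + -1ℤ * - k + 0ℤ * 1ℤ
    ly = solve-∀

  private
    residue : ℤ → ℕ
    residue a = a % (+ 3)

    residues : ℤ × ℤ → ℕ × ℕ
    residues (x , y) = residue x , residue y

    nonzero-residues : List (ℕ × ℕ)
    nonzero-residues = (0 , 1) ∷ (0 , 2) ∷ (1 , 0) ∷ (1 , 1) ∷ (1 , 2) ∷ (2 , 0) ∷ (2 , 1) ∷ (2 , 2) ∷ []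

    ∈-nonzero : ∀ {r s} → r ℕ.< 3 → s ℕ.< 3 → ¬ (r ≡ 0 × s ≡ 0) → (r , s) ∈ nonzero-residues
    ∈-nonzero {0} {0} _ _ ≢0 = contradiction (refl , refl) ≢0
    ∈-nonzero {0} {1} _ _ _ = here refl
    ∈-nonzero {0} {2} _ _ _ = there (here refl)
    ∈-nonzero {1} {0} _ _ _ = there (there (here refl))
    ∈-nonzero {1} {1} _ _ _ = there (there (there (here refl)))
    ∈-nonzero {1} {2} _ _ _ = there (there (there (there (here refl))))
    ∈-nonzero {2} {0} _ _ _ = there (there (there (there (there (here refl)))))
    ∈-nonzero {2} {1} _ _ _ = there (there (there (there (there (there (here refl))))))
    ∈-nonzero {2} {2} _ _ _ = there (there (there (there (there (there (there (here refl)))))))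
    ∈-nonzero {suc (suc (suc _))} (ℕ.s≤s (ℕ.s≤s (ℕ.s≤s ())))
    ∈-nonzero {_} {suc (suc (suc _))} _ (ℕ.s≤s (ℕ.s≤s (ℕ.s≤s ())))

  -- Nine boundary points cannot have distinct residues mod 3: the residue 0 would put an interior
  -- lattice point on the segment to the origin. Two congruent points span a segment of lattice length 3.
  module _ (K : Config) (origin : OnlyOrigin K) where
    open Config K using (O; cast; castO; combineO; B; B!; B⇒C; B⇒¬O)

    private
      o = proj₁ origin
      only : ∀ {x y} → O x y 1ℤ → x ≡ 0ℤ × y ≡ 0ℤ
      only = proj₂ origin

      residue-≢0 : ∀ {x y} → (x , y) ∈ B → ¬ (residue x ≡ 0 × residue y ≡ 0)
      residue-≢0 {x} {y} b∈ (rx , ry) = B⇒¬O b∈ (castO (sym (vanish rx (proj₁ zero₂))) (sym (vanish ry (proj₂ zero₂))) refl o)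
        where
        multiple : ∀ {x} → residue x ≡ 0 → x ≡ + 3 * (x / + 3)
        multiple {x} r = trans (a≡a%n+[a/n]*n x (+ 3)) (trans (cong (λ r → + r + x / + 3 * + 3) r) (l (x / + 3)))
          where
          l : ∀ q → 0ℤ + q * + 3 ≡ + 3 * q
          l = solve-∀
        vanish : ∀ {x} → residue x ≡ 0 → x / + 3 ≡ 0ℤ → x ≡ 0ℤ
        vanish {x} r q = trans (multiple r) (cong (+ 3 *_) q)
        zero₂ : x / + 3 ≡ 0ℤ × y / + 3 ≡ 0ℤ
        zero₂ = only (combineO {a = + 2} {1ℤ} {0ℤ} {+ 3} o (B⇒C b∈) (B⇒C b∈) (+<+ (ℕ.s≤s ℕ.z≤n)) (nat 1) (nat 0)
                  (+<+ (ℕ.s≤s ℕ.z≤n)) (trans (l x) (multiple rx)) (trans (l y) (multiple ry)) refl)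
          where
          l : ∀ x → + 2 * 0ℤ + 1ℤ * x + 0ℤ * x ≡ x
          l = solve-∀

      distinct : Unique (map residues B) → length B ℕ.≤ 8
      distinct u = subst (ℕ._≤ 8) (length-map residues B) (unique-⊆-length {ys = nonzero-residues} u sub)
        where
        sub : ∀ {r} → r ∈ map residues B → r ∈ nonzero-residues
        sub r∈ with ∈-map⁻ residues r∈
        ... | (x , y) , b∈ , refl = ∈-nonzero (n%d<d x (+ 3)) (n%d<d y (+ 3)) (residue-≢0 b∈)

      congruent : ∀ {x₁ y₁ x₂ y₂} → (x₁ , y₁) ∈ B → (x₂ , y₂) ∈ B → (x₁ , y₁) ≢ (x₂ , y₂) →
                  residues (x₁ , y₁) ≡ residues (x₂ , y₂) → Conclusion₁ K
      congruent {x₁} {y₁} {x₂} {y₂} b₁ b₂ ne eq =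
        conclusion₁-reframe K φ (three-apart (reframe K φ) (origin-reframe K φ refl refl origin) g>0
          (cast (sym (X-right φ x₂ y₂ 1ℤ)) (sym (Y-right φ x₂ y₂ 1ℤ)) refl (B⇒C b₂))
          (cast (trans ex (along p (- t) 0ℤ g ψ₁ ψ₂ (X-right φ x₂ y₂ 1ℤ) u≡))
                (trans ey (along q r 0ℤ g ψ₁ ψ₂ (Y-right φ x₂ y₂ 1ℤ) v≡)) refl (B⇒C b₁)))
        where
        u = x₁ / + 3 - x₂ / + 3
        v = y₁ / + 3 - y₂ / + 3
        difference : ∀ {x₁ x₂} → residue x₁ ≡ residue x₂ → x₁ ≡ x₂ + + 3 * (x₁ / + 3 - x₂ / + 3)
        difference {x₁} {x₂} r = shift (cong₂ _-_ (trans (a≡a%n+[a/n]*n x₁ (+ 3)) (cong (λ r → + r + x₁ / + 3 * + 3) r))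
                                                  (a≡a%n+[a/n]*n x₂ (+ 3))) (l x₁ x₂ (x₁ / + 3) (x₂ / + 3) (+ residue x₂))
          where
          l : ∀ x₁ x₂ q₁ q₂ r → x₁ - (x₂ + + 3 * (q₁ - q₂)) ≡ x₁ - x₂ - (r + q₁ * + 3 - (r + q₂ * + 3))
          l = solve-∀
        ex : x₁ ≡ x₂ + + 3 * u
        ex = difference {x₁} {x₂} (cong proj₁ eq)
        ey : y₁ ≡ y₂ + + 3 * v
        ey = difference {y₁} {y₂} (cong proj₂ eq)
        same : ∀ {x₁ x₂ u} → x₁ ≡ x₂ + + 3 * u → u ≡ 0ℤ → x₁ ≡ x₂
        same {x₁} {x₂} e refl = trans e (+-identityʳ x₂)
        π = primitiveVector u v λ { (u≡0 , v≡0) → ne (cong₂ _,_ (same ex u≡0) (same ey v≡0)) }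
        open Primitive π
        φ = alongAxis 0ℤ 0ℤ π
        ψ₁ = Frame.X (φ ⁻¹) x₂ y₂ 1ℤ
        ψ₂ = Frame.Y (φ ⁻¹) x₂ y₂ 1ℤ
        along : ∀ p t e g a k {x u} → p * a + t * k + e * 1ℤ ≡ x → u ≡ g * p →
                x + + 3 * u ≡ p * (a + + 3 * g) + t * k + e * 1ℤ
        along p t e g a k refl refl = l p t e g a k
          where
          l : ∀ p t e g a k → p * a + t * k + e * 1ℤ + + 3 * (g * p) ≡ p * (a + + 3 * g) + t * k + e * 1ℤ
          l = solve-∀

    single-origin : Conclusion₁ K
    single-origin = [ (λ u → inj₁ (distinct u)) ,
      (λ { ((x₁ , y₁) , (x₂ , y₂) , b₁ , b₂ , ne , eq) → congruent b₁ b₂ ne eq }) ]′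
      (collision (≡-dec ℕ._≟_ ℕ._≟_) residues B B!)

  single : ∀ K → length (Config.I K) ≡ 1 → Conclusion₁ K
  single K = go (Config.I K) refl
    where
    open Config K using (cone; O; castO; I; I⇒O; O⇒I)
    go : ∀ L → I ≡ L → length L ≡ 1 → Conclusion₁ K
    go ((x₀ , y₀) ∷ []) I≡ refl = conclusion₁-reframe K φ (single-origin (reframe K φ) (o , only))
      where
      φ = translate x₀ y₀
      module K′ = Config (reframe K φ) using (O)
      o : K′.O 0ℤ 0ℤ 1ℤ
      o = O-pullback⁺ cone φ (castO (l x₀) (l y₀) refl (I⇒O (subst ((x₀ , y₀) ∈_) (sym I≡) (here refl))))
        where
        l : ∀ x → x ≡ 0ℤ + x * 1ℤ
        l = solve-∀
      lx : ∀ x y x₀ → x - 0ℤ ≡ 1ℤ * x + 0ℤ * y + x₀ * 1ℤ - x₀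
      lx = solve-∀
      ly : ∀ x y y₀ → y - 0ℤ ≡ 0ℤ * x + 1ℤ * y + y₀ * 1ℤ - y₀
      ly = solve-∀
      origin : ∀ x y → (Frame.X φ x y 1ℤ , Frame.Y φ x y 1ℤ) ∈ (x₀ , y₀) ∷ [] → x ≡ 0ℤ × y ≡ 0ℤ
      origin x y (here e) = shift (cong proj₁ e) (lx x y x₀) , shift (cong proj₂ e) (ly x y y₀)
      only : ∀ {x y} → K′.O x y 1ℤ → x ≡ 0ℤ × y ≡ 0ℤ
      only {x} {y} h = origin x y (subst ((Frame.X φ x y 1ℤ , Frame.Y φ x y 1ℤ) ∈_) I≡ (O⇒I (O-pullback⁻ cone φ h)))

  -- Classification by induction on the number of interior lattice points.

  Conclusion : Config → Set
  Conclusion K = Flat cone ⊎ length B ℕ.≤ 3 ℕ.* length I ℕ.+ 5 ⊎ (length I ≡ 1 × length B ℕ.≤ 9 × Tripled cone)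
    where open Config K

  conclusion-reframe : ∀ K φ → Conclusion (reframe K φ) → Conclusion K
  conclusion-reframe K φ (inj₁ flat) = inj₁ (flat-pullback (Config.cone K) φ flat)
  conclusion-reframe K φ (inj₂ (inj₁ le)) = inj₂ (inj₁
    (subst₂ (λ b i → b ℕ.≤ 3 ℕ.* i ℕ.+ 5) (length-B-reframe K φ) (length-I-reframe K φ) le))
  conclusion-reframe K φ (inj₂ (inj₂ (i≡1 , le , T))) = inj₂ (inj₂
    (trans (sym (length-I-reframe K φ)) i≡1 , subst (ℕ._≤ 9) (length-B-reframe K φ) le ,
     tripled-pullback (Config.cone K) φ T))

  2i+6≤3i+5 : ∀ {i} → 1 ℕ.≤ i → 2 ℕ.* i ℕ.+ 6 ℕ.≤ 3 ℕ.* i ℕ.+ 5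
  2i+6≤3i+5 {i} 1≤i = subst₂ ℕ._≤_ (l i) (l′ i) (ℕP.+-monoʳ-≤ (2 ℕ.* i ℕ.+ 5) 1≤i)
    where
    l : ∀ i → 2 ℕ.* i ℕ.+ 5 ℕ.+ 1 ≡ 2 ℕ.* i ℕ.+ 6
    l = ℕS.solve-∀
    l′ : ∀ i → 2 ℕ.* i ℕ.+ 5 ℕ.+ i ≡ 3 ℕ.* i ℕ.+ 5
    l′ = ℕS.solve-∀

  -- The lattice points (0, 0) and (1, 0) span an edge of the hull of the interior lattice points.
  record Edged (K : Config) : Set where
    open Config K using (O)
    field
      o₀ : O 0ℤ 0ℤ 1ℤ
      o₁ : O 1ℤ 0ℤ 1ℤ
      below : ∀ {x y} → O x y 1ℤ → y ≤ 0ℤ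

  module _ (K : Config) (E : Edged K) where
    open Config K using (C; O; O⇒C; combineO; I; O⇒I)
    open Edged E

    -- For y ≥ 2 the triangle over (0, 0), (1, 0) has a chord at height 1 that contains the integer
    -- Q, the ceiling of x/y. The two base weights e and d sum to y - 1 > 0, so an interior point
    -- has positive weight, and (Q, 1) would be interior above the edge.
    ≤1 : C x y 1ℤ → y ≤ 1ℤ
    ≤1 {x} {y} c = ≮⇒≥ λ y>1 → go y>1 (divide (x + y - 1ℤ) y (<-trans 0<1 y>1))
      where
      go : 1ℤ < y → (∃ λ Q → ∃ λ r → x + y - 1ℤ ≡ + r + Q * y × + r < y) → ⊥
      go y>1 (Q , r , eq , r<y) = not-below (by-weight (0ℤ <? e))
        where
        not-below : O Q 1ℤ 1ℤ → ⊥
        not-below h = <⇒≱ 0<1 (below h)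
        y>0 = <-trans 0<1 y>1
        e = y * Q - x
        d = y - 1ℤ - e
        e≡ : e ≡ y - 1ℤ - + r
        e≡ = shift (sym eq) (l x y Q (+ r))
          where
          l : ∀ x y Q r → y * Q - x - (y - 1ℤ - r) ≡ r + Q * y - (x + y - 1ℤ)
          l = solve-∀
        d≥0 : NN d
        d≥0 = subst (λ e → NN (y - 1ℤ - e)) (sym e≡) (lin (nat r) (l y (+ r)))
          where
          l : ∀ y r → y - 1ℤ - (y - 1ℤ - r) - 0ℤ ≡ r
          l = solve-∀
        e≥0 : NN e
        e≥0 = subst NN (sym e≡) (lin (Δ< r<y) (l y (+ r)))
          where
          l : ∀ y r → y - 1ℤ - r - 0ℤ ≡ y - r - 1ℤ
          l = solve-∀
        by-weight : Dec (0ℤ < e) → O Q 1ℤ 1ℤ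
        by-weight (yes e>0) = combineO o₁ c (O⇒C o₀) e>0 (nat 1) d≥0 y>0 (lx x y Q) (ly x y Q) (ln x y Q)
          where
          lx : ∀ x y Q → (y * Q - x) * 1ℤ + 1ℤ * x + (y - 1ℤ - (y * Q - x)) * 0ℤ ≡ y * Q
          lx = solve-∀
          ly : ∀ x y Q → (y * Q - x) * 0ℤ + 1ℤ * y + (y - 1ℤ - (y * Q - x)) * 0ℤ ≡ y * 1ℤ
          ly = solve-∀
          ln : ∀ x y Q → (y * Q - x) * 1ℤ + 1ℤ * 1ℤ + (y - 1ℤ - (y * Q - x)) * 1ℤ ≡ y * 1ℤ
          ln = solve-∀
        by-weight (no ¬e>0) = combineO o₀ c (O⇒C o₁) d>0 (nat 1) e≥0 y>0 (lx x y Q) (ly x y Q) (ln x y Q)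
          where
          d>0 : 0ℤ < d
          d>0 = lin< (Δ< y>1 ⊹ Δ (≮⇒≥ ¬e>0)) (l y e)
            where
            l : ∀ y e → y - 1ℤ - e - 0ℤ - 1ℤ ≡ y - 1ℤ - 1ℤ + (0ℤ - e)
            l = solve-∀
          lx : ∀ x y Q → (y - 1ℤ - (y * Q - x)) * 0ℤ + 1ℤ * x + (y * Q - x) * 1ℤ ≡ y * Q
          lx = solve-∀
          ly : ∀ x y Q → (y - 1ℤ - (y * Q - x)) * 0ℤ + 1ℤ * y + (y * Q - x) * 0ℤ ≡ y * 1ℤ
          ly = solve-∀
          ln : ∀ x y Q → (y - 1ℤ - (y * Q - x)) * 1ℤ + 1ℤ * 1ℤ + (y * Q - x) * 1ℤ ≡ y * 1ℤ
          ln = solve-∀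

    two≤row : 2 ℕ.≤ length (row 0ℤ I)
    two≤row = unique-⊆-length (unique-interval 0ℤ 2) sub
      where
      sub : ∀ {x} → x ∈ 0ℤ ∷ 1ℤ ∷ [] → x ∈ row 0ℤ I
      sub (here refl) = ∈-row⁺ (O⇒I o₀)
      sub (there (here refl)) = ∈-row⁺ (O⇒I o₁)

  private
    three-values : -1ℤ ≤ y → y ≤ 1ℤ → y ∈ 1ℤ ∷ 0ℤ ∷ -1ℤ ∷ []
    three-values {+ 0} _ _ = there (here refl)
    three-values {+ 1} _ _ = here refl
    three-values {+ suc (suc _)} _ (+≤+ (ℕ.s≤s ()))
    three-values { -[1+ zero ]} _ _ = there (there (here refl))
    three-values { -[1+ suc _ ]} (-≤- ())

  private
    close : ∀ {a b} → a ≡ 0ℤ ⊎ a ≡ -1ℤ → b ≡ 0ℤ ⊎ b ≡ -1ℤ → NN (a - b + 1ℤ) × NN (b - a + 1ℤ)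
    close (inj₁ refl) (inj₁ refl) = nat 1 , nat 1
    close (inj₁ refl) (inj₂ refl) = nat 2 , nat 0
    close (inj₂ refl) (inj₁ refl) = nat 0 , nat 2
    close (inj₂ refl) (inj₂ refl) = nat 1 , nat 1

    steep⁻ : ∀ d y → d < 0ℤ → y < -1ℤ → ¬ NN (1ℤ - d * y)
    steep⁻ d y d<0 y<-1 q = <⇒≱ d<0 (lin (q ⊹ Δ< d<0 ⊠ Δ< y<-1 ⊹ Δ< y<-1 ⊹ Δ< d<0) (l d y))
      where
      l : ∀ d y → d - 0ℤ ≡ 1ℤ - d * y + (0ℤ - d - 1ℤ) * (-1ℤ - y - 1ℤ) + (-1ℤ - y - 1ℤ) + (0ℤ - d - 1ℤ)
      l = solve-∀

    steep⁺ : ∀ d y → 0ℤ < d → y < -1ℤ → ¬ NN (d * y + 1ℤ)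
    steep⁺ d y d>0 y<-1 p = <⇒≱ d>0 (lin (p ⊹ Δ< d>0 ⊠ Δ< y<-1 ⊹ Δ< y<-1 ⊹ Δ< d>0) (l d y))
      where
      l : ∀ d y → 0ℤ - d ≡ d * y + 1ℤ + (d - 0ℤ - 1ℤ) * (-1ℤ - y - 1ℤ) + (-1ℤ - y - 1ℤ) + (d - 0ℤ - 1ℤ)
      l = solve-∀

    steep : ∀ {d y} → d ≢ 0ℤ → y < -1ℤ → ¬ (NN (d * y + 1ℤ) × NN (1ℤ - d * y))
    steep {d} {y} d≢0 y<-1 (p , q) = by-sign (<-cmp d 0ℤ)
      where
      by-sign : Tri (d < 0ℤ) (d ≡ 0ℤ) (0ℤ < d) → ⊥
      by-sign (tri< d<0 _ _) = steep⁻ d y d<0 y<-1 q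
      by-sign (tri≈ _ d≡0 _) = d≢0 d≡0
      by-sign (tri> _ _ d>0) = steep⁺ d y d>0 y<-1 p

    level-difference : ∀ {c d f x y} → c ≡ 0ℤ →
      NN (c * x + d * y + f * 1ℤ - (c * 0ℤ + d * 0ℤ + f * 1ℤ) + 1ℤ)
      × NN (c * 0ℤ + d * 0ℤ + f * 1ℤ - (c * x + d * y + f * 1ℤ) + 1ℤ) → NN (d * y + 1ℤ) × NN (1ℤ - d * y)
    level-difference {c} {d} {f} {x} {y} c≡0 (p , q) =
      subst NN (trans (l c d f x y) (drop x (d * y + 1ℤ))) p , subst NN (trans (l′ c d f x y) (drop (- x) (1ℤ - d * y))) q
      where
      l : ∀ c d f x y → c * x + d * y + f * 1ℤ - (c * 0ℤ + d * 0ℤ + f * 1ℤ) + 1ℤ ≡ c * x + (d * y + 1ℤ)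
      l = solve-∀
      l′ : ∀ c d f x y → c * 0ℤ + d * 0ℤ + f * 1ℤ - (c * x + d * y + f * 1ℤ) + 1ℤ ≡ c * - x + (1ℤ - d * y)
      l′ = solve-∀
      drop : ∀ x t → c * x + t ≡ t
      drop x t = trans (cong (λ c → c * x + t) c≡0) (+-identityˡ t)

  between-lines : ∀ K → 1 ℕ.≤ length (Config.I K) →
    (∀ {x y} → Config.C K x y 1ℤ → -1ℤ ≤ y × y ≤ 1ℤ) → Conclusion K
  between-lines K 1≤i rows =
    [ inj₁ , (λ le → inj₂ (inj₁ (ℕP.≤-trans le (2i+6≤3i+5 1≤i)))) ]′
    (ThreeRows.three-rows K λ c → three-values (proj₁ (rows c)) (proj₂ (rows c)))

  module _ (K : Config) (E : Edged K) (1≤i : 1 ℕ.≤ length (Config.I K)) where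
    open Config K using (cone; C; O; cast; castO; O⇒C; I; B; B!; B⇒C)
    open Edged E

    -- With all interior lattice points on y = 0, the bound `≤1` also applies to the mirror image
    -- and leaves three rows.
    collinear : (∀ {x y} → O x y 1ℤ → 0ℤ ≤ y) → Conclusion K
    collinear above = between-lines K 1≤i λ {x} {y} c → ≥-1 x y c , ≤1 K E c
      where
      flip : Frame
      flip = frame 1ℤ 0ℤ 0ℤ -1ℤ 0ℤ 0ℤ -1ℤ refl refl
      lx : ∀ x y → x ≡ 1ℤ * x + 0ℤ * y + 0ℤ * 1ℤ
      lx = solve-∀
      ly : ∀ x y → y ≡ 0ℤ * x + -1ℤ * - y + 0ℤ * 1ℤ
      ly = solve-∀
      ly′ : ∀ x y → 0ℤ - y ≡ 0ℤ * x + -1ℤ * y + 0ℤ * 1ℤ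
      ly′ = solve-∀
      flipped : Edged (reframe K flip)
      flipped = record
        { o₀ = O-pullback⁺ cone flip o₀ ; o₁ = O-pullback⁺ cone flip o₁
        ; below = λ {x} {y} h → lin (above (O-pullback⁻ cone flip h)) (ly′ x y) }
      ≥-1 : ∀ x y → C x y 1ℤ → -1ℤ ≤ y
      ≥-1 x y c = subst (-1ℤ ≤_) (neg-involutive y)
        (neg-mono-≤ (≤1 (reframe K flip) flipped {x} { - y} (cast (lx x (- y)) (ly x y) refl c)))

    module Truncated {s g : ℤ} (g>0 : 0ℤ < g) (os : O s (- g) 1ℤ) where
      open Cut K public using (cut-cone; O-cut⁺; cut; cut-I; cut-B)
      open RowProperties K using (module Chord)

      j r : ℕ
      j = length (row 0ℤ I)
      r = length (row 1ℤ B)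

      -- The triangle from row 1, of width w, down to (s, - g) has a chord of length g w/(g + 1) at
      -- y = 0. It is at most j + 1, and (g + 1)/g ≤ 2.
      r≤2j+3 : r ℕ.≤ 2 ℕ.* j ℕ.+ 3
      r≤2j+3 = [ (λ empty → subst (λ xs → length xs ℕ.≤ 2 ℕ.* j ℕ.+ 3) (sym empty) ℕ.z≤n) , spanned ]′
        (span (row 1ℤ B) (unique-row 1ℤ B!))
        where
        spanned : Span (row 1ℤ B) → r ℕ.≤ 2 ℕ.* j ℕ.+ 3
        spanned S = ℕP.≤-trans length≤ (subst (suc width ℕ.≤_) (ℕe j) (ℕ.s≤s width≤))
          where
          open Span S
          ℕe : ∀ j → suc (2 ℕ.* j ℕ.+ 2) ≡ 2 ℕ.* j ℕ.+ 3
          ℕe = ℕS.solve-∀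
          open Chord 0<1 g>0 (B⇒C (∈-row⁻ low∈)) (B⇒C (∈-row⁻ high∈)) (O⇒C os) (O⇒C os)
          scaled : g * + width ≤ g * (+ 2 * + j + + 2)
          scaled = lin (Δ bound ⊹ Δ< g>0 ⊠ (nat 1 ⊹ nat j)) (l s g low (+ width) (+ j))
            where
            l : ∀ s g a m j → g * (+ 2 * j + + 2) - g * m
                ≡ 1ℤ * s + g * a + (1ℤ * 1ℤ + g * 1ℤ) * (1ℤ + j) - (1ℤ * s + g * (a + m)) + (g - 0ℤ - 1ℤ) * (1ℤ + j)
            l = solve-∀
          width≤ : width ℕ.≤ 2 ℕ.* j ℕ.+ 2
          width≤ = drop‿+≤+ (subst (+ width ≤_) (cong (_+ + 2) (sym (pos-* 2 j))) (cancel g>0 scaled))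
            where
            cancel : ∀ {g a b} → 0ℤ < g → g * a ≤ g * b → a ≤ b
            cancel {+[1+ n ]} {a} {b} _ le = *-cancelˡ-≤-pos a b +[1+ n ] le
            cancel {+0} (+<+ ())

      -- With b′, i′ for the piece, b + j ≤ b′ + r, r ≤ 2 j + 3 and i′ + j ≤ i give b ≤ 3 i - 2 j +
      -- 9, and j ≥ 2 makes this 3 i + 5. The hypothesis allows 3 i′ + 6 so that the piece may be
      -- 3Δ.
      transfer : length (Config.B cut) ℕ.≤ 3 ℕ.* length (Config.I cut) ℕ.+ 6 → length B ℕ.≤ 3 ℕ.* length I ℕ.+ 5
      transfer le = ℕP.+-cancelʳ-≤ (3 ℕ.* j) _ _ (begin
        length B ℕ.+ 3 ℕ.* j ≡⟨ e₁ (length B) j ⟩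
        length B ℕ.+ j ℕ.+ 2 ℕ.* j ≤⟨ ℕP.+-monoˡ-≤ (2 ℕ.* j) (cut-B (≤1 K E)) ⟩
        length (Config.B cut) ℕ.+ r ℕ.+ 2 ℕ.* j ≤⟨ ℕP.+-monoˡ-≤ (2 ℕ.* j) (ℕP.+-mono-≤ le r≤2j+3) ⟩
        3 ℕ.* i′ ℕ.+ 6 ℕ.+ (2 ℕ.* j ℕ.+ 3) ℕ.+ 2 ℕ.* j ≡⟨ e₂ i′ j ⟩
        3 ℕ.* (i′ ℕ.+ j) ℕ.+ 9 ℕ.+ j ≤⟨ ℕP.+-monoˡ-≤ j (ℕP.+-monoˡ-≤ 9 (ℕP.*-monoʳ-≤ 3 cut-I)) ⟩
        3 ℕ.* length I ℕ.+ 9 ℕ.+ j ≡⟨ e₃ (length I) j ⟩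
        3 ℕ.* length I ℕ.+ 5 ℕ.+ (4 ℕ.+ j) ≤⟨ ℕP.+-monoʳ-≤ (3 ℕ.* length I ℕ.+ 5) 4+j≤3j ⟩
        3 ℕ.* length I ℕ.+ 5 ℕ.+ 3 ℕ.* j ∎)
        where
        open ℕP.≤-Reasoning
        i′ = length (Config.I cut)
        e₁ : ∀ b j → b ℕ.+ 3 ℕ.* j ≡ b ℕ.+ j ℕ.+ 2 ℕ.* j
        e₁ = ℕS.solve-∀
        e₂ : ∀ i j → 3 ℕ.* i ℕ.+ 6 ℕ.+ (2 ℕ.* j ℕ.+ 3) ℕ.+ 2 ℕ.* j ≡ 3 ℕ.* (i ℕ.+ j) ℕ.+ 9 ℕ.+ j
        e₂ = ℕS.solve-∀
        e₃ : ∀ i j → 3 ℕ.* i ℕ.+ 9 ℕ.+ j ≡ 3 ℕ.* i ℕ.+ 5 ℕ.+ (4 ℕ.+ j)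
        e₃ = ℕS.solve-∀
        4+j≤3j : 4 ℕ.+ j ℕ.≤ 3 ℕ.* j
        4+j≤3j = subst (4 ℕ.+ j ℕ.≤_) (e₄ j) (ℕP.+-monoˡ-≤ j (ℕP.*-monoʳ-≤ 2 (two≤row K E)))
          where
          e₄ : ∀ j → 2 ℕ.* j ℕ.+ j ≡ 3 ℕ.* j
          e₄ = ℕS.solve-∀

      s∈cut : (s , - g) ∈ Config.I cut
      s∈cut = Config.O⇒I cut (O-cut⁺ os (neg-mono-< g>0))

      1≤cut : 1 ℕ.≤ length (Config.I cut)
      1≤cut = unique-⊆-length {xs = (s , - g) ∷ []} ([] ∷ []) λ { (here refl) → s∈cut }
        where
        open import Data.List.Relation.Unary.AllPairs using ([]; _∷_)
        open import Data.List.Relation.Unary.All using ([])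

      cut<I : length (Config.I cut) ℕ.< length I
      cut<I = ℕP.<-≤-trans (ℕP.m<m+n _ (ℕP.<-≤-trans (ℕ.s≤s ℕ.z≤n) (two≤row K E))) cut-I

      -- `ψ.Y` is the affine function with values 0 and -1 on the lattice points of the piece; its
      -- coefficient `ψ.c` vanishes exactly when its level lines are parallel to the cut.
      module FlatCut (φ : Frame) (rows : ∀ {x y} → Cone.C (pullback cut-cone φ) x y 1ℤ → y ≡ 0ℤ ⊎ y ≡ -1ℤ) where
        private
          module φ = Frame φ
          module ψ = Frame (φ ⁻¹)
          K₂ = reframe K φ

        level : C x y 1ℤ → y ≤ 0ℤ → ψ.Y x y 1ℤ ≡ 0ℤ ⊎ ψ.Y x y 1ℤ ≡ -1ℤ
        level {x} {y} c y≤0 = rows {ψ.X x y 1ℤ} {ψ.Y x y 1ℤ}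
          (cast (sym (X-right φ x y 1ℤ)) (sym (Y-right φ x y 1ℤ)) refl c ,
           subst (_≤ 0ℤ) (sym (Y-right φ x y 1ℤ)) y≤0)

        level₀ : ψ.Y 0ℤ 0ℤ 1ℤ ≡ 0ℤ ⊎ ψ.Y 0ℤ 0ℤ 1ℤ ≡ -1ℤ
        level₀ = level (O⇒C o₀) ≤-refl

        -- The levels of (0, 0) and of a lattice point with y ≤ 0 differ by d y and by at most 1,
        -- and d ≠ 0. So y ≥ -1, and only three rows remain.
        parallel : ψ.c ≡ 0ℤ → Conclusion K
        parallel c≡0 = between-lines K 1≤i λ {x} {y} c → ≮⇒≥ (low x y c) , ≤1 K E c
          where
          d≢0 : ψ.d ≢ 0ℤ
          d≢0 d≡0 = unit (trans (sym ψ.det≡s) (trans (cong₂ (λ c d → ψ.a * d - ψ.b * c) c≡0 d≡0) (l ψ.a ψ.b))) ψ.s²≡1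
            where
            l : ∀ a b → a * 0ℤ - b * 0ℤ ≡ 0ℤ
            l = solve-∀
            unit : ∀ {s} → s ≡ 0ℤ → s * s ≢ 1ℤ
            unit refl ()
          low : ∀ x y → C x y 1ℤ → ¬ y < -1ℤ
          low x y c y<-1 = steep d≢0 y<-1 (level-difference {ψ.c} {ψ.d} {ψ.f} {x} {y} c≡0
            (close (level c (<⇒≤ (<-trans y<-1 -<+))) level₀))

        -- The interior points (0, 0) and (1, 0) lie on different levels, so each of the two lines
        -- carries at most two boundary points. Row 1 adds at most 2 j + 3, and j + 1 ≤ i because
        -- the piece has an interior lattice point.
        transversal : ψ.c ≢ 0ℤ → Conclusion K
        transversal c≢0 = inj₂ (inj₁ (begin
          length B ≤⟨ unique-⊆-length B! sub ⟩
          length (line 0ℤ ++ line -1ℤ ++ map (_, 1ℤ) (row 1ℤ B))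
            ≡⟨ trans (length-++ (line 0ℤ)) (cong₂ ℕ._+_ (length-map _ (row 0ℤ (Config.B K₂)))
                 (trans (length-++ (line -1ℤ)) (cong₂ ℕ._+_ (length-map _ (row -1ℤ (Config.B K₂))) (length-map _ (row 1ℤ B))))) ⟩
          length (row 0ℤ (Config.B K₂)) ℕ.+ (length (row -1ℤ (Config.B K₂)) ℕ.+ r)
            ≤⟨ ℕP.+-mono-≤ (row≤2 (proj₁ heights)) (ℕP.+-mono-≤ (row≤2 (proj₂ heights)) r≤2j+3) ⟩
          2 ℕ.+ (2 ℕ.+ (2 ℕ.* j ℕ.+ 3)) ≡⟨ e₁ j ⟩
          2 ℕ.* (1 ℕ.+ j) ℕ.+ 5
            ≤⟨ ℕP.+-monoˡ-≤ 5 (ℕP.*-monoʳ-≤ 2 (ℕP.≤-trans (ℕP.+-monoˡ-≤ j 1≤cut) cut-I)) ⟩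
          2 ℕ.* length I ℕ.+ 5 ≤⟨ ℕP.+-monoˡ-≤ 5 (ℕP.*-monoˡ-≤ (length I) (ℕP.n≤1+n 2)) ⟩
          3 ℕ.* length I ℕ.+ 5 ∎))
          where
          open ℕP.≤-Reasoning
          e₁ : ∀ j → 2 ℕ.+ (2 ℕ.+ (2 ℕ.* j ℕ.+ 3)) ≡ 2 ℕ.* (1 ℕ.+ j) ℕ.+ 5
          e₁ = ℕS.solve-∀
          line : ℤ → List (ℤ × ℤ)
          line h = map (λ x → φ.X x h 1ℤ , φ.Y x h 1ℤ) (row h (Config.B K₂))
          in-line : ∀ {x y h} → (x , y) ∈ B → ψ.Y x y 1ℤ ≡ h → (x , y) ∈ line h
          in-line {x} {y} b∈ refl = subst (_∈ line (ψ.Y x y 1ℤ)) (cong₂ _,_ (X-right φ x y 1ℤ) (Y-right φ x y 1ℤ))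
            (∈-map⁺ (λ x′ → φ.X x′ (ψ.Y x y 1ℤ) 1ℤ , φ.Y x′ (ψ.Y x y 1ℤ) 1ℤ) (∈-row⁺ {L = (Config.B K₂)} (∈-map⁺ _ b∈)))
          sub : ∀ {z} → z ∈ B → z ∈ line 0ℤ ++ line -1ℤ ++ map (_, 1ℤ) (row 1ℤ B)
          sub {x , y} b∈ = by (y ≤? 0ℤ)
            where
            by : Dec (y ≤ 0ℤ) → (x , y) ∈ line 0ℤ ++ line -1ℤ ++ map (_, 1ℤ) (row 1ℤ B)
            by (yes y≤0) = [ (λ e → ∈-++⁺ˡ (in-line b∈ e)) , (λ e → ∈-++⁺ʳ (line 0ℤ) (∈-++⁺ˡ (in-line b∈ e))) ]′
                           (level (B⇒C b∈) y≤0)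
            by (no y≰0) = top b∈ (≤-antisym (≤1 K E (B⇒C b∈)) (i<j⇒suc[i]≤j (≰⇒> y≰0)))
              where
              top : ∀ {y} → (x , y) ∈ B → y ≡ 1ℤ → (x , y) ∈ line 0ℤ ++ line -1ℤ ++ map (_, 1ℤ) (row 1ℤ B)
              top b∈ refl = ∈-++⁺ʳ (line 0ℤ) (∈-++⁺ʳ (line -1ℤ) (∈-map⁺ _ (∈-row⁺ b∈)))
          Occupied : ℤ → Set
          Occupied h = ∃ λ x → Config.O K₂ x h 1ℤ
          row≤2 : ∀ {h} → Occupied h → length (row h (Config.B K₂)) ℕ.≤ 2
          row≤2 (_ , o) = RowProperties.O⇒row-B≤2 K₂ o
          occupied : ∀ {x y} → O x y 1ℤ → Occupied (ψ.Y x y 1ℤ)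
          occupied {x} {y} o = ψ.X x y 1ℤ ,
            O-pullback⁺ cone φ (castO (sym (X-right φ x y 1ℤ)) (sym (Y-right φ x y 1ℤ)) refl o)
          heights : Occupied 0ℤ × Occupied -1ℤ
          heights = arrange level₀ (level (O⇒C o₁) ≤-refl) (occupied o₀) (occupied o₁) differ
            where
            differ : ψ.Y 0ℤ 0ℤ 1ℤ ≢ ψ.Y 1ℤ 0ℤ 1ℤ
            differ e = c≢0 (shift (sym e) (l ψ.c ψ.d ψ.f))
              where
              l : ∀ c d f → c - 0ℤ ≡ c * 1ℤ + d * 0ℤ + f * 1ℤ - (c * 0ℤ + d * 0ℤ + f * 1ℤ)
              l = solve-∀
            arrange : ∀ {h k} → h ≡ 0ℤ ⊎ h ≡ -1ℤ → k ≡ 0ℤ ⊎ k ≡ -1ℤ → Occupied h → Occupied k → h ≢ k →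
                      Occupied 0ℤ × Occupied -1ℤ
            arrange (inj₁ refl) (inj₁ refl) _ _ ne = contradiction refl ne
            arrange (inj₁ refl) (inj₂ refl) p q _ = p , q
            arrange (inj₂ refl) (inj₁ refl) p q _ = q , p
            arrange (inj₂ refl) (inj₂ refl) _ _ ne = contradiction refl ne

        conclusion : Conclusion K
        conclusion = by (ψ.c ≟ 0ℤ)
          where
          by : Dec (ψ.c ≡ 0ℤ) → Conclusion K
          by (yes c≡0) = parallel c≡0
          by (no c≢0) = transversal c≢0

      extend : Conclusion cut → Conclusion K
      extend (inj₁ (φ , rows)) = FlatCut.conclusion φ rows
      extend (inj₂ (inj₁ le)) = inj₂ (inj₁ (transfer (ℕP.≤-trans le (ℕP.+-monoʳ-≤ (3 ℕ.* length (Config.I cut)) (ℕP.n≤1+n 5)))))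
      extend (inj₂ (inj₂ (i≡1 , le , _))) =
        inj₂ (inj₁ (transfer (subst (λ i → length (Config.B cut) ℕ.≤ 3 ℕ.* i ℕ.+ 6) (sym i≡1) le)))

  -- The number m bounds the interior lattice points. It can drop at each cut, because those on the
  -- edge become boundary points.
  classification : ∀ m K → length (Config.I K) ℕ.≤ m → 1 ℕ.≤ length (Config.I K) → Conclusion K
  classification zero K i≤m 1≤i = contradiction (ℕP.≤-trans 1≤i i≤m) λ ()
  classification (suc m) K i≤m 1≤i = by-size (length (Config.I K) ℕ.≟ 1)
    where
    edged : ∀ K → Edged K → length (Config.I K) ℕ.≤ suc m → 1 ℕ.≤ length (Config.I K) → Conclusion K
    edged K E i≤m 1≤i = by-depth (Any.any? (λ z → proj₂ z <? 0ℤ) I)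
      where
      open Config K using (castO; I; I⇒O; O⇒I)
      by-depth : Dec (Any.Any (λ z → proj₂ z < 0ℤ) I) → Conclusion K
      by-depth (no none) = collinear K E 1≤i λ o → ≮⇒≥ λ y<0 → none (lose (O⇒I o) y<0)
      by-depth (yes some) = deep (find some)
        where
        deep : (∃ λ z → z ∈ I × proj₂ z < 0ℤ) → Conclusion K
        deep ((s , y) , z∈ , y<0) = T.extend (classification m T.cut (ℕP.≤-pred (ℕP.<-≤-trans T.cut<I i≤m)) T.1≤cut)
          where
          module T = Truncated K E 1≤i {s} { - y} (neg-mono-< y<0)
                       (castO refl (sym (neg-involutive y)) refl (I⇒O z∈)) using (extend; cut; cut<I; 1≤cut)
    by-size : Dec (length (Config.I K) ≡ 1) → Conclusion K
    by-size (yes i≡1) = from₁ (single K i≡1)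
      where
      from₁ : Conclusion₁ K → Conclusion K
      from₁ (inj₁ le) = inj₂ (inj₁ (subst (λ i → length (Config.B K) ℕ.≤ 3 ℕ.* i ℕ.+ 5) (sym i≡1) le))
      from₁ (inj₂ (inj₁ flat)) = inj₁ flat
      from₁ (inj₂ (inj₂ (le , T))) = inj₂ (inj₂ (i≡1 , le , T))
    by-size (no i≢1) = from-frame (edge-frame K (edge K (ℕP.≤∧≢⇒< 1≤i (λ e → i≢1 (sym e)))))
      where
      from-frame : (Σ Frame λ φ → let module K′ = Config (reframe K φ) in
                    K′.O 0ℤ 0ℤ 1ℤ × K′.O 1ℤ 0ℤ 1ℤ × (∀ {x y} → K′.O x y 1ℤ → y ≤ 0ℤ)) → Conclusion K
      from-frame (φ , o₀ , o₁ , below) = conclusion-reframe K φ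
        (edged (reframe K φ) (record { o₀ = o₀ ; o₁ = o₁ ; below = below })
          (subst (ℕ._≤ suc m) (sym (length-I-reframe K φ)) i≤m)
          (subst (1 ℕ.≤_) (sym (length-I-reframe K φ)) 1≤i))

  -- The extremal triangle and the flat case.

  -- The cone over the triangle (0, 1/k), (0, -1), ((k+1)(i+1), -1).
  Extremal : ℤ → ℤ → ℤ → ℤ → ℤ → Set
  Extremal k i x y n = 0ℤ < n × 0ℤ ≤ x × - n ≤ y × x ≤ (1ℤ + i) * (n - k * y)

  module ExtremalCorners (K : Cone) {k i : ℤ} (k≥0 : 0ℤ ≤ k) (i≥0 : 0ℤ ≤ i) where
    open Interior K using (C; combine₃)

    module _ (top : C 0ℤ 1ℤ k) (left : C 0ℤ -1ℤ 1ℤ) (right : C ((1ℤ + k) * (1ℤ + i)) -1ℤ 1ℤ) where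

      -- The weights are the barycentric coordinates times (1 + k)(1 + i); each is nonnegative by
      -- the inequality of the opposite edge.
      extremal⊆C : Extremal k i x y n → C x y n
      extremal⊆C {x} {y} {n} (n>0 , x≥0 , y≥-n , x≤) =
        combine₃ {a = (y + n) * (1ℤ + i)} {(1ℤ + i) * (n - k * y) - x} {x} {(1ℤ + k) * (1ℤ + i)} top left right
          (lin (Δ y≥-n ⊠ (nat 1 ⊹ i≥0)) (l₀ y n i)) (Δ x≤) x≥0 (*-pos (1+-pos k≥0) (1+-pos i≥0)) n>0
          (lx k i x y n) (ly k i x y n) (ln k i x y n)
        where
        1+-pos : ∀ {a} → 0ℤ ≤ a → 0ℤ < 1ℤ + a
        1+-pos {a} a≥0 = lin< a≥0 (l a)
          where
          l : ∀ a → 1ℤ + a - 0ℤ - 1ℤ ≡ a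
          l = solve-∀
        l₀ : ∀ y n i → (y + n) * (1ℤ + i) - 0ℤ ≡ (y - - n) * (1ℤ + i)
        l₀ = solve-∀
        lx : ∀ k i x y n → (y + n) * (1ℤ + i) * 0ℤ + ((1ℤ + i) * (n - k * y) - x) * 0ℤ + x * ((1ℤ + k) * (1ℤ + i))
             ≡ (1ℤ + k) * (1ℤ + i) * x
        lx = solve-∀
        ly : ∀ k i x y n → (y + n) * (1ℤ + i) * 1ℤ + ((1ℤ + i) * (n - k * y) - x) * -1ℤ + x * -1ℤ
             ≡ (1ℤ + k) * (1ℤ + i) * y
        ly = solve-∀
        ln : ∀ k i x y n → (y + n) * (1ℤ + i) * k + ((1ℤ + i) * (n - k * y) - x) * 1ℤ + x * 1ℤ
             ≡ (1ℤ + k) * (1ℤ + i) * n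
        ln = solve-∀

  module ExtremalShape (K : Config) {k i : ℤ} (k≥0 : 0ℤ ≤ k) (i≥0 : 0ℤ ≤ i)
    (top : Config.C K 0ℤ 1ℤ k) (left : Config.C K 0ℤ -1ℤ 1ℤ) (right : Config.C K ((1ℤ + k) * (1ℤ + i)) -1ℤ 1ℤ)
    (centre : Config.C K 1ℤ 0ℤ 1ℤ)
    (¬o₀ : ¬ Config.O K 0ℤ 0ℤ 1ℤ) (¬o₁ : ¬ Config.O K (1ℤ + i) 0ℤ 1ℤ) where
    open Config K using (cone; C; C-pos; cast; castO; crossing)

    private
      swap : Frame
      swap = frame 0ℤ 1ℤ 1ℤ 0ℤ 0ℤ 0ℤ -1ℤ refl refl

      slant : Frame
      slant = frame (- ((1ℤ + i) * k)) -1ℤ 1ℤ 0ℤ (1ℤ + i) 0ℤ 1ℤ (l ((1ℤ + i) * k)) refl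
        where
        l : ∀ a → - a * 0ℤ - -1ℤ * 1ℤ ≡ 1ℤ
        l = solve-∀

    -- The corners (0, -1) and (0, 1/k) lie on either side of the origin on x = 0, and (1, 0) lies
    -- to the right of this line. A point to the left would make the origin interior.
    right-of-left-edge : C x y n → 0ℤ ≤ x
    right-of-left-edge {x} {y} {n} c = ≮⇒≥ λ x<0 → ¬o₀ (O-pullback⁻ cone swap (K′.crossing 0ℤ { -1ℤ} {1ℤ} {1ℤ} {k} {0ℤ} {1ℤ} {1ℤ} {y} {x} {n} {0ℤ} {1ℤ}
        left (cast (lx₁ 1ℤ 0ℤ k) (ly₁ 1ℤ 0ℤ k) refl top) 0<1 -<+ 0<1
        centre 0<1 (cast (lx₁ y x n) (ly₁ y x n) refl c) x<0))
      where
      module K′ = Interior (pullback cone swap) using (crossing)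
      lx₁ : ∀ y x n → x ≡ 0ℤ * y + 1ℤ * x + 0ℤ * n
      lx₁ = solve-∀
      ly₁ : ∀ y x n → y ≡ 1ℤ * y + 0ℤ * x + 0ℤ * n
      ly₁ = solve-∀

    -- The same argument along the right edge: `slant` takes (1 + i)(n - k y) - x as its second
    -- coordinate, and (1 + i, 0) replaces the origin.
    left-of-right-edge : C x y n → x ≤ (1ℤ + i) * (n - k * y)
    left-of-right-edge {x} {y} {n} c = ≮⇒≥ λ x> → ¬o₁ (castO (l₀ i k) refl refl (O-pullback⁻ cone slant
      (K′.crossing 0ℤ { -1ℤ} {1ℤ} {1ℤ} {k} { -1ℤ} {(1ℤ + i) * (1ℤ + k)} {1ℤ} {y} {(1ℤ + i) * (n - k * y) - x} {n} {0ℤ} {1ℤ}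
        (cast (l₁ i k) refl refl right) (cast (l₂ i k) (l₂′ k) refl top) 0<1 -<+ 0<1
        (cast (l₃ i k) refl refl left) (*-pos (1+-pos i≥0) (1+-pos k≥0))
        (cast (l₄ i k x y n) (l₄′ i k x y n) refl c) (lin< (Δ< x>) (l₅ i k x y n)))))
      where
      module K′ = Interior (pullback cone slant) using (crossing)
      1+-pos : ∀ {a} → 0ℤ ≤ a → 0ℤ < 1ℤ + a
      1+-pos {a} a≥0 = lin< a≥0 (l a)
        where
        l : ∀ a → 1ℤ + a - 0ℤ - 1ℤ ≡ a
        l = solve-∀
      l₀ : ∀ i k → - ((1ℤ + i) * k) * 0ℤ + -1ℤ * 0ℤ + (1ℤ + i) * 1ℤ ≡ 1ℤ + i
      l₀ = solve-∀
      l₁ : ∀ i k → (1ℤ + k) * (1ℤ + i) ≡ - ((1ℤ + i) * k) * -1ℤ + -1ℤ * 0ℤ + (1ℤ + i) * 1ℤ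
      l₁ = solve-∀
      l₂ : ∀ i k → 0ℤ ≡ - ((1ℤ + i) * k) * 1ℤ + -1ℤ * 0ℤ + (1ℤ + i) * k
      l₂ = solve-∀
      l₂′ : ∀ k → 1ℤ ≡ 1ℤ * 1ℤ + 0ℤ * 0ℤ + 0ℤ * k
      l₂′ = solve-∀
      l₃ : ∀ i k → 0ℤ ≡ - ((1ℤ + i) * k) * -1ℤ + -1ℤ * ((1ℤ + i) * (1ℤ + k)) + (1ℤ + i) * 1ℤ
      l₃ = solve-∀
      l₄ : ∀ i k x y n → x ≡ - ((1ℤ + i) * k) * y + -1ℤ * ((1ℤ + i) * (n - k * y) - x) + (1ℤ + i) * n
      l₄ = solve-∀
      l₄′ : ∀ i k x y n → y ≡ 1ℤ * y + 0ℤ * ((1ℤ + i) * (n - k * y) - x) + 0ℤ * n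
      l₄′ = solve-∀
      l₅ : ∀ i k x y n → 0ℤ - ((1ℤ + i) * (n - k * y) - x) - 1ℤ ≡ x - (1ℤ + i) * (n - k * y) - 1ℤ
      l₅ = solve-∀

    shape : (∀ {x y n} → C x y n → - n ≤ y) → C x y n → Extremal k i x y n
    shape bottom c = C-pos c , right-of-left-edge c , bottom c , left-of-right-edge c

  -- A highest point (r/k, q/k). As q is an integer, a summit above y = 0 has height at least 1/k;
  -- this is how the denominator enters the flat case.
  Summit : Cone → ℤ → Set
  Summit K k = ∃ λ r → ∃ λ q → C r q k × (∀ {x y n} → C x y n → k * y ≤ n * q)
    where open Cone K

  module TwoRows (K : Config) {k : ℕ} (rows : ∀ {x y} → Config.C K x y 1ℤ → y ≡ 0ℤ ⊎ y ≡ -1ℤ)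
    {x₀ : ℤ} (o : Config.O K x₀ 0ℤ 1ℤ) (summit : Summit (Config.cone K) (+ k)) where
    open RowProperties K using (cone; C; C-pos; O; move; cast; castO; O⇒C; I; B; B!; O⇒I; B⇒C; B⇒¬O; support; O⇒row-B≤2; module Chord)

    private
      i j : ℕ
      i = length I
      j = length (row 0ℤ I)

      r = proj₁ summit
      q = proj₁ (proj₂ summit)

      apex : C r q (+ k)
      apex = proj₁ (proj₂ (proj₂ summit))

      cancel : ∀ {g a b} → 0ℤ < g → g * a ≤ g * b → a ≤ b
      cancel {+[1+ n ]} {a} {b} _ le = *-cancelˡ-≤-pos a b +[1+ n ] le
      cancel {+0} (+<+ ())

      k>0 : 0ℤ < + k
      k>0 = C-pos apex

      q>0 : 0ℤ < q
      q>0 = ≰⇒> λ q≤0 → go q≤0 (move o 0ℤ 1ℤ)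
        where
        go : q ≤ 0ℤ → (∃ λ t → 0ℤ < t × C (t * x₀ + 0ℤ) (t * 0ℤ + 1ℤ) (t * 1ℤ)) → ⊥
        go q≤0 (t , t>0 , c) = <⇒≱ k>0 (lin (Δ (proj₂ (proj₂ (proj₂ summit)) c) ⊹ <⇒≤ t>0 ⊠ Δ q≤0) (l (+ k) t q))
          where
          l : ∀ k t q → 0ℤ - k ≡ t * 1ℤ * q - k * (t * 0ℤ + 1ℤ) + t * (0ℤ - q)
          l = solve-∀

      row₀≤2 : length (row 0ℤ B) ℕ.≤ 2
      row₀≤2 = O⇒row-B≤2 o

      B≤ : length B ℕ.≤ length (row 0ℤ B) ℕ.+ (length (row -1ℤ B) ℕ.+ 0)
      B≤ = length≤rows (0ℤ ∷ -1ℤ ∷ []) B! λ b∈ → [ here , (λ e → there (here e)) ]′ (rows (B⇒C b∈))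

    module BottomRow (S : Span (row -1ℤ B)) where
      open Span S renaming (low to A; width to m)

      cA : C A -1ℤ 1ℤ
      cA = B⇒C (∈-row⁻ low∈)

      cA′ : C (A + + m) -1ℤ 1ℤ
      cA′ = B⇒C (∈-row⁻ high∈)

      open Chord q>0 0<1 apex apex cA cA′ public using (inside; bound; tight)

      -- The triangle of base m and height q/k above y = 0 has a chord of length q m/(q + k) at y =
      -- 0, with at most j lattice points in its interior.
      q*m≤ : q * + m ≤ (q + + k) * (1ℤ + + j)
      q*m≤ = lin (Δ bound) (l q (+ m) (+ k) (+ j) A r)
        where
        l : ∀ q m k j A r → (q + k) * (1ℤ + j) - q * m ≡ q * A + 1ℤ * r + (q * 1ℤ + 1ℤ * k) * (1ℤ + j) - (q * (A + m) + 1ℤ * r)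
        l = solve-∀

      product : ∀ k j → + (suc k ℕ.* suc j) ≡ (1ℤ + + k) * (1ℤ + + j)
      product k j = pos-* (suc k) (suc j)

      m≤ : m ℕ.≤ suc k ℕ.* suc j
      m≤ = drop‿+≤+ (subst (+ m ≤_) (sym (product k j)) (cancel q>0
        (lin (Δ q*m≤ ⊹ Δ< q>0 ⊠ <⇒≤ k>0 ⊠ (nat 1 ⊹ nat j)) (l q (+ m) (+ k) (+ j)))))
        where
        l : ∀ q m k j → q * ((1ℤ + k) * (1ℤ + j)) - q * m ≡ (q + k) * (1ℤ + j) - q * m + (q - 0ℤ - 1ℤ) * k * (1ℤ + j)
        l = solve-∀

      B≤m+3 : length B ℕ.≤ m ℕ.+ 3
      B≤m+3 = ℕP.≤-trans B≤ (ℕP.≤-trans (ℕP.+-mono-≤ row₀≤2 (ℕP.+-monoˡ-≤ 0 length≤)) (ℕP.≤-reflexive (l m)))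
        where
        l : ∀ m → 2 ℕ.+ (suc m ℕ.+ 0) ≡ m ℕ.+ 3
        l = ℕS.solve-∀

      bounded : length B ℕ.≤ suc k ℕ.* suc i ℕ.+ 3
      bounded = ℕP.≤-trans B≤m+3 (ℕP.+-monoˡ-≤ 3 (ℕP.≤-trans m≤ (ℕP.*-monoʳ-≤ (suc k) (ℕ.s≤s (length-row≤ 0ℤ I)))))

      module Equality (1≤i : 1 ℕ.≤ i) (b≡ : length B ≡ suc k ℕ.* suc i ℕ.+ 3) where

        M≤m : suc k ℕ.* suc i ℕ.≤ m
        M≤m = ℕP.+-cancelʳ-≤ 3 _ _ (subst (ℕ._≤ m ℕ.+ 3) b≡ B≤m+3)

        j≡i : j ≡ i
        j≡i = ℕP.≤-antisym (length-row≤ 0ℤ I)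
          (ℕP.≤-pred (ℕP.*-cancelˡ-≤ (suc k) (ℕP.≤-trans M≤m m≤)))

        m≡ : + m ≡ (1ℤ + + k) * (1ℤ + + j)
        m≡ = trans (cong +_ (ℕP.≤-antisym m≤ (subst (λ i → suc k ℕ.* suc i ℕ.≤ m) (sym j≡i) M≤m))) (product k j)

        -- Maximal m turns `q*m≤` into q k ≤ k: a summit higher than 1/k would shorten the longest
        -- possible base.
        q≡1 : q ≡ 1ℤ
        q≡1 = ≤-antisym (cancel k>0 (cancel {1ℤ + + j} (+<+ (ℕ.s≤s ℕ.z≤n))
                (lin (Δ (subst (λ m → q * m ≤ (q + + k) * (1ℤ + + j)) m≡ q*m≤)) (l q (+ k) (+ j)))))
                (i<j⇒suc[i]≤j q>0)
          where
          l : ∀ q k j → (1ℤ + j) * (k * 1ℤ) - (1ℤ + j) * (k * q) ≡ (q + k) * (1ℤ + j) - q * ((1ℤ + k) * (1ℤ + j))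
          l = solve-∀

        α : ℤ
        -- The chord at y = 0 now has length exactly j + 1, so its ends are integers, α and α + j +
        -- 1.
        tight-α : ∃ λ α → q * A + 1ℤ * r ≡ (q * 1ℤ + 1ℤ * + k) * α
        tight-α = tight (trans (cong₂ (λ m q → q * (A + m) + 1ℤ * r) m≡ q≡1)
          (trans (l A (+ k) (+ j) r) (cong (λ q → q * A + 1ℤ * r + (q * 1ℤ + 1ℤ * + k) * (1ℤ + + j)) (sym q≡1))))
          where
          l : ∀ A k j r → 1ℤ * (A + (1ℤ + k) * (1ℤ + j)) + 1ℤ * r ≡ 1ℤ * A + 1ℤ * r + (1ℤ * 1ℤ + 1ℤ * k) * (1ℤ + j)
          l = solve-∀
        α = proj₁ tight-α

        r≡ : r ≡ (1ℤ + + k) * α - A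
        r≡ = shift (trans (cong (λ q → q * A + 1ℤ * r) (sym q≡1)) (trans (proj₂ tight-α) (cong (λ q → (q * 1ℤ + 1ℤ * + k) * α) q≡1)))
                   (l A r (+ k) α)
          where
          l : ∀ A r k α → r - ((1ℤ + k) * α - A) ≡ 1ℤ * A + 1ℤ * r - (1ℤ * 1ℤ + 1ℤ * k) * α
          l = solve-∀

        interior : ∀ {X} → α < X → X < α + (1ℤ + + j) → O X 0ℤ 1ℤ
        interior {X} α<X X<β = inside X
          (subst₂ _<_ (sym (proj₂ tight-α)) refl (lin< (N>0 ⊠ Δ< α<X ⊹ N-1) (l₁ N X α)))
          (subst (N * X <_) (sym end) (lin< (N>0 ⊠ Δ< X<β ⊹ N-1) (l₂ N X α (+ j))))
          where
          N = q * 1ℤ + 1ℤ * + k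
          N-1 : NN (N - 1ℤ)
          N-1 = subst (λ q → NN (q * 1ℤ + 1ℤ * + k - 1ℤ)) (sym q≡1) (lin (<⇒≤ k>0) (l (+ k)))
            where
            l : ∀ k → 1ℤ * 1ℤ + 1ℤ * k - 1ℤ - 0ℤ ≡ k
            l = solve-∀
          N>0 : NN N
          N>0 = lin (N-1 ⊹ nat 1) (l N)
            where
            l : ∀ N → N - 0ℤ ≡ N - 1ℤ + 1ℤ
            l = solve-∀
          end : q * (A + + m) + 1ℤ * r ≡ N * (α + (1ℤ + + j))
          end = trans (cong₂ (λ m q → q * (A + m) + 1ℤ * r) m≡ q≡1)
                 (trans (cong (λ r → 1ℤ * (A + (1ℤ + + k) * (1ℤ + + j)) + 1ℤ * r) r≡)
                   (trans (l A (+ k) (+ j) α) (cong (λ q → (q * 1ℤ + 1ℤ * + k) * (α + (1ℤ + + j))) (sym q≡1))))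
            where
            l : ∀ A k j α → 1ℤ * (A + (1ℤ + k) * (1ℤ + j)) + 1ℤ * ((1ℤ + k) * α - A) ≡ (1ℤ * 1ℤ + 1ℤ * k) * (α + (1ℤ + j))
            l = solve-∀
          l₁ : ∀ N X α → N * X - N * α - 1ℤ ≡ N * (X - α - 1ℤ) + (N - 1ℤ)
          l₁ = solve-∀
          l₂ : ∀ N X α j → N * (α + (1ℤ + j)) - N * X - 1ℤ ≡ N * (α + (1ℤ + j) - X - 1ℤ) + (N - 1ℤ)
          l₂ = solve-∀

        crowded : ∀ β → ¬ (∀ {X} → X ∈ interval β (suc j) → O X 0ℤ 1ℤ)
        crowded β all = ℕP.<-irrefl refl (subst (ℕ._≤ j) (length-interval β (suc j))
          (unique-⊆-length (unique-interval β (suc j)) λ X∈ → ∈-row⁺ (O⇒I (all X∈))))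

        -- Otherwise α, ..., α + j would be j + 1 interior lattice points on a row that has only j.
        ¬left : ¬ O α 0ℤ 1ℤ
        ¬left h = crowded α λ {X} X∈ → let α≤X , X< = ∈-interval⁻ {α} {suc j} X∈ in by X α≤X X< (X ≟ α)
          where
          by : ∀ X → α ≤ X → X < α + + suc j → Dec (X ≡ α) → O X 0ℤ 1ℤ
          by X _ _ (yes e) = castO (sym e) refl refl h
          by X α≤X X< (no ne) = interior (≤∧≢⇒< α≤X (λ e → ne (sym e))) X<

        ¬right : ¬ O (α + (1ℤ + + j)) 0ℤ 1ℤ
        ¬right h = crowded (α + 1ℤ) λ {X} X∈ → let α<X , X< = ∈-interval⁻ {α + 1ℤ} {suc j} X∈ in
          by X (lin< (Δ α<X) (l₁ X α)) (lin (Δ< X<) (l₂ X α (+ j))) (X ≟ α + (1ℤ + + j))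
          where
          l₁ : ∀ X α → X - α - 1ℤ ≡ X - (α + 1ℤ)
          l₁ = solve-∀
          l₂ : ∀ X α j → α + (1ℤ + j) - X ≡ α + 1ℤ + (1ℤ + j) - X - 1ℤ
          l₂ = solve-∀
          by : ∀ X → α < X → X ≤ α + (1ℤ + + j) → Dec (X ≡ α + (1ℤ + + j)) → O X 0ℤ 1ℤ
          by X _ _ (yes e) = castO (sym e) refl refl h
          by X α<X X≤ (no ne) = interior α<X (≤∧≢⇒< X≤ ne)

        -- At most two boundary points lie on y = 0, so the bottom row has at least three; its
        -- middle ones are not interior, and `support` makes y = -1 an edge line.
        bottom : C x y n → - n ≤ y
        bottom {x} {y} {n} c = [ (λ le → contradiction (ℕP.≤-trans long le) λ { (ℕ.s≤s (ℕ.s≤s ())) }) ,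
          (λ { (a , b , d , a∈ , b∈ , d∈ , a<b , b<d) → subst (_≤ y) (-1*i≡-i n)
               (support (B⇒C (∈-row⁻ a∈)) (B⇒C (∈-row⁻ d∈)) a<b b<d (B⇒¬O (∈-row⁻ b∈)) (O⇒C o) -<+ c) }) ]′
          (three (row -1ℤ B) (unique-row -1ℤ B!))
          where
          long : 3 ℕ.≤ length (row -1ℤ B)
          long = ℕP.+-cancelˡ-≤ 2 3 (length (row -1ℤ B)) (begin
            1 ℕ.* 2 ℕ.+ 3 ≤⟨ ℕP.+-monoˡ-≤ 3 (ℕP.*-mono-≤ {1} {suc k} (ℕ.s≤s ℕ.z≤n) (ℕ.s≤s 1≤i)) ⟩
            suc k ℕ.* suc i ℕ.+ 3 ≡⟨ sym b≡ ⟩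
            length B ≤⟨ B≤ ⟩
            length (row 0ℤ B) ℕ.+ (length (row -1ℤ B) ℕ.+ 0) ≡⟨ cong (length (row 0ℤ B) ℕ.+_) (ℕP.+-identityʳ _) ⟩
            length (row 0ℤ B) ℕ.+ length (row -1ℤ B) ≤⟨ ℕP.+-monoˡ-≤ _ row₀≤2 ⟩
            2 ℕ.+ length (row -1ℤ B) ∎)
            where open ℕP.≤-Reasoning

        -- Shear and translate so that (A , -1) and (α , 0) become (0 , -1) and (0 , 0).
        normalForm : Frame
        normalForm = frame 1ℤ (α - A) 0ℤ 1ℤ α 0ℤ 1ℤ (l (α - A)) refl
          where
          l : ∀ a → 1ℤ * 1ℤ - a * 0ℤ ≡ 1ℤ
          l = solve-∀

        private
          module K′ = Config (reframe K normalForm) using (C; O)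

          top : K′.C 0ℤ 1ℤ (+ k)
          top = cast (trans r≡ (l A α (+ k))) (trans q≡1 (l′ (+ k))) refl apex
            where
            l : ∀ A α k → (1ℤ + k) * α - A ≡ 1ℤ * 0ℤ + (α - A) * 1ℤ + α * k
            l = solve-∀
            l′ : ∀ k → 1ℤ ≡ 0ℤ * 0ℤ + 1ℤ * 1ℤ + 0ℤ * k
            l′ = solve-∀

          left : K′.C 0ℤ -1ℤ 1ℤ
          left = cast (l A α) refl refl cA
            where
            l : ∀ A α → A ≡ 1ℤ * 0ℤ + (α - A) * -1ℤ + α * 1ℤ
            l = solve-∀

          right : K′.C ((1ℤ + + k) * (1ℤ + + j)) -1ℤ 1ℤ
          right = cast (trans (cong (_+_ A) m≡) (l A α ((1ℤ + + k) * (1ℤ + + j)))) (ly ((1ℤ + + k) * (1ℤ + + j))) refl cA′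
            where
            l : ∀ A α m → A + m ≡ 1ℤ * m + (α - A) * -1ℤ + α * 1ℤ
            l = solve-∀
            ly : ∀ m → -1ℤ ≡ 0ℤ * m + 1ℤ * -1ℤ + 0ℤ * 1ℤ
            ly = solve-∀

          on-row : ∀ X → α + X ≡ 1ℤ * X + (α - A) * 0ℤ + α * 1ℤ
          on-row X = l A α X
            where
            l : ∀ A α X → α + X ≡ 1ℤ * X + (α - A) * 0ℤ + α * 1ℤ
            l = solve-∀

          on-row₀ : ∀ X → 0ℤ ≡ 0ℤ * X + 1ℤ * 0ℤ + 0ℤ * 1ℤ
          on-row₀ = solve-∀

          centre : K′.C 1ℤ 0ℤ 1ℤ
          centre = cast (on-row 1ℤ) refl refl (O⇒C (interior (lin< (nat 0) (l α)) (lin< (Δ j>0) (l′ α (+ j)))))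
            where
            l : ∀ α → α + 1ℤ - α - 1ℤ ≡ 0ℤ
            l = solve-∀
            l′ : ∀ α j → α + (1ℤ + j) - (α + 1ℤ) - 1ℤ ≡ j - 1ℤ
            l′ = solve-∀
            j>0 : 1ℤ ≤ + j
            j>0 = +≤+ (subst (1 ℕ.≤_) (sym j≡i) 1≤i)

          ¬o₀ : ¬ K′.O 0ℤ 0ℤ 1ℤ
          ¬o₀ h = ¬left (castO (trans (sym (on-row 0ℤ)) (+-identityʳ α)) refl refl (O-pullback⁻ cone normalForm h))

          ¬o₁ : ¬ K′.O (1ℤ + + j) 0ℤ 1ℤ
          ¬o₁ h = ¬right (castO (sym (on-row (1ℤ + + j))) (sym (on-row₀ (1ℤ + + j))) refl (O-pullback⁻ cone normalForm h))

          bottom′ : ∀ {x y n} → K′.C x y n → - n ≤ y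
          bottom′ {x} {y} {n} c = subst (- n ≤_) (l x y n) (bottom c)
            where
            l : ∀ x y n → 0ℤ * x + 1ℤ * y + 0ℤ * n ≡ y
            l = solve-∀

          module Shape = ExtremalShape (reframe K normalForm) (<⇒≤ k>0) (nat j) top left right centre ¬o₀ ¬o₁ using (shape)
          module Corners = ExtremalCorners (pullback cone normalForm) (<⇒≤ k>0) (nat j)

        extremal : (∀ {x y n} → K′.C x y n → Extremal (+ k) (+ i) x y n)
                   × (∀ {x y n} → Extremal (+ k) (+ i) x y n → K′.C x y n)
        extremal = subst (λ i → (∀ {x y n} → K′.C x y n → Extremal (+ k) (+ i) x y n)
                   × (∀ {x y n} → Extremal (+ k) (+ i) x y n → K′.C x y n)) j≡i
          ((λ {x} {y} {n} c → Shape.shape {x} {y} {n} (λ {x} {y} {n} → bottom′ {x} {y} {n}) c) ,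
           λ {x} {y} {n} → Corners.extremal⊆C top left right {x} {y} {n})

    bounded : length B ℕ.≤ suc k ℕ.* suc i ℕ.+ 3
    bounded = [ (λ empty → ℕP.≤-trans B≤ (subst (λ xs → length (row 0ℤ B) ℕ.+ (length xs ℕ.+ 0) ℕ.≤ suc k ℕ.* suc i ℕ.+ 3)
                  (sym empty) (ℕP.≤-trans (ℕP.+-monoˡ-≤ 0 row₀≤2) (ℕP.≤-trans (ℕP.n≤1+n 2) (ℕP.m≤n+m 3 (suc k ℕ.* suc i)))))) ,
                BottomRow.bounded ]′ (span (row -1ℤ B) (unique-row -1ℤ B!))

    equality : 1 ℕ.≤ i → length B ≡ suc k ℕ.* suc i ℕ.+ 3 → Σ Frame λ χ → let open Cone (pullback cone χ) using () renaming (C to C′) in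
      (∀ {x y n} → C′ x y n → Extremal (+ k) (+ i) x y n) × (∀ {x y n} → Extremal (+ k) (+ i) x y n → C′ x y n)
    equality 1≤i b≡ = [ (λ empty → contradiction (short empty) (ℕP.<⇒≱ (ℕP.m≤n+m 3 (suc k ℕ.* suc i)))) ,
                        (λ S → let open BottomRow.Equality S 1≤i b≡ using (normalForm; extremal) in normalForm , extremal) ]′
                      (span (row -1ℤ B) (unique-row -1ℤ B!))
      where
      short : row -1ℤ B ≡ [] → suc k ℕ.* suc i ℕ.+ 3 ℕ.≤ 2
      short empty = subst (ℕ._≤ 2) b≡ (ℕP.≤-trans B≤ (subst (λ xs → length (row 0ℤ B) ℕ.+ (length xs ℕ.+ 0) ℕ.≤ 2)
                      (sym empty) (ℕP.+-monoˡ-≤ 0 row₀≤2)))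

  IsExtremal : Cone → ℕ → ℕ → Set
  IsExtremal K k i = Σ Frame λ χ → let open Cone (pullback K χ) in
    (∀ {x y n} → C x y n → Extremal (+ k) (+ i) x y n) × (∀ {x y n} → Extremal (+ k) (+ i) x y n → C x y n)

  isExtremal-pullback : ∀ K φ {k i} → IsExtremal (pullback K φ) k i → IsExtremal K k i
  isExtremal-pullback K φ (χ , to , from) = φ ∘ᶠ χ ,
    (λ {x} {y} {n} c → to {x} {y} {n} (cast (X-∘ φ χ x y n) (Y-∘ φ χ x y n) refl c)) ,
    (λ {x} {y} {n} e → cast (sym (X-∘ φ χ x y n)) (sym (Y-∘ φ χ x y n)) refl (from {x} {y} {n} e))
    where open Interior K

  OrientedFlat : Config → Set
  OrientedFlat K = Σ Frame λ φ → (∀ {x y} → Cone.C (pullback (Config.cone K) φ) x y 1ℤ → y ≡ 0ℤ ⊎ y ≡ -1ℤ)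
                   × ∃ λ x₀ → Interior.O (pullback (Config.cone K) φ) x₀ 0ℤ 1ℤ

  -- Flatness does not tell which of the two lines meets the interior; the half-turn that exchanges
  -- the rows 0 and -1 puts an interior lattice point on y = 0.
  orient : ∀ K → 1 ℕ.≤ length (Config.I K) → Flat (Config.cone K) → OrientedFlat K
  orient K 1≤i (φ , rows) = pick (Config.I K) 1≤i (λ z∈ → z∈)
    where
    open Config K using (cone; O; cast; castO; O⇒C; I; I⇒O)
    module ψ = Frame (φ ⁻¹)
    module φ = Frame φ
    module Kφ = Interior (pullback cone φ) using (O; O⇒C)
    turn : Frame
    turn = frame -1ℤ 0ℤ 0ℤ -1ℤ 0ℤ -1ℤ 1ℤ refl refl
    by-level : ∀ {x y} → Kφ.O x y 1ℤ → y ≡ 0ℤ ⊎ y ≡ -1ℤ → OrientedFlat K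
    by-level {x} o (inj₁ refl) = φ , rows , x , o
    by-level {x} o (inj₂ refl) = φ ∘ᶠ turn , turned , - x , turned-o
      where
      lx : ∀ x → x ≡ -1ℤ * - x + 0ℤ * 0ℤ + 0ℤ * 1ℤ
      lx = solve-∀
      ly : ∀ x → -1ℤ ≡ 0ℤ * - x + -1ℤ * 0ℤ + -1ℤ * 1ℤ
      ly = solve-∀
      l : ∀ x y h → y - (- h - 1ℤ) ≡ - (0ℤ * x + -1ℤ * y + -1ℤ * 1ℤ) - - h
      l = solve-∀
      turned : ∀ {x y} → Cone.C (pullback cone (φ ∘ᶠ turn)) x y 1ℤ → y ≡ 0ℤ ⊎ y ≡ -1ℤ
      turned {x} {y} c = [ (λ e → inj₂ (shift (cong -_ e) (l x y 0ℤ))) , (λ e → inj₁ (shift (cong -_ e) (l x y -1ℤ))) ]′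
        (rows {Frame.X turn x y 1ℤ} {Frame.Y turn x y 1ℤ} (cast (X-∘ φ turn x y 1ℤ) (Y-∘ φ turn x y 1ℤ) refl c))
      turned-o : Interior.O (pullback cone (φ ∘ᶠ turn)) (- x) 0ℤ 1ℤ
      turned-o = O-pullback⁺ cone (φ ∘ᶠ turn) (castO (sym (X-∘ φ turn (- x) 0ℤ 1ℤ)) (sym (Y-∘ φ turn (- x) 0ℤ 1ℤ)) refl
        (castO (cong₂ (λ u v → φ.X u v 1ℤ) (lx x) (ly x)) (cong₂ (λ u v → φ.Y u v 1ℤ) (lx x) (ly x)) refl
          (O-pullback⁻ cone φ o)))
    pick : ∀ L → 1 ℕ.≤ length L → (∀ {z} → z ∈ L → z ∈ I) → OrientedFlat K
    pick ((x , y) ∷ _) _ sub = by-level o (rows {ψ.X x y 1ℤ} {ψ.Y x y 1ℤ} (Kφ.O⇒C o))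
      where
      o : Kφ.O (ψ.X x y 1ℤ) (ψ.Y x y 1ℤ) 1ℤ
      o = O-pullback⁺ cone φ (castO (sym (X-right φ x y 1ℤ)) (sym (Y-right φ x y 1ℤ)) refl (I⇒O (sub (here refl))))

  flat-bound : ∀ K {k} → 1 ℕ.≤ length (Config.I K) → Flat (Config.cone K) →
    (∀ φ → Summit (pullback (Config.cone K) φ) (+ k)) →
    length (Config.B K) ℕ.≤ suc k ℕ.* suc (length (Config.I K)) ℕ.+ 3
    × (length (Config.B K) ≡ suc k ℕ.* suc (length (Config.I K)) ℕ.+ 3 → IsExtremal (Config.cone K) k (length (Config.I K)))
  flat-bound K {k} 1≤i flat summit = from-oriented (orient K 1≤i flat)
    where
    from-oriented : OrientedFlat K →
      length (Config.B K) ℕ.≤ suc k ℕ.* suc (length (Config.I K)) ℕ.+ 3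
      × (length (Config.B K) ≡ suc k ℕ.* suc (length (Config.I K)) ℕ.+ 3 → IsExtremal (Config.cone K) k (length (Config.I K)))
    from-oriented (φ , rows , x₀ , o) = subst₂ ℕ._≤_ b≡ (bound≡ i≡) R.bounded ,
      λ eq → subst (IsExtremal (Config.cone K) k) i≡ (isExtremal-pullback (Config.cone K) φ {k} {length (Config.I (reframe K φ))}
        (R.equality (subst (1 ℕ.≤_) (sym i≡) 1≤i) (trans b≡ (trans eq (sym (bound≡ i≡))))))
      where
      i≡ = length-I-reframe K φ
      b≡ = length-B-reframe K φ
      bound≡ : ∀ {i j} → i ≡ j → suc k ℕ.* suc i ℕ.+ 3 ≡ suc k ℕ.* suc j ℕ.+ 3
      bound≡ = cong (λ i → suc k ℕ.* suc i ℕ.+ 3)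
      module R = TwoRows (reframe K φ) {k} (λ {x} {y} → rows {x} {y}) o (summit φ) using (bounded; equality)

  -- Boundary lattice points of the extremal triangle.

  module ExtremalCount (K : Config) {k i : ℕ} (2≤k : 2 ℕ.≤ k)
    (to : ∀ {x y n} → Config.C K x y n → Extremal (+ k) (+ i) x y n)
    (from : ∀ {x y n} → Extremal (+ k) (+ i) x y n → Config.C K x y n) where
    open Config K using (cone; C; O; move; insideTriangle; B; B!; B⇒C; B⇒¬O; ¬O⇒B)

    private
      M = suc k ℕ.* suc i

      -- The two ends of the chord at y = 0 and the M + 1 points of the base. The apex is not a
      -- lattice point, as its height 1/k is less than 1.
      points : List (ℤ × ℤ)
      points = (0ℤ , 0ℤ) ∷ (+ suc i , 0ℤ) ∷ map (_, -1ℤ) (interval 0ℤ (suc M))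

      M≡ : + M ≡ (1ℤ + + k) * (1ℤ + + i)
      M≡ = pos-* (suc k) (suc i)

      unique : Unique points
      unique = (nonzero ∷ All.map⁺ (All.tabulate λ _ ())) ∷ All.map⁺ (All.tabulate λ _ ()) ∷ map⁺ (cong proj₁) (unique-interval 0ℤ (suc M))
        where
        open import Data.List.Relation.Unary.AllPairs using (_∷_)
        open import Data.List.Relation.Unary.All using (_∷_)
        import Data.List.Relation.Unary.All as All
        import Data.List.Relation.Unary.All.Properties as All
        nonzero : (0ℤ , 0ℤ) ≢ (+ suc i , 0ℤ)
        nonzero ()

      strict-x : O x y n → 0ℤ < x
      strict-x {x} {y} {n} o = ≰⇒> λ x≤0 → go x≤0 (move o -1ℤ 0ℤ)
        where
        go : x ≤ 0ℤ → (∃ λ t → 0ℤ < t × C (t * x + -1ℤ) (t * y + 0ℤ) (t * n)) → ⊥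
        go x≤0 (t , t>0 , c) = <⇒≱ 0<1 (lin (proj₁ (proj₂ (to c)) ⊹ <⇒≤ t>0 ⊠ Δ x≤0) (l t x))
          where
          l : ∀ t x → 0ℤ - 1ℤ ≡ t * x + -1ℤ + t * (0ℤ - x)
          l = solve-∀

      strict-y : O x y n → - n < y
      strict-y {x} {y} {n} o = ≰⇒> λ y≤-n → go y≤-n (move o 0ℤ -1ℤ)
        where
        go : y ≤ - n → (∃ λ t → 0ℤ < t × C (t * x + 0ℤ) (t * y + -1ℤ) (t * n)) → ⊥
        go y≤-n (t , t>0 , c) = <⇒≱ 0<1 (lin (Δ (proj₁ (proj₂ (proj₂ (to c)))) ⊹ <⇒≤ t>0 ⊠ Δ y≤-n) (l t y n))
          where
          l : ∀ t y n → 0ℤ - 1ℤ ≡ t * y + -1ℤ - - (t * n) + t * (- n - y)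
          l = solve-∀

      strict-right : O x y n → x < (1ℤ + + i) * (n - + k * y)
      strict-right {x} {y} {n} o = ≰⇒> λ le → go le (move o 1ℤ 0ℤ)
        where
        go : (1ℤ + + i) * (n - + k * y) ≤ x → (∃ λ t → 0ℤ < t × C (t * x + 1ℤ) (t * y + 0ℤ) (t * n)) → ⊥
        go le (t , t>0 , c) = <⇒≱ 0<1 (lin (Δ (proj₂ (proj₂ (proj₂ (to c)))) ⊹ <⇒≤ t>0 ⊠ Δ le) (l t x y n (+ k) (+ i)))
          where
          l : ∀ t x y n k i → 0ℤ - 1ℤ ≡ (1ℤ + i) * (t * n - k * (t * y + 0ℤ)) - (t * x + 1ℤ) + t * (x - (1ℤ + i) * (n - k * y))
          l = solve-∀

      origin-right : ∀ i k → (1ℤ + i) * (1ℤ - k * 0ℤ) ≡ 1ℤ + i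
      origin-right = solve-∀

      points⊆B : ∀ {z} → z ∈ points → z ∈ B
      points⊆B (here refl) = ¬O⇒B (from (0<1 , ≤-refl , -≤+ , subst (0ℤ ≤_) (sym (origin-right (+ i) (+ k))) (nat (suc i))))
        λ o → <-irrefl refl (strict-x o)
      points⊆B (there (here refl)) = ¬O⇒B (from (0<1 , nat (suc i) , -≤+ , ≤-reflexive (sym (origin-right (+ i) (+ k)))))
        λ o → <-irrefl refl (subst (+ suc i <_) (origin-right (+ i) (+ k)) (strict-right o))
      points⊆B (there (there p)) = low (∈-map⁻ (_, -1ℤ) p)
        where
        low : ∀ {z} → (∃ λ x → x ∈ interval 0ℤ (suc M) × z ≡ (x , -1ℤ)) → z ∈ B
        low (x , x∈ , refl) = let x≥0 , x< = ∈-interval⁻ {0ℤ} {suc M} x∈ in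
          ¬O⇒B (from (0<1 , x≥0 , ≤-refl , subst (x ≤_) (trans M≡ (l (+ k) (+ i))) (lin (Δ< x<) (l′ x (+ M)))))
            λ o → <-irrefl refl (strict-y o)
          where
          l : ∀ k i → (1ℤ + k) * (1ℤ + i) ≡ (1ℤ + i) * (1ℤ - k * -1ℤ)
          l = solve-∀
          l′ : ∀ x M → M - x ≡ 0ℤ + (1ℤ + M) - x - 1ℤ
          l′ = solve-∀

      corners : Interior.C cone 0ℤ 1ℤ (+ k) × C 0ℤ -1ℤ 1ℤ × C ((1ℤ + + k) * (1ℤ + + i)) -1ℤ 1ℤ
      corners = from (k>0 , ≤-refl , neg-≤-pos {k} {1} , ≤-reflexive (l₁ (+ k) (+ i))) ,
        from (0<1 , ≤-refl , ≤-refl , subst (0ℤ ≤_) (trans M≡ (l₂ (+ k) (+ i))) (nat M)) ,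
        from (0<1 , subst (0ℤ ≤_) M≡ (nat M) , ≤-refl , ≤-reflexive (l₂ (+ k) (+ i)))
        where
        k>0 : 0ℤ < + k
        k>0 = +<+ (ℕP.<-≤-trans (ℕ.s≤s ℕ.z≤n) 2≤k)
        l₁ : ∀ k i → 0ℤ ≡ (1ℤ + i) * (k - k * 1ℤ)
        l₁ = solve-∀
        l₂ : ∀ k i → (1ℤ + k) * (1ℤ + i) ≡ (1ℤ + i) * (1ℤ - k * -1ℤ)
        l₂ = solve-∀

      row₀-interior : ∀ {x} → 0ℤ < x → x < 1ℤ + + i → O x 0ℤ 1ℤ
      row₀-interior {x} x>0 x< = insideTriangle {a = 1ℤ + + i} {1ℤ + + i - x} {x} {(1ℤ + + k) * (1ℤ + + i)}
        (proj₁ corners) (proj₁ (proj₂ corners)) (proj₂ (proj₂ corners)) D≢0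
        (+<+ (ℕ.s≤s ℕ.z≤n)) (lin< (Δ< x<) (l₀ x (+ i))) x>0 M>0 (lx (+ k) (+ i) x) (ly (+ k) (+ i) x) (ln (+ k) (+ i) x)
        where
        M>0 : 0ℤ < (1ℤ + + k) * (1ℤ + + i)
        M>0 = subst (0ℤ <_) M≡ (+<+ (ℕ.s≤s ℕ.z≤n))
        l₀ : ∀ x i → 1ℤ + i - x - 0ℤ - 1ℤ ≡ 1ℤ + i - x - 1ℤ
        l₀ = solve-∀
        lx : ∀ k i x → (1ℤ + i) * 0ℤ + (1ℤ + i - x) * 0ℤ + x * ((1ℤ + k) * (1ℤ + i)) ≡ (1ℤ + k) * (1ℤ + i) * x
        lx = solve-∀
        ly : ∀ k i x → (1ℤ + i) * 1ℤ + (1ℤ + i - x) * -1ℤ + x * -1ℤ ≡ (1ℤ + k) * (1ℤ + i) * 0ℤ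
        ly = solve-∀
        ln : ∀ k i x → (1ℤ + i) * k + (1ℤ + i - x) * 1ℤ + x * 1ℤ ≡ (1ℤ + k) * (1ℤ + i) * 1ℤ
        ln = solve-∀
        Dl : ∀ k m → 0ℤ * (-1ℤ * 1ℤ - 1ℤ * -1ℤ) - 1ℤ * (0ℤ * 1ℤ - 1ℤ * m) + k * (0ℤ * -1ℤ - -1ℤ * m) ≡ (1ℤ + k) * m
        Dl = solve-∀
        D≢0 : det 0ℤ 1ℤ (+ k) 0ℤ -1ℤ 1ℤ ((1ℤ + + k) * (1ℤ + + i)) -1ℤ 1ℤ ≢ 0ℤ
        D≢0 D≡0 = <⇒≢ (*-pos {1ℤ + + k} (+<+ (ℕ.s≤s ℕ.z≤n)) M>0)
          (sym (trans (sym (Dl (+ k) ((1ℤ + + k) * (1ℤ + + i)))) D≡0))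

      B⊆points : ∀ {z} → z ∈ B → z ∈ points
      B⊆points {x , y} b∈ = by-level (to (B⇒C b∈)) y b∈ refl
        where
        by-level : Extremal (+ k) (+ i) x y 1ℤ → ∀ y′ → (x , y) ∈ B → y ≡ y′ → (x , y) ∈ points
        by-level (_ , x≥0 , _ , x≤) +0 b∈ refl = by-x (x ≟ 0ℤ) (x ≟ 1ℤ + + i)
          where
          x≤′ : x ≤ 1ℤ + + i
          x≤′ = subst (x ≤_) (origin-right (+ i) (+ k)) x≤
          by-x : Dec (x ≡ 0ℤ) → Dec (x ≡ 1ℤ + + i) → (x , 0ℤ) ∈ points
          by-x (yes refl) _ = here refl
          by-x _ (yes refl) = there (here refl)
          by-x (no ne) (no ne′) = contradiction (row₀-interior (≤∧≢⇒< x≥0 (λ e → ne (sym e))) (≤∧≢⇒< x≤′ ne′)) (B⇒¬O b∈)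
        by-level (_ , x≥0 , _ , x≤) -[1+ zero ] b∈ refl = there (there (∈-map⁺ _ (∈-interval⁺ x≥0
          (lin< (Δ (subst (x ≤_) (trans (l (+ k) (+ i)) (sym M≡)) x≤)) (l′ x (+ M))))))
          where
          l : ∀ k i → (1ℤ + i) * (1ℤ - k * -1ℤ) ≡ (1ℤ + k) * (1ℤ + i)
          l = solve-∀
          l′ : ∀ x M → 0ℤ + (1ℤ + M) - x - 1ℤ ≡ M - x
          l′ = solve-∀
        -- Here k ≥ 2 makes 1 - k (1 + m) negative, so the right edge would force x < 0.
        by-level (_ , x≥0 , _ , x≤) +[1+ m ] b∈ refl = ⊥-elim (<⇒≱ 0<1
          (lin (nat i ⊠ (nat k ⊠ nat m ⊹ k≥2 ⊹ nat 1) ⊹ nat k ⊠ nat m ⊹ k≥2 ⊹ x≥0 ⊹ Δ x≤) (l (+ k) (+ i) (+ m) x)))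
          where
          k≥2 : NN (+ k - + 2)
          k≥2 = Δ (+≤+ 2≤k)
          l : ∀ k i m x → 0ℤ - 1ℤ ≡ i * (k * m + (k - + 2) + 1ℤ) + k * m + (k - + 2) + x + ((1ℤ + i) * (1ℤ - k * (1ℤ + m)) - x)
          l = solve-∀
        by-level (_ , _ , -≤- () , _) -[1+ suc m ] b∈ refl

    count : length B ≡ suc k ℕ.* suc i ℕ.+ 3
    count = trans (ℕP.≤-antisym (unique-⊆-length B! B⊆points) (unique-⊆-length unique points⊆B))
      (trans (cong (λ l → suc (suc l)) (trans (length-map _ (interval 0ℤ (suc M))) (length-interval 0ℤ (suc M))))
        (ℕP.+-comm 3 M))

-- Rational polygons and their integral cones.

module RationalPolygons where

  open LatticeGeometry using (*-pos; *-cancel-pos; 0<1; NN; Δ; nat; lin; _⊹_; _⊠_; zero⊎pos)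
  open LatticeGeometry using (Cone; module Cone; module Interior; Frame; frame; module Frame; _⁻¹; X-right; Y-right; X-left; Y-left)
  open LatticeGeometry using (pullback; Config; reframe; Tripled; module Tripled)
  open LatticeGeometry using (Extremal; module ExtremalCorners; Summit; IsExtremal)
  open import Data.Integer as ℤ using (ℤ; +_; -[1+_]; +[1+_]; 0ℤ; 1ℤ; -1ℤ)
  import Data.Integer.Properties as ℤP
  import Data.Integer.Tactic.RingSolver as ℤS
  open import Data.Nat.Coprimality using (1-coprimeTo) renaming (sym to coprime-sym)
  open import Data.Fin using (Fin; zero; suc)
  open import Data.Maybe using (Maybe; just; nothing)
  open import Data.Rational
  open import Data.Rational.Properties
  open import Data.Rational.Unnormalised as ℚᵘ using (mkℚᵘ; *≡*; *≤*; *<*)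
  import Data.Rational.Unnormalised.Properties as ℚᵘP
  open import Tactic.RingSolver using (solve-∀)
  open import Tactic.RingSolver.Core.AlmostCommutativeRing using (AlmostCommutativeRing; fromCommutativeRing)

  ι : ℤ → ℚ
  ι = ℤ→ℚ

  ℚ-ring : AlmostCommutativeRing _ _
  ℚ-ring = fromCommutativeRing +-*-commutativeRing λ x → isZero (0ℚ ≟ x)
    where
    isZero : ∀ {x} → Dec (0ℚ ≡ x) → Maybe (0ℚ ≡ x)
    isZero (yes e) = just e
    isZero (no _) = nothing

  private
    embed : ∀ a → toℚᵘ (ι a) ℚᵘ.≃ mkℚᵘ a 0
    embed a = toℚᵘ-fromℚᵘ (mkℚᵘ a 0)

  ι-+ : ∀ a b → ι (a ℤ.+ b) ≡ ι a + ι b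
  ι-+ a b = toℚᵘ-injective (ℚᵘP.≃-trans (embed (a ℤ.+ b)) (ℚᵘP.≃-trans (*≡* (l a b))
    (ℚᵘP.≃-trans (ℚᵘP.≃-sym (ℚᵘP.+-cong (embed a) (embed b))) (ℚᵘP.≃-sym (toℚᵘ-homo-+ (ι a) (ι b))))))
    where
    l : ∀ a b → (a ℤ.+ b) ℤ.* (ℤ.1ℤ ℤ.* ℤ.1ℤ) ≡ (a ℤ.* ℤ.1ℤ ℤ.+ b ℤ.* ℤ.1ℤ) ℤ.* ℤ.1ℤ
    l = ℤS.solve-∀

  ι-* : ∀ a b → ι (a ℤ.* b) ≡ ι a * ι b
  ι-* a b = toℚᵘ-injective (ℚᵘP.≃-trans (embed (a ℤ.* b)) (ℚᵘP.≃-trans (*≡* (l a b))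
    (ℚᵘP.≃-trans (ℚᵘP.≃-sym (ℚᵘP.*-cong (embed a) (embed b))) (ℚᵘP.≃-sym (toℚᵘ-homo-* (ι a) (ι b))))))
    where
    l : ∀ a b → (a ℤ.* b) ℤ.* (ℤ.1ℤ ℤ.* ℤ.1ℤ) ≡ (a ℤ.* b) ℤ.* ℤ.1ℤ
    l = ℤS.solve-∀

  ι-injective : ∀ {a b} → ι a ≡ ι b → a ≡ b
  ι-injective {a} {b} eq with ℚᵘP.≃-trans (ℚᵘP.≃-sym (embed a)) (ℚᵘP.≃-trans (toℚᵘ-cong eq) (embed b))
  ... | *≡* e = trans (sym (ℤP.*-identityʳ a)) (trans e (ℤP.*-identityʳ b))

  ι-mono-≤ : ∀ {a b} → a ℤ.≤ b → ι a ≤ ι b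
  ι-mono-≤ {a} {b} le = toℚᵘ-cancel-≤ (ℚᵘP.≤-respˡ-≃ (ℚᵘP.≃-sym (embed a)) (ℚᵘP.≤-respʳ-≃ (ℚᵘP.≃-sym (embed b))
    (*≤* (subst₂ ℤ._≤_ (sym (ℤP.*-identityʳ a)) (sym (ℤP.*-identityʳ b)) le))))

  ι-mono-< : ∀ {a b} → a ℤ.< b → ι a < ι b
  ι-mono-< {a} {b} lt = toℚᵘ-cancel-< (ℚᵘP.<-respˡ-≃ (ℚᵘP.≃-sym (embed a)) (ℚᵘP.<-respʳ-≃ (ℚᵘP.≃-sym (embed b))
    (*<* (subst₂ ℤ._<_ (sym (ℤP.*-identityʳ a)) (sym (ℤP.*-identityʳ b)) lt))))

  ι-cancel-≤ : ∀ {a b} → ι a ≤ ι b → a ℤ.≤ b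
  ι-cancel-≤ {a} {b} le = ℤP.≮⇒≥ λ lt → <-irrefl refl (<-≤-trans (ι-mono-< lt) le)

  ι-cancel-< : ∀ {a b} → ι a < ι b → a ℤ.< b
  ι-cancel-< {a} {b} lt = ℤP.≰⇒> λ le → <-irrefl refl (<-≤-trans lt (ι-mono-≤ le))

  ι-denominator : ∀ p → ι (↧ p) * p ≡ ι (↥ p)
  ι-denominator p@record{} = toℚᵘ-injective (ℚᵘP.≃-trans (toℚᵘ-homo-* (ι (↧ p)) p)
    (ℚᵘP.≃-trans (ℚᵘP.*-cong (embed (↧ p)) (ℚᵘP.≃-refl {toℚᵘ p})) (ℚᵘP.≃-trans (*≡* (l (↥ p) (↧ p))) (ℚᵘP.≃-sym (embed (↥ p))))))
    where
    l : ∀ n d → d ℤ.* n ℤ.* ℤ.1ℤ ≡ n ℤ.* (ℤ.1ℤ ℤ.* d)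
    l = ℤS.solve-∀

  reciprocal : ∀ {n} → 0ℚ < n → ∃ λ u → n * u ≡ 1ℚ × 0ℚ < u
  reciprocal {n} n>0 = 1/ n , *-inverseʳ n , positive⁻¹ (1/ n) {{1/pos⇒pos n}}
    where
    instance
      n-positive : Positive n
      n-positive = positive n>0
      n≢0 : NonZero n
      n≢0 = pos⇒nonZero n

  *-cancel : ∀ {n p q} → 0ℚ < n → n * p ≡ n * q → p ≡ q
  *-cancel {n} {p} {q} n>0 eq = let u , nu≡1 , _ = reciprocal n>0 in
    trans (sym (l u nu≡1 p)) (trans (cong (u *_) eq) (l u nu≡1 q))
    where
    l : ∀ u → n * u ≡ 1ℚ → ∀ p → u * (n * p) ≡ p
    l u nu≡1 p = trans (l′ u n p) (trans (cong (_* p) nu≡1) (*-identityˡ p))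
      where
      l′ : ∀ u n p → u * (n * p) ≡ n * u * p
      l′ = solve-∀ ℚ-ring

  *-nonneg : ∀ {p q} → 0ℚ ≤ p → 0ℚ ≤ q → 0ℚ ≤ p * q
  *-nonneg {p} {q} p≥0 q≥0 = subst (_≤ p * q) (*-zeroʳ p) (*-monoˡ-≤-nonNeg p {{nonNegative p≥0}} q≥0)

  ≤∧≢⇒< : ∀ {p q} → p ≤ q → p ≢ q → p < q
  ≤∧≢⇒< p≤q p≢q = ≰⇒> λ q≤p → p≢q (≤-antisym p≤q q≤p)

  ι-neg : ∀ a → ι (ℤ.- a) ≡ - ι a
  ι-neg a = trans (l (ι (ℤ.- a)) (ι a)) (trans (cong (_+ - ι a) (trans (sym (ι-+ (ℤ.- a) a)) (cong ι (ℤP.+-inverseˡ a)))) (+-identityˡ _))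
    where
    l : ∀ x y → x ≡ x + y + - y
    l = solve-∀ ℚ-ring

  sumQ-cong : ∀ n {f g : Fin n → ℚ} → (∀ j → f j ≡ g j) → sumQ n f ≡ sumQ n g
  sumQ-cong zero _ = refl
  sumQ-cong (suc n) eq = cong₂ _+_ (eq zero) (sumQ-cong n λ j → eq (suc j))

  sumQ-linear : ∀ n a b (f g : Fin n → ℚ) → sumQ n (λ j → a * f j + b * g j) ≡ a * sumQ n f + b * sumQ n g
  sumQ-linear zero a b f g = l a b
    where
    l : ∀ a b → 0ℚ ≡ a * 0ℚ + b * 0ℚ
    l = solve-∀ ℚ-ring
  sumQ-linear (suc n) a b f g = trans (cong (_+_ (a * f zero + b * g zero)) (sumQ-linear n a b (λ j → f (suc j)) (λ j → g (suc j))))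
    (l a b (f zero) (g zero) (sumQ n λ j → f (suc j)) (sumQ n λ j → g (suc j)))
    where
    l : ∀ a b x y s t → a * x + b * y + (a * s + b * t) ≡ a * (x + s) + b * (y + t)
    l = solve-∀ ℚ-ring

  sumQ-mono : ∀ n {f g : Fin n → ℚ} → (∀ j → f j ≤ g j) → sumQ n f ≤ sumQ n g
  sumQ-mono zero _ = ≤-refl
  sumQ-mono (suc n) le = +-mono-≤ (le zero) (sumQ-mono n λ j → le (suc j))

  sumQ-nonneg : ∀ n {f : Fin n → ℚ} → (∀ j → 0ℚ ≤ f j) → 0ℚ ≤ sumQ n f
  sumQ-nonneg zero _ = ≤-refl
  sumQ-nonneg (suc n) le = +-mono-≤ (le zero) (sumQ-nonneg n λ j → le (suc j))

  sumQ-vanish : ∀ n {f : Fin n → ℚ} → (∀ j → 0ℚ ≤ f j) → sumQ n f ≡ 0ℚ → ∀ j → f j ≡ 0ℚ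
  sumQ-vanish (suc n) {f} le eq = λ { zero → head ; (suc j) → sumQ-vanish n (λ j → le (suc j)) tail j }
    where
    rest = sumQ n λ j → f (suc j)
    rest≥0 : 0ℚ ≤ rest
    rest≥0 = sumQ-nonneg n λ j → le (suc j)
    head : f zero ≡ 0ℚ
    head = ≤-antisym (subst₂ _≤_ (+-identityʳ (f zero)) eq (+-monoʳ-≤ (f zero) rest≥0)) (le zero)
    tail : rest ≡ 0ℚ
    tail = ≤-antisym (subst₂ _≤_ (+-identityˡ rest) eq (+-monoˡ-≤ rest (le zero))) rest≥0

  sumP≡ : ∀ n (f : Fin n → Point) → sumP n f ≡ (sumQ n (λ j → proj₁ (f j)) , sumQ n (λ j → proj₂ (f j)))
  sumP≡ zero f = refl
  sumP≡ (suc n) f = cong (f zero ⊕_) (sumP≡ n λ j → f (suc j))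

  module _ {n : ℕ} (vs : Fin n → Point) where

    record Weights (p : Point) : Set where
      field
        weight : Fin n → ℚ
        nonneg : ∀ j → 0ℚ ≤ weight j
        total : sumQ n weight ≡ 1ℚ
        first : sumQ n (λ j → weight j * proj₁ (vs j)) ≡ proj₁ p
        second : sumQ n (λ j → weight j * proj₂ (vs j)) ≡ proj₂ p

    weights : ∀ {p} → InHull vs p → Weights p
    weights (λs , λ≥0 , λ≡1 , eq) = record
      { weight = λs ; nonneg = λ≥0 ; total = λ≡1
      ; first = trans (cong proj₁ (sym (sumP≡ n _))) (cong proj₁ eq)
      ; second = trans (cong proj₂ (sym (sumP≡ n _))) (cong proj₂ eq) }

    fromWeights : ∀ {p} → Weights p → InHull vs p
    fromWeights w = weight , nonneg , total , trans (sumP≡ n _) (cong₂ _,_ first second)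
      where open Weights w

    convex : ∀ {x y x′ y′ a b} → InHull vs (x , y) → InHull vs (x′ , y′) → 0ℚ ≤ a → 0ℚ ≤ b → a + b ≡ 1ℚ →
             InHull vs (a * x + b * x′ , a * y + b * y′)
    convex {x} {y} {x′} {y′} {a} {b} h h′ a≥0 b≥0 a+b≡1 = fromWeights record
      { weight = λ j → a * W.weight j + b * V.weight j
      ; nonneg = λ j → +-mono-≤ (*-nonneg a≥0 (W.nonneg j)) (*-nonneg b≥0 (V.nonneg j))
      ; total = trans (sumQ-linear n a b W.weight V.weight)
          (trans (cong₂ (λ s t → a * s + b * t) W.total V.total) (trans (l a b) a+b≡1))
      ; first = trans (sumQ-cong n λ j → l′ a b (W.weight j) (V.weight j) (proj₁ (vs j)))
          (trans (sumQ-linear n a b _ _) (cong₂ (λ s t → a * s + b * t) W.first V.first))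
      ; second = trans (sumQ-cong n λ j → l′ a b (W.weight j) (V.weight j) (proj₂ (vs j)))
          (trans (sumQ-linear n a b _ _) (cong₂ (λ s t → a * s + b * t) W.second V.second)) }
      where
      module W = Weights (weights h)
      module V = Weights (weights h′)
      l : ∀ a b → a * 1ℚ + b * 1ℚ ≡ a + b
      l = solve-∀ ℚ-ring
      l′ : ∀ a b w v x → (a * w + b * v) * x ≡ a * (w * x) + b * (v * x)
      l′ = solve-∀ ℚ-ring

    evaluate : ∀ α β γ {p} (w : Weights p) → let open Weights w in
      sumQ n (λ j → weight j * (α * proj₁ (vs j) + β * proj₂ (vs j) + γ)) ≡ α * proj₁ p + β * proj₂ p + γ
    evaluate α β γ {p} w = trans (sumQ-cong n λ j → l α β γ (weight j) (proj₁ (vs j)) (proj₂ (vs j)))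
      (trans (sumQ-linear n 1ℚ γ _ weight)
        (trans (cong₂ (λ s t → 1ℚ * s + γ * t)
                 (trans (sumQ-linear n α β _ _) (cong₂ (λ s t → α * s + β * t) first second)) total)
               (l′ α β γ (proj₁ p) (proj₂ p))))
      where
      open Weights w
      l : ∀ α β γ w x y → w * (α * x + β * y + γ) ≡ 1ℚ * (α * (w * x) + β * (w * y)) + γ * w
      l = solve-∀ ℚ-ring
      l′ : ∀ α β γ x y → 1ℚ * (α * x + β * y) + γ * 1ℚ ≡ α * x + β * y + γ
      l′ = solve-∀ ℚ-ring

    sumQ-const : ∀ {p} (w : Weights p) M → let open Weights w in sumQ n (λ j → weight j * M) ≡ M
    sumQ-const w M = trans (sumQ-cong n λ j → l M (weight j)) (trans (sumQ-linear n M 0ℚ weight weight)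
      (trans (cong (λ s → M * s + 0ℚ * s) total) (l′ M)))
      where
      open Weights w
      l : ∀ M w → w * M ≡ M * w + 0ℚ * w
      l = solve-∀ ℚ-ring
      l′ : ∀ M → M * 1ℚ + 0ℚ * 1ℚ ≡ M
      l′ = solve-∀ ℚ-ring

    module _ (α β γ : ℚ) where
      private
        F : Point → ℚ
        F p = α * proj₁ p + β * proj₂ p + γ

      functional-≤ : ∀ {M p} → (∀ j → F (vs j) ≤ M) → InHull vs p → F p ≤ M
      functional-≤ {M} {p} le h = subst₂ _≤_ (evaluate α β γ w) (sumQ-const w M)
        (sumQ-mono n λ j → *-monoˡ-≤-nonNeg (weight j) {{nonNegative (nonneg j)}} (le j))
        where
        w = weights h
        open Weights w

      -- The weighted gaps M - F (vs j) are nonnegative and sum to M - F p = 0, so each of them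
      -- vanishes.
      face : ∀ {M p} → (∀ j → F (vs j) ≤ M) → (h : InHull vs p) → F p ≡ M →
             ∀ j → Weights.weight (weights h) j ≡ 0ℚ ⊎ F (vs j) ≡ M
      face {M} {p} le h Fp≡M j with F (vs j) ≟ M
      ... | yes e = inj₂ e
      ... | no ne = inj₁ (*-cancel gap>0 (trans (*-comm _ (weight j)) (trans (zero-term j) (sym (*-zeroʳ (M - F (vs j)))))))
        where
        w = weights h
        open Weights w
        term : Fin n → ℚ
        term j = weight j * (M - F (vs j))
        gap : ∀ j → 0ℚ ≤ M - F (vs j)
        gap j = subst (_≤ M - F (vs j)) (+-inverseʳ (F (vs j))) (+-monoˡ-≤ (- F (vs j)) (le j))
        gap>0 : 0ℚ < M - F (vs j)
        gap>0 = subst (_< M - F (vs j)) (+-inverseʳ (F (vs j))) (+-monoˡ-< (- F (vs j)) (≤∧≢⇒< (le j) ne))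
        total≡0 : sumQ n term ≡ 0ℚ
        total≡0 = trans (sumQ-cong n λ j → l M (weight j) (F (vs j)))
          (trans (sumQ-linear n 1ℚ (- 1ℚ) (λ j → weight j * M) (λ j → weight j * F (vs j)))
            (trans (cong₂ (λ s t → 1ℚ * s + - 1ℚ * t) (sumQ-const w M) (trans (evaluate α β γ w) Fp≡M)) (l′ M)))
          where
          l : ∀ M w F → w * (M - F) ≡ 1ℚ * (w * M) + - 1ℚ * (w * F)
          l = solve-∀ ℚ-ring
          l′ : ∀ M → 1ℚ * M + - 1ℚ * M ≡ 0ℚ
          l′ = solve-∀ ℚ-ring
        zero-term : ∀ j → term j ≡ 0ℚ
        zero-term = sumQ-vanish n (λ j → *-nonneg (nonneg j) (gap j)) total≡0

  module _ {N : ℕ} (vs : Fin N → Point) where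

    -- The rational point is stored together with its cleared coordinates, so that membership
    -- involves no division by n.
    record InCone (x y n : ℤ) : Set where
      constructor inCone
      field
        n>0 : 0ℤ ℤ.< n
        {p₁ p₂} : ℚ
        inHull : InHull vs (p₁ , p₂)
        first : ι n * p₁ ≡ ι x
        second : ι n * p₂ ≡ ι y

    hull-add : ∀ {x₁ y₁ n₁ x₂ y₂ n₂} → InCone x₁ y₁ n₁ → InCone x₂ y₂ n₂ → InCone (x₁ ℤ.+ x₂) (y₁ ℤ.+ y₂) (n₁ ℤ.+ n₂)
    hull-add {x₁} {y₁} {n₁} {x₂} {y₂} {n₂} (inCone n₁>0 {p₁} {p₂} h e₁ e₂) (inCone n₂>0 {q₁} {q₂} k f₁ f₂) =
      average (reciprocal (ι-mono-< n>0))
      where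
      s = n₁ ℤ.+ n₂
      n>0 : 0ℤ ℤ.< s
      n>0 = ℤP.+-mono-< n₁>0 n₂>0
      average : (∃ λ u → ι s * u ≡ 1ℚ × 0ℚ < u) → InCone (x₁ ℤ.+ x₂) (y₁ ℤ.+ y₂) s
      average (u , nu≡1 , u>0) = inCone n>0
        (convex vs h k (*-nonneg (ι-mono-≤ (ℤP.<⇒≤ n₁>0)) (<⇒≤ u>0)) (*-nonneg (ι-mono-≤ (ℤP.<⇒≤ n₂>0)) (<⇒≤ u>0))
          (trans (l (ι n₁) (ι n₂) u) (trans (cong (_* u) (sym (ι-+ n₁ n₂))) nu≡1)))
        (coordinate p₁ q₁ {x₁} {x₂} e₁ f₁) (coordinate p₂ q₂ {y₁} {y₂} e₂ f₂)
        where
        l : ∀ a b u → a * u + b * u ≡ (a + b) * u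
        l = solve-∀ ℚ-ring
        l′ : ∀ n a b u p q → n * (a * u * p + b * u * q) ≡ n * u * (a * p + b * q)
        l′ = solve-∀ ℚ-ring
        coordinate : ∀ p q {x y} → ι n₁ * p ≡ ι x → ι n₂ * q ≡ ι y → ι s * (ι n₁ * u * p + ι n₂ * u * q) ≡ ι (x ℤ.+ y)
        coordinate p q {x} {y} e f = trans (l′ (ι s) (ι n₁) (ι n₂) u p q)
          (trans (cong₂ _*_ nu≡1 (cong₂ _+_ e f)) (trans (*-identityˡ _) (sym (ι-+ x y))))

    hullCone : Cone
    hullCone = record
      { C = InCone
      ; C-pos = InCone.n>0
      ; add = hull-add
      ; scale = λ { {x} {y} {n} {a} a>0 (inCone n>0 h e₁ e₂) → inCone (*-pos a>0 n>0) h (up a n x e₁) (up a n y e₂) }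
      ; unscale = λ { {x} {y} {n} {a} a>0 (inCone an>0 h e₁ e₂) →
          inCone (*-cancel-pos a>0 an>0) h (down a n x a>0 e₁) (down a n y a>0 e₂) }
      }
      where
      up : ∀ a n x {p} → ι n * p ≡ ι x → ι (a ℤ.* n) * p ≡ ι (a ℤ.* x)
      up a n x {p} e = trans (cong (_* p) (ι-* a n)) (trans (*-assoc (ι a) (ι n) p) (trans (cong (ι a *_) e) (sym (ι-* a x))))
      down : ∀ a n x {p} → 0ℤ ℤ.< a → ι (a ℤ.* n) * p ≡ ι (a ℤ.* x) → ι n * p ≡ ι x
      down a n x {p} a>0 e = *-cancel (ι-mono-< a>0)
        (trans (sym (*-assoc (ι a) (ι n) p)) (trans (cong (_* p) (sym (ι-* a n))) (trans e (ι-* a x))))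

    module Cᵥ = Interior hullCone using (C; O; O⇒C; axes⇒O; O⇒axes)

    lattice⁺ : ∀ {x y} → InHull vs (lat (x , y)) → Cᵥ.C x y 1ℤ
    lattice⁺ {x} {y} h = inCone 0<1 h (*-identityˡ (ι x)) (*-identityˡ (ι y))

    lattice⁻ : ∀ {x y} → Cᵥ.C x y 1ℤ → InHull vs (lat (x , y))
    lattice⁻ {x} {y} (inCone _ {p₁} {p₂} h e₁ e₂) =
      subst (InHull vs) (cong₂ _,_ (trans (sym (*-identityˡ p₁)) e₁) (trans (sym (*-identityˡ p₂)) e₂)) h

    rational⁺ : ∀ {p₁ p₂} → InHull vs (p₁ , p₂) → ∃ λ x → ∃ λ y → ∃ λ n →
                Cᵥ.C x y n × ι n * p₁ ≡ ι x × ι n * p₂ ≡ ι y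
    rational⁺ {p₁} {p₂} h = ↥ p₁ ℤ.* ↧ p₂ , ↥ p₂ ℤ.* ↧ p₁ , ↧ p₁ ℤ.* ↧ p₂ , inCone n>0 h e₁ e₂ , e₁ , e₂
      where
      ↧>0 : ∀ p → 0ℤ ℤ.< ↧ p
      ↧>0 p@record{} = ℤ.+<+ (ℕ.s≤s ℕ.z≤n)
      n>0 : 0ℤ ℤ.< ↧ p₁ ℤ.* ↧ p₂
      n>0 = *-pos (↧>0 p₁) (↧>0 p₂)
      l : ∀ a b p → a * b * p ≡ a * p * b
      l = solve-∀ ℚ-ring
      l′ : ∀ a b p → a * b * p ≡ b * p * a
      l′ = solve-∀ ℚ-ring
      e₁ : ι (↧ p₁ ℤ.* ↧ p₂) * p₁ ≡ ι (↥ p₁ ℤ.* ↧ p₂)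
      e₁ = trans (cong (_* p₁) (ι-* (↧ p₁) (↧ p₂))) (trans (l (ι (↧ p₁)) (ι (↧ p₂)) p₁)
        (trans (cong (_* ι (↧ p₂)) (ι-denominator p₁)) (sym (ι-* (↥ p₁) (↧ p₂)))))
      e₂ : ι (↧ p₁ ℤ.* ↧ p₂) * p₂ ≡ ι (↥ p₂ ℤ.* ↧ p₁)
      e₂ = trans (cong (_* p₂) (ι-* (↧ p₁) (↧ p₂))) (trans (l′ (ι (↧ p₁)) (ι (↧ p₂)) p₂)
        (trans (cong (_* ι (↧ p₁)) (ι-denominator p₂)) (sym (ι-* (↥ p₂) (↧ p₁)))))

    interior⁺ : ∀ {x y} → Interior vs (lat (x , y)) → Cᵥ.O x y 1ℤ
    interior⁺ {x} {y} (h , ε , ε>0 , right , left , up , down) = Cᵥ.axes⇒O e>0 f>0 (lattice⁺ h)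
      (inCone f1>0 right (plus x) (still y)) (inCone f1>0 left (minus x) (still y))
      (inCone f1>0 up (still x) (plus y)) (inCone f1>0 down (still x) (minus y))
      where
      e = ↥ ε
      f = ↧ ε
      f>0 : 0ℤ ℤ.< f
      f>0 = positive-denominator ε
        where
        positive-denominator : ∀ p → 0ℤ ℤ.< ↧ p
        positive-denominator p@record{} = ℤ.+<+ (ℕ.s≤s ℕ.z≤n)
      f1>0 : 0ℤ ℤ.< f ℤ.* 1ℤ
      f1>0 = subst (0ℤ ℤ.<_) (sym (ℤP.*-identityʳ f)) f>0
      e>0 : 0ℤ ℤ.< e
      e>0 = ι-cancel-< (subst₂ _<_ (*-zeroʳ (ι f)) (ι-denominator ε) (*-monoʳ-<-pos (ι f) {{positive (ι-mono-< f>0)}} ε>0))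
      still : ∀ x → ι (f ℤ.* 1ℤ) * ι x ≡ ι (f ℤ.* x)
      still x = trans (cong (λ t → ι t * ι x) (ℤP.*-identityʳ f)) (sym (ι-* f x))
      plus : ∀ x → ι (f ℤ.* 1ℤ) * (ι x + ε) ≡ ι (f ℤ.* x ℤ.+ e)
      plus x = trans (cong (λ t → ι t * (ι x + ε)) (ℤP.*-identityʳ f)) (trans (*-distribˡ-+ (ι f) (ι x) ε)
        (trans (cong₂ _+_ (sym (ι-* f x)) (ι-denominator ε)) (sym (ι-+ (f ℤ.* x) e))))
      minus : ∀ x → ι (f ℤ.* 1ℤ) * (ι x - ε) ≡ ι (f ℤ.* x ℤ.- e)
      minus x = trans (cong (λ t → ι t * (ι x - ε)) (ℤP.*-identityʳ f)) (trans (l (ι f) (ι x) ε)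
        (trans (cong₂ (λ s t → s + - t) (sym (ι-* f x)) (ι-denominator ε))
          (trans (cong (_+_ (ι (f ℤ.* x))) (sym (ι-neg e))) (sym (ι-+ (f ℤ.* x) (ℤ.- e))))))
        where
        l : ∀ f x ε → f * (x - ε) ≡ f * x + - (f * ε)
        l = solve-∀ ℚ-ring

    interior⁻ : ∀ {x y} → Cᵥ.O x y 1ℤ → Interior vs (lat (x , y))
    interior⁻ {x} {y} o = build (Cᵥ.O⇒axes o)
      where
      build : (∃ λ a → 0ℤ ℤ.< a ×
        Cᵥ.C (a ℤ.* x ℤ.+ 1ℤ) (a ℤ.* y) (a ℤ.* 1ℤ) × Cᵥ.C (a ℤ.* x ℤ.- 1ℤ) (a ℤ.* y) (a ℤ.* 1ℤ) ×
        Cᵥ.C (a ℤ.* x) (a ℤ.* y ℤ.+ 1ℤ) (a ℤ.* 1ℤ) × Cᵥ.C (a ℤ.* x) (a ℤ.* y ℤ.- 1ℤ) (a ℤ.* 1ℤ)) → Interior vs (lat (x , y))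
      build (a , a>0 , right , left , up , down) = with-ε (reciprocal (ι-mono-< a>0))
        where
        with-ε : (∃ λ u → ι a * u ≡ 1ℚ × 0ℚ < u) → Interior vs (lat (x , y))
        with-ε (u , au≡1 , u>0) = lattice⁻ (Cᵥ.O⇒C o) , u , u>0 ,
          at right (plus x) (still y) , at left (minus x) (still y) , at up (still x) (plus y) , at down (still x) (minus y)
          where
          still : ∀ x → ι a * ι x ≡ ι (a ℤ.* x)
          still x = sym (ι-* a x)
          plus : ∀ x → ι a * (ι x + u) ≡ ι (a ℤ.* x ℤ.+ 1ℤ)
          plus x = trans (*-distribˡ-+ (ι a) (ι x) u) (trans (cong₂ _+_ (still x) au≡1) (sym (ι-+ (a ℤ.* x) 1ℤ)))
          minus : ∀ x → ι a * (ι x - u) ≡ ι (a ℤ.* x ℤ.- 1ℤ)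
          minus x = trans (l (ι a) (ι x) u) (trans (cong₂ (λ s t → s + - t) (still x) au≡1) (sym (ι-+ (a ℤ.* x) (ℤ.- 1ℤ))))
            where
            l : ∀ f x ε → f * (x - ε) ≡ f * x + - (f * ε)
            l = solve-∀ ℚ-ring
          at : ∀ {X Y p₁ p₂} → Cᵥ.C X Y (a ℤ.* 1ℤ) → ι a * p₁ ≡ ι X → ι a * p₂ ≡ ι Y → InHull vs (p₁ , p₂)
          at (inCone _ h e₁ e₂) f₁ f₂ = subst (InHull vs)
            (cong₂ _,_ (*-cancel (ι-mono-< a>0) (trans (trans (cong (λ t → ι t * _) (sym (ℤP.*-identityʳ a))) e₁) (sym f₁)))
                       (*-cancel (ι-mono-< a>0) (trans (trans (cong (λ t → ι t * _) (sym (ℤP.*-identityʳ a))) e₂) (sym f₂)))) h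

    config : (I : List (ℤ × ℤ)) → Unique I → (∀ z → (z ∈ I) ⇔ Interior vs (lat z)) →
             (B : List (ℤ × ℤ)) → Unique B → (∀ z → (z ∈ B) ⇔ Boundary vs (lat z)) → Config
    config I I! I⇔ B B! B⇔ = record
      { cone = hullCone ; I = I ; B = B ; I! = I! ; B! = B!
      ; I⇒O = λ p → interior⁺ (Equivalence.to (I⇔ _) p)
      ; O⇒I = λ o → Equivalence.from (I⇔ _) (interior⁻ o)
      ; B⇒C = λ p → lattice⁺ (proj₁ (Equivalence.to (B⇔ _) p))
      ; B⇒¬O = λ p o → proj₂ (Equivalence.to (B⇔ _) p) (interior⁻ o)
      ; ¬O⇒B = λ c ¬o → Equivalence.from (B⇔ _) (lattice⁻ c , λ i → ¬o (interior⁺ i))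
      }

  -- Vertices and denominators.

  integral⁻ : ∀ {q} → IsIntegral q → ∃ λ m → q ≡ ι m
  integral⁻ {q@record{}} d≡1 = ↥ q , trans (sym (*-identityˡ q)) (trans (cong (λ d → ι (+ d) * q) (sym d≡1)) (ι-denominator q))

  integral⁺ : ∀ m → IsIntegral (ι m)
  integral⁺ m = cong ℚ.denominatorℕ (↥p/↧p≡p (mkℚ m 0 (coprime-sym (1-coprimeTo ℤ.∣ m ∣))))

  -- A generator that maximises one functional may lie inside an edge; breaking ties by a second
  -- functional makes it a vertex.
  lexMax : ∀ m (f g : Fin (suc m) → ℚ) → ∃ λ j → ∀ l → f l < f j ⊎ (f l ≡ f j × g l ≤ g j)
  lexMax zero f g = zero , λ { zero → inj₂ (refl , ≤-refl) }
  lexMax (suc m) f g = insert (lexMax m (λ j → f (suc j)) (λ j → g (suc j)))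
    where
    insert : (∃ λ j → ∀ l → f (suc l) < f (suc j) ⊎ (f (suc l) ≡ f (suc j) × g (suc l) ≤ g (suc j))) →
             ∃ λ j → ∀ l → f l < f j ⊎ (f l ≡ f j × g l ≤ g j)
    insert (j , best) = compare (<-cmp (f zero) (f (suc j))) (≤-total (g zero) (g (suc j)))
      where
      keep : f zero < f (suc j) ⊎ (f zero ≡ f (suc j) × g zero ≤ g (suc j)) → ∃ λ j → ∀ l → f l < f j ⊎ (f l ≡ f j × g l ≤ g j)
      keep h = suc j , λ { zero → h ; (suc l) → best l }
      replace : f (suc j) < f zero ⊎ (f (suc j) ≡ f zero × g (suc j) ≤ g zero) → ∃ λ j → ∀ l → f l < f j ⊎ (f l ≡ f j × g l ≤ g j)
      replace h = zero , λ { zero → inj₂ (refl , ≤-refl) ; (suc l) → chain (best l) h }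
        where
        chain : ∀ {l} → f (suc l) < f (suc j) ⊎ (f (suc l) ≡ f (suc j) × g (suc l) ≤ g (suc j)) →
                f (suc j) < f zero ⊎ (f (suc j) ≡ f zero × g (suc j) ≤ g zero) →
                f (suc l) < f zero ⊎ (f (suc l) ≡ f zero × g (suc l) ≤ g zero)
        chain (inj₁ a) (inj₁ b) = inj₁ (<-trans a b)
        chain {l} (inj₁ a) (inj₂ (b , _)) = inj₁ (subst (f (suc l) <_) b a)
        chain (inj₂ (a , _)) (inj₁ b) = inj₁ (subst (_< f zero) (sym a) b)
        chain (inj₂ (a , a′)) (inj₂ (b , b′)) = inj₂ (trans a b , ≤-trans a′ b′)
      compare : Tri (f zero < f (suc j)) (f zero ≡ f (suc j)) (f (suc j) < f zero) → g zero ≤ g (suc j) ⊎ g (suc j) ≤ g zero →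
                ∃ λ j → ∀ l → f l < f j ⊎ (f l ≡ f j × g l ≤ g j)
      compare (tri< a _ _) _ = keep (inj₁ a)
      compare (tri> _ _ b) _ = replace (inj₁ b)
      compare (tri≈ _ e _) (inj₁ le) = keep (inj₂ (e , le))
      compare (tri≈ _ e _) (inj₂ le) = replace (inj₂ (sym e , le))

  private
    delta : ∀ {m} → Fin m → Fin m → ℚ
    delta zero zero = 1ℚ
    delta zero (suc _) = 0ℚ
    delta (suc _) zero = 0ℚ
    delta (suc j) (suc l) = delta j l

    sumQ-zero : ∀ m (f : Fin m → ℚ) → sumQ m (λ j → 0ℚ * f j) ≡ 0ℚ
    sumQ-zero zero f = refl
    sumQ-zero (suc m) f = trans (cong₂ _+_ (*-zeroˡ (f zero)) (sumQ-zero m λ j → f (suc j))) (+-identityˡ 0ℚ)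

    sumQ-delta : ∀ m (j : Fin m) (f : Fin m → ℚ) → sumQ m (λ l → delta j l * f l) ≡ f j
    sumQ-delta (suc m) zero f = trans (cong₂ _+_ (*-identityˡ (f zero)) (sumQ-zero m λ l → f (suc l))) (+-identityʳ (f zero))
    sumQ-delta (suc m) (suc j) f = trans (cong₂ _+_ (*-zeroˡ (f zero)) (sumQ-delta m j λ l → f (suc l))) (+-identityˡ (f (suc j)))

  generator∈hull : ∀ {m} (vs : Fin m → Point) j → InHull vs (vs j)
  generator∈hull {m} vs j = fromWeights vs record
    { weight = delta j ; nonneg = delta≥0 j
    ; total = trans (sumQ-cong m λ l → sym (*-identityʳ (delta j l))) (sumQ-delta m j λ _ → 1ℚ)
    ; first = sumQ-delta m j λ l → proj₁ (vs l) ; second = sumQ-delta m j λ l → proj₂ (vs l) }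
    where
    delta≥0 : ∀ {m} (j l : Fin m) → 0ℚ ≤ delta j l
    delta≥0 zero zero = ι-mono-≤ {0ℤ} {1ℤ} (ℤ.+≤+ ℕ.z≤n)
    delta≥0 zero (suc _) = ≤-refl
    delta≥0 (suc _) zero = ≤-refl
    delta≥0 (suc j) (suc l) = delta≥0 j l

  mean-extreme : ∀ {a b M t} → a ≤ M → b ≤ M → 0ℚ < t → t < 1ℚ → t * a + (1ℚ - t) * b ≡ M → a ≡ M × b ≡ M
  mean-extreme {a} {b} {M} {t} a≤M b≤M t>0 t<1 eq = left (a ≟ M) , right (b ≟ M)
    where
    u>0 : 0ℚ < 1ℚ - t
    u>0 = subst (_< 1ℚ - t) (+-inverseʳ t) (+-monoˡ-< (- t) t<1)
    l : ∀ t M → t * M + (1ℚ - t) * M ≡ M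
    l = solve-∀ ℚ-ring
    t*≤ : ∀ {p} → p ≤ M → t * p ≤ t * M
    t*≤ = *-monoˡ-≤-nonNeg t {{nonNegative (<⇒≤ t>0)}}
    u*≤ : ∀ {p} → p ≤ M → (1ℚ - t) * p ≤ (1ℚ - t) * M
    u*≤ = *-monoˡ-≤-nonNeg (1ℚ - t) {{nonNegative (<⇒≤ u>0)}}
    left : Dec (a ≡ M) → a ≡ M
    left (yes e) = e
    left (no ne) = contradiction (subst₂ _<_ eq (l t M)
      (+-mono-<-≤ (*-monoʳ-<-pos t {{positive t>0}} (≤∧≢⇒< a≤M ne)) (u*≤ b≤M))) (<-irrefl refl)
    right : Dec (b ≡ M) → b ≡ M
    right (yes e) = e
    right (no ne) = contradiction (subst₂ _<_ eq (l t M)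
      (+-mono-≤-< (t*≤ a≤M) (*-monoʳ-<-pos (1ℚ - t) {{positive u>0}} (≤∧≢⇒< b≤M ne)))) (<-irrefl refl)

  cleared : ∀ α β γ {u v m p₁ p₂} → ι m * p₁ ≡ ι u → ι m * p₂ ≡ ι v →
            ι m * (ι α * p₁ + ι β * p₂ + ι γ) ≡ ι (α ℤ.* u ℤ.+ β ℤ.* v ℤ.+ γ ℤ.* m)
  cleared α β γ {u} {v} {m} {p₁} {p₂} e₁ e₂ = trans (l (ι m) (ι α) (ι β) (ι γ) p₁ p₂)
    (trans (cong₂ (λ s t → ι α * s + ι β * t + ι γ * ι m) e₁ e₂)
      (trans (cong₂ _+_ (trans (cong₂ _+_ (sym (ι-* α u)) (sym (ι-* β v))) (sym (ι-+ (α ℤ.* u) (β ℤ.* v)))) (sym (ι-* γ m)))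
        (sym (ι-+ (α ℤ.* u ℤ.+ β ℤ.* v) (γ ℤ.* m)))))
    where
    l : ∀ m c d f x y → m * (c * x + d * y + f) ≡ c * (m * x) + d * (m * y) + f * m
    l = solve-∀ ℚ-ring

  module FrameCoordinates (ψ : Frame) where
    open Frame ψ

    F G : Point → ℚ
    F p = ι c * proj₁ p + ι d * proj₂ p + ι f
    G p = ι a * proj₁ p + ι b * proj₂ p + ι e

    private
      det-ι : ι s * (ι a * ι d - ι b * ι c) ≡ 1ℚ
      det-ι = trans (cong (ι s *_) (trans (cong₂ (λ u v → u + - v) (sym (ι-* a d)) (sym (ι-* b c)))
                (trans (cong (_+_ (ι (a ℤ.* d))) (sym (ι-neg (b ℤ.* c)))) (trans (sym (ι-+ (a ℤ.* d) (ℤ.- (b ℤ.* c)))) (cong ι det≡s)))))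
              (trans (sym (ι-* s s)) (cong ι s²≡1))

      recover₁ : ∀ p → proj₁ p ≡ ι s * (ι d * (G p - ι e) - ι b * (F p - ι f))
      recover₁ (p₁ , p₂) = sym (trans (l (ι s) (ι a) (ι b) (ι c) (ι d) (ι e) (ι f) p₁ p₂) (trans (cong (_* p₁) det-ι) (*-identityˡ p₁)))
        where
        l : ∀ s a b c d e f x y → s * (d * (a * x + b * y + e - e) - b * (c * x + d * y + f - f)) ≡ s * (a * d - b * c) * x
        l = solve-∀ ℚ-ring

      recover₂ : ∀ p → proj₂ p ≡ ι s * (ι a * (F p - ι f) - ι c * (G p - ι e))
      recover₂ (p₁ , p₂) = sym (trans (l (ι s) (ι a) (ι b) (ι c) (ι d) (ι e) (ι f) p₁ p₂) (trans (cong (_* p₂) det-ι) (*-identityˡ p₂)))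
        where
        l : ∀ s a b c d e f x y → s * (a * (c * x + d * y + f - f) - c * (a * x + b * y + e - e)) ≡ s * (a * d - b * c) * y
        l = solve-∀ ℚ-ring

    coordinates-injective : ∀ {p q} → F p ≡ F q → G p ≡ G q → p ≡ q
    coordinates-injective {p} {q} eF eG = cong₂ _,_
      (trans (recover₁ p) (trans (cong₂ (λ F G → ι s * (ι d * (G - ι e) - ι b * (F - ι f))) eF eG) (sym (recover₁ q))))
      (trans (recover₂ p) (trans (cong₂ (λ F G → ι s * (ι a * (F - ι f) - ι c * (G - ι e))) eF eG) (sym (recover₂ q))))

    F-cleared : ∀ {u v m p} → ι m * proj₁ p ≡ ι u → ι m * proj₂ p ≡ ι v → ι m * F p ≡ ι (Y u v m)
    F-cleared = cleared c d f

    affine : ∀ t p q → F ((t · p) ⊕ ((1ℚ - t) · q)) ≡ t * F p + (1ℚ - t) * F q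
                     × G ((t · p) ⊕ ((1ℚ - t) · q)) ≡ t * G p + (1ℚ - t) * G q
    affine t (p₁ , p₂) (q₁ , q₂) = l (ι c) (ι d) (ι f) t p₁ p₂ q₁ q₂ , l (ι a) (ι b) (ι e) t p₁ p₂ q₁ q₂
      where
      l : ∀ α β γ t p₁ p₂ q₁ q₂ → α * (t * p₁ + (1ℚ - t) * q₁) + β * (t * p₂ + (1ℚ - t) * q₂) + γ
          ≡ t * (α * p₁ + β * p₂ + γ) + (1ℚ - t) * (α * q₁ + β * q₂ + γ)
      l = solve-∀ ℚ-ring

    module _ {m : ℕ} (vs : Fin m → Point) (j : Fin m)
             (best : ∀ l → F (vs l) < F (vs j) ⊎ (F (vs l) ≡ F (vs j) × G (vs l) ≤ G (vs j))) where

      F≤ : ∀ {p} → InHull vs p → F p ≤ F (vs j)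
      F≤ = functional-≤ vs (ι c) (ι d) (ι f) λ l → [ <⇒≤ , (λ { (e , _) → ≤-reflexive e }) ]′ (best l)

      -- A point of maximal F has weight only on generators of maximal F, and among these G is
      -- largest at `vs j`.
      G≤ : ∀ {p} → InHull vs p → F p ≡ F (vs j) → G p ≤ G (vs j)
      G≤ {p} h Fp≡ = subst₂ _≤_ (evaluate vs (ι a) (ι b) (ι e) w) (sumQ-const vs w (G (vs j))) (sumQ-mono m term)
        where
        w = weights vs h
        open Weights w
        on-face = face vs (ι c) (ι d) (ι f) (λ l → [ <⇒≤ , (λ { (e , _) → ≤-reflexive e }) ]′ (best l)) h Fp≡
        zero-weight : ∀ {w p q} → w ≡ 0ℚ → w * p ≤ w * q
        zero-weight {w} {p} {q} refl = ≤-reflexive (trans (*-zeroˡ p) (sym (*-zeroˡ q)))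
        term : ∀ l → weight l * G (vs l) ≤ weight l * G (vs j)
        term l = [ zero-weight , (λ e → *-monoˡ-≤-nonNeg (weight l) {{nonNegative (nonneg l)}} (on e (best l))) ]′ (on-face l)
          where
          on : F (vs l) ≡ F (vs j) → F (vs l) < F (vs j) ⊎ (F (vs l) ≡ F (vs j) × G (vs l) ≤ G (vs j)) → G (vs l) ≤ G (vs j)
          on e (inj₁ lt) = contradiction lt (<-irrefl e)
          on _ (inj₂ (_ , le)) = le

      lexMax-vertex : IsVertex vs (vs j)
      lexMax-vertex = generator∈hull vs j , λ p q t hp hq t>0 t<1 eq →
        let affF , affG = affine t p q
            Fp , Fq = mean-extreme (F≤ hp) (F≤ hq) t>0 t<1 (trans (sym affF) (cong F (sym eq)))
            Gp , Gq = mean-extreme (G≤ hp Fp) (G≤ hq Fq) t>0 t<1 (trans (sym affG) (cong G (sym eq)))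
        in coordinates-injective (trans Fp (sym Fq)) (trans Gp (sym Gq))

  module _ {m : ℕ} (vs : Fin m → Point) {k : ℕ} (1≤k : 1 ℕ.≤ k) (integral : HasIntegralVertices vs k) where

    -- Integrality is known for vertices, not for generators, so the highest point is taken as the
    -- lexicographic maximum. Heights are measured by the inverse frame, which yields the new
    -- coordinates.
    summit : ∀ {p} → InHull vs p → ∀ φ → Summit (pullback (hullCone vs) φ) (+ k)
    summit {p} h φ = by-size m vs integral h
      where
      module φ = Frame φ
      module ψ = Frame (φ ⁻¹)
      open FrameCoordinates (φ ⁻¹) using (F; G; F-cleared; F≤; lexMax-vertex)
      k>0 : 0ℤ ℤ.< + k
      k>0 = ℤ.+<+ 1≤k
      by-size : ∀ m (vs : Fin m → Point) → HasIntegralVertices vs k → InHull vs p → Summit (pullback (hullCone vs) φ) (+ k)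
      by-size zero vs _ (_ , _ , () , _)
      by-size (suc m) vs integral _ = from-max (lexMax m (λ j → F (vs j)) (λ j → G (vs j)))
        where
        module Cv = Interior (hullCone vs) using (cast)
        from-max : (∃ λ j → ∀ l → F (vs l) < F (vs j) ⊎ (F (vs l) ≡ F (vs j) × G (vs l) ≤ G (vs j))) →
                   Summit (pullback (hullCone vs) φ) (+ k)
        from-max (j , best) = at (integral⁻ (proj₁ scaled)) (integral⁻ (proj₂ scaled))
          where
          scaled = integral (vs j) (lexMax-vertex vs j best)
          at : (∃ λ u → ι (+ k) * proj₁ (vs j) ≡ ι u) → (∃ λ v → ι (+ k) * proj₂ (vs j) ≡ ι v) → Summit (pullback (hullCone vs) φ) (+ k)
          at (u , eu) (v , ev) = ψ.X u v (+ k) , ψ.Y u v (+ k) ,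
            Cv.cast (sym (X-right φ u v (+ k))) (sym (Y-right φ u v (+ k))) refl (inCone k>0 (generator∈hull vs j) eu ev) ,
            λ {x} {y} {n} c → maximal x y n c
            where
            maximal : ∀ x y n → Cone.C (pullback (hullCone vs) φ) x y n → + k ℤ.* y ℤ.≤ n ℤ.* ψ.Y u v (+ k)
            maximal x y n (inCone n>0 {p₁} {p₂} h e₁ e₂) = ι-cancel-≤ (subst₂ _≤_
              (trans (cong (λ t → ι (+ k) * t) (trans (F-cleared {φ.X x y n} {φ.Y x y n} {n} {p₁ , p₂} e₁ e₂) (cong ι (Y-left φ x y n)))) (sym (ι-* (+ k) y)))
              (trans (l (ι (+ k)) (ι n) (F (vs j))) (trans (cong (ι n *_) (F-cleared {u} {v} {+ k} {vs j} eu ev)) (sym (ι-* n (ψ.Y u v (+ k))))))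
              (*-monoˡ-≤-nonNeg (ι (+ k)) {{nonNegative (<⇒≤ (ι-mono-< k>0))}}
                (*-monoˡ-≤-nonNeg (ι n) {{nonNegative (<⇒≤ (ι-mono-< n>0))}} (F≤ vs j best h))))
              where
              l : ∀ k n F → k * (n * F) ≡ n * (k * F)
              l = solve-∀ ℚ-ring

  -- The sum of two cone vectors is the convex combination of their points with weights n₁/(n₁ + n₂)
  -- and n₂/(n₁ + n₂); extremality makes both points equal to the vertex.
  vertex-split : ∀ {m} (vs : Fin m → Point) {v₁ v₂ x₁ y₁ n₁ x₂ y₂ n₂} → IsVertex vs (v₁ , v₂) →
    InCone vs x₁ y₁ n₁ → InCone vs x₂ y₂ n₂ →
    ι (n₁ ℤ.+ n₂) * v₁ ≡ ι (x₁ ℤ.+ x₂) → ι (n₁ ℤ.+ n₂) * v₂ ≡ ι (y₁ ℤ.+ y₂) →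
    ι n₁ * v₁ ≡ ι x₁ × ι n₁ * v₂ ≡ ι y₁
  vertex-split vs {v₁} {v₂} {x₁} {y₁} {n₁} {x₂} {y₂} {n₂} (_ , extreme) (inCone n₁>0 {p₁} {p₂} h e₁ e₂) (inCone n₂>0 {q₁} {q₂} k f₁ f₂) ev₁ ev₂ =
    split (reciprocal (ι-mono-< s>0))
    where
    s = n₁ ℤ.+ n₂
    s>0 : 0ℤ ℤ.< s
    s>0 = ℤP.+-mono-< n₁>0 n₂>0
    split : (∃ λ u → ι s * u ≡ 1ℚ × 0ℚ < u) → ι n₁ * v₁ ≡ ι x₁ × ι n₁ * v₂ ≡ ι y₁
    split (u , su≡1 , u>0) =
      trans (cong (ι n₁ *_) (at v₁≡ (cong proj₁ p≡q))) e₁ , trans (cong (ι n₁ *_) (at v₂≡ (cong proj₂ p≡q))) e₂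
      where
      t = ι n₁ * u
      1-t : 1ℚ - t ≡ ι n₂ * u
      1-t = trans (cong (_- t) (trans (sym su≡1) (cong (_* u) (ι-+ n₁ n₂)))) (l (ι n₁) (ι n₂) u)
        where
        l : ∀ a b u → (a + b) * u - a * u ≡ b * u
        l = solve-∀ ℚ-ring
      product-pos : ∀ {a b} → 0ℚ < a → 0ℚ < b → 0ℚ < a * b
      product-pos {a} {b} a>0 b>0 = subst (_< a * b) (*-zeroʳ a) (*-monoʳ-<-pos a {{positive a>0}} b>0)
      t>0 : 0ℚ < t
      t>0 = product-pos (ι-mono-< n₁>0) u>0
      t<1 : t < 1ℚ
      t<1 = subst₂ _<_ (+-identityˡ t) (l t) (+-monoˡ-< t (subst (0ℚ <_) (sym 1-t) (product-pos (ι-mono-< n₂>0) u>0)))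
        where
        l : ∀ t → 1ℚ - t + t ≡ 1ℚ
        l = solve-∀ ℚ-ring
      mean : ∀ {p q v x y} → ι n₁ * p ≡ ι x → ι n₂ * q ≡ ι y → ι s * v ≡ ι (x ℤ.+ y) → v ≡ t * p + (1ℚ - t) * q
      mean {p} {q} {v} {x} {y} e f ev = *-cancel (ι-mono-< s>0) (trans ev (sym (trans
        (cong (λ r → ι s * (t * p + r * q)) 1-t) (trans (l (ι s) (ι n₁) (ι n₂) u p q)
          (trans (cong₂ _*_ su≡1 (cong₂ _+_ e f)) (trans (*-identityˡ _) (sym (ι-+ x y))))))))
        where
        l : ∀ s a b u p q → s * (a * u * p + b * u * q) ≡ s * u * (a * p + b * q)
        l = solve-∀ ℚ-ring
      v₁≡ : v₁ ≡ t * p₁ + (1ℚ - t) * q₁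
      v₁≡ = mean {x = x₁} {x₂} e₁ f₁ ev₁
      v₂≡ : v₂ ≡ t * p₂ + (1ℚ - t) * q₂
      v₂≡ = mean {x = y₁} {y₂} e₂ f₂ ev₂
      p≡q : (p₁ , p₂) ≡ (q₁ , q₂)
      p≡q = extreme (p₁ , p₂) (q₁ , q₂) t h k t>0 t<1 (cong₂ _,_ v₁≡ v₂≡)
      at : ∀ {v p q} → v ≡ t * p + (1ℚ - t) * q → p ≡ q → v ≡ p
      at {p = p} e refl = trans e (l t p)
        where
        l : ∀ t p → t * p + (1ℚ - t) * p ≡ p
        l = solve-∀ ℚ-ring

  private
    drop-zero : ∀ a b e m w v {x y n} → x ≡ 0ℤ → y ≡ 0ℤ → n ≡ 0ℤ →
      ι (m ℤ.+ n) * v ≡ ι (w ℤ.+ (a ℤ.* x ℤ.+ b ℤ.* y ℤ.+ e ℤ.* n)) → ι m * v ≡ ι w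
    drop-zero a b e m w v refl refl refl eq =
      trans (cong (λ t → ι t * v) (sym (ℤP.+-identityʳ m))) (trans eq (cong ι (l a b e w)))
      where
      l : ∀ a b e w → w ℤ.+ (a ℤ.* 0ℤ ℤ.+ b ℤ.* 0ℤ ℤ.+ e ℤ.* 0ℤ) ≡ w
      l = ℤS.solve-∀

  module _ {m : ℕ} (vs : Fin m → Point) (T : Tripled (hullCone vs)) where
    open Tripled T
    private
      module φ = Frame coords
      module ψ = Frame (coords ⁻¹)
      module L = Interior (pullback (hullCone vs) coords) using (C; scale; cast; add*)

      scaleX : ∀ a b e t x y n → t ℤ.* (a ℤ.* x ℤ.+ b ℤ.* y ℤ.+ e ℤ.* n) ≡ a ℤ.* (t ℤ.* x) ℤ.+ b ℤ.* (t ℤ.* y) ℤ.+ e ℤ.* (t ℤ.* n)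
      scaleX = ℤS.solve-∀

      -- A vertex with positive barycentric weight α at a lattice corner is that corner.
      at-corner : ∀ {v₁ v₂ x y n cx cy α β γ d₁x d₁y d₂x d₂y} → IsVertex vs (v₁ , v₂) →
        ι n * v₁ ≡ ι (φ.X x y n) → ι n * v₂ ≡ ι (φ.Y x y n) →
        L.C cx cy 1ℤ → L.C d₁x d₁y 1ℤ → L.C d₂x d₂y 1ℤ → 0ℤ ℤ.< α → 0ℤ ℤ.≤ β → 0ℤ ℤ.≤ γ →
        + 3 ℤ.* x ≡ α ℤ.* cx ℤ.+ (β ℤ.* d₁x ℤ.+ γ ℤ.* d₂x) → + 3 ℤ.* y ≡ α ℤ.* cy ℤ.+ (β ℤ.* d₁y ℤ.+ γ ℤ.* d₂y) →
        + 3 ℤ.* n ≡ α ℤ.* 1ℤ ℤ.+ (β ℤ.* 1ℤ ℤ.+ γ ℤ.* 1ℤ) → v₁ ≡ ι (φ.X cx cy 1ℤ) × v₂ ≡ ι (φ.Y cx cy 1ℤ)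
      at-corner {v₁} {v₂} {x} {y} {n} {cx} {cy} {α} {β} {γ} {d₁x} {d₁y} {d₂x} {d₂y} vert e₁ e₂ cc cd₁ cd₂ α>0 β≥0 γ≥0 ex ey en =
        finish (rest (zero⊎pos β≥0) (zero⊎pos γ≥0))
        where
        rx = β ℤ.* d₁x ℤ.+ γ ℤ.* d₂x
        ry = β ℤ.* d₁y ℤ.+ γ ℤ.* d₂y
        rn = β ℤ.* 1ℤ ℤ.+ γ ℤ.* 1ℤ
        rest : β ≡ 0ℤ ⊎ 0ℤ ℤ.< β → γ ≡ 0ℤ ⊎ 0ℤ ℤ.< γ → (rx ≡ 0ℤ × ry ≡ 0ℤ × rn ≡ 0ℤ) ⊎ L.C rx ry rn
        rest (inj₂ β>0) _ = inj₂ (L.add* {x₁ = β ℤ.* d₁x} {β ℤ.* d₁y} {β ℤ.* 1ℤ} {d₂x} {d₂y} {1ℤ} (L.scale {d₁x} {d₁y} β>0 cd₁) γ≥0 cd₂)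
        rest (inj₁ refl) (inj₂ γ>0) = inj₂ (L.cast (sym (ℤP.+-identityˡ _)) (sym (ℤP.+-identityˡ _)) (sym (ℤP.+-identityˡ _)) (L.scale {d₂x} {d₂y} γ>0 cd₂))
        rest (inj₁ refl) (inj₁ refl) = inj₁ (refl , refl , refl)
        triple : ∀ {v} (X : ℤ → ℤ → ℤ → ℤ) → (∀ t x y n → t ℤ.* X x y n ≡ X (t ℤ.* x) (t ℤ.* y) (t ℤ.* n)) → ι n * v ≡ ι (X x y n) →
                 ι (α ℤ.* 1ℤ ℤ.+ rn) * v ≡ ι (X (α ℤ.* cx ℤ.+ rx) (α ℤ.* cy ℤ.+ ry) (α ℤ.* 1ℤ ℤ.+ rn))
        triple {v} X lin e = trans (cong (λ t → ι t * v) (sym en)) (trans (cong (_* v) (ι-* (+ 3) n))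
          (trans (*-assoc (ι (+ 3)) (ι n) v) (trans (cong (ι (+ 3) *_) e) (trans (sym (ι-* (+ 3) (X x y n)))
            (cong ι (trans (lin (+ 3) x y n) (trans (cong₂ (λ u v → X u v (+ 3 ℤ.* n)) ex ey) (cong (X _ _) en))))))))
        addX : ∀ a b e x y n x′ y′ n′ → a ℤ.* (x ℤ.+ x′) ℤ.+ b ℤ.* (y ℤ.+ y′) ℤ.+ e ℤ.* (n ℤ.+ n′)
               ≡ a ℤ.* x ℤ.+ b ℤ.* y ℤ.+ e ℤ.* n ℤ.+ (a ℤ.* x′ ℤ.+ b ℤ.* y′ ℤ.+ e ℤ.* n′)
        addX = ℤS.solve-∀
        t₁ : ι (α ℤ.* 1ℤ ℤ.+ rn) * v₁ ≡ ι (φ.X (α ℤ.* cx) (α ℤ.* cy) (α ℤ.* 1ℤ) ℤ.+ φ.X rx ry rn)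
        t₁ = trans (triple φ.X (scaleX φ.a φ.b φ.e) e₁) (cong ι (addX φ.a φ.b φ.e (α ℤ.* cx) (α ℤ.* cy) (α ℤ.* 1ℤ) rx ry rn))
        t₂ : ι (α ℤ.* 1ℤ ℤ.+ rn) * v₂ ≡ ι (φ.Y (α ℤ.* cx) (α ℤ.* cy) (α ℤ.* 1ℤ) ℤ.+ φ.Y rx ry rn)
        t₂ = trans (triple φ.Y (scaleX φ.c φ.d φ.f) e₂) (cong ι (addX φ.c φ.d φ.f (α ℤ.* cx) (α ℤ.* cy) (α ℤ.* 1ℤ) rx ry rn))
        on-ray : (rx ≡ 0ℤ × ry ≡ 0ℤ × rn ≡ 0ℤ) ⊎ L.C rx ry rn →
          ι (α ℤ.* 1ℤ) * v₁ ≡ ι (φ.X (α ℤ.* cx) (α ℤ.* cy) (α ℤ.* 1ℤ)) × ι (α ℤ.* 1ℤ) * v₂ ≡ ι (φ.Y (α ℤ.* cx) (α ℤ.* cy) (α ℤ.* 1ℤ))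
        on-ray (inj₂ cr) = vertex-split vs vert (L.scale {cx} {cy} α>0 cc) cr t₁ t₂
        on-ray (inj₁ (zx , zy , zn)) =
          drop-zero φ.a φ.b φ.e (α ℤ.* 1ℤ) (φ.X (α ℤ.* cx) (α ℤ.* cy) (α ℤ.* 1ℤ)) v₁ zx zy zn t₁ ,
          drop-zero φ.c φ.d φ.f (α ℤ.* 1ℤ) (φ.Y (α ℤ.* cx) (α ℤ.* cy) (α ℤ.* 1ℤ)) v₂ zx zy zn t₂
        finish : (rx ≡ 0ℤ × ry ≡ 0ℤ × rn ≡ 0ℤ) ⊎ L.C rx ry rn → v₁ ≡ ι (φ.X cx cy 1ℤ) × v₂ ≡ ι (φ.Y cx cy 1ℤ)
        finish r = divide φ.a φ.b φ.e (proj₁ (on-ray r)) , divide φ.c φ.d φ.f (proj₂ (on-ray r))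
          where
          divide : ∀ a b e {v} → ι (α ℤ.* 1ℤ) * v ≡ ι (a ℤ.* (α ℤ.* cx) ℤ.+ b ℤ.* (α ℤ.* cy) ℤ.+ e ℤ.* (α ℤ.* 1ℤ)) →
                   v ≡ ι (a ℤ.* cx ℤ.+ b ℤ.* cy ℤ.+ e ℤ.* 1ℤ)
          divide a b e {v} eq = *-cancel (ι-mono-< α>0) (trans (cong (λ t → ι t * v) (sym (ℤP.*-identityʳ α)))
            (trans eq (trans (cong ι (sym (scaleX a b e α cx cy 1ℤ))) (ι-* α _))))

    -- The values x + n, y + n and n - (x + y) are barycentric coordinates for the three corners.
    -- They sum to 3 n > 0, so one is positive, and the vertex is that lattice corner.
    tripled⇒integral : HasIntegralVertices vs 1
    tripled⇒integral (v₁ , v₂) vert = from-rational (rational⁺ vs (proj₁ vert))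
      where
      integral-point : ∀ a b → v₁ ≡ ι a × v₂ ≡ ι b → ScaledIntegral 1 (v₁ , v₂)
      integral-point a b (e₁ , e₂) =
        subst IsIntegral (trans (sym e₁) (sym (*-identityˡ v₁))) (integral⁺ a) , subst IsIntegral (trans (sym e₂) (sym (*-identityˡ v₂))) (integral⁺ b)
      from-rational : (∃ λ X → ∃ λ Y → ∃ λ n → InCone vs X Y n × ι n * v₁ ≡ ι X × ι n * v₂ ≡ ι Y) → ScaledIntegral 1 (v₁ , v₂)
      from-rational (X , Y , n , c , e₁ , e₂) = by-weight (0ℤ ℤ.<? α) (0ℤ ℤ.<? β) (0ℤ ℤ.<? γ)
        where
        x = ψ.X X Y n
        y = ψ.Y X Y n
        c′ : L.C x y n
        c′ = Interior.cast (hullCone vs) (sym (X-right coords X Y n)) (sym (Y-right coords X Y n)) refl c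
        α = x ℤ.+ n
        β = y ℤ.+ n
        γ = n ℤ.- (x ℤ.+ y)
        plus : ∀ {a} → ℤ.- n ℤ.≤ a → 0ℤ ℤ.≤ a ℤ.+ n
        plus {a} le = lin (Δ le) (l a n)
          where
          l : ∀ a n → a ℤ.+ n ℤ.- 0ℤ ≡ a ℤ.- ℤ.- n
          l = ℤS.solve-∀
        α≥0 = plus (left {x} {y} {n} c′)
        β≥0 = plus (bottom {x} {y} {n} c′)
        γ≥0 : 0ℤ ℤ.≤ γ
        γ≥0 = Δ (right {x} {y} {n} c′)
        e₁′ : ι n * v₁ ≡ ι (φ.X x y n)
        e₁′ = trans e₁ (cong ι (sym (X-right coords X Y n)))
        e₂′ : ι n * v₂ ≡ ι (φ.Y x y n)
        e₂′ = trans e₂ (cong ι (sym (Y-right coords X Y n)))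
        by-weight : Dec (0ℤ ℤ.< α) → Dec (0ℤ ℤ.< β) → Dec (0ℤ ℤ.< γ) → ScaledIntegral 1 (v₁ , v₂)
        by-weight (yes α>0) _ _ = integral-point (φ.X (+ 2) -1ℤ 1ℤ) (φ.Y (+ 2) -1ℤ 1ℤ) (at-corner {cx = + 2} { -1ℤ} {α} {β} {γ} { -1ℤ} {+ 2} { -1ℤ} { -1ℤ} vert e₁′ e₂′ corner₂ corner₃ corner₁ α>0 β≥0 γ≥0 (lx x y n) (ly x y n) (ln x y n))
          where
          lx : ∀ x y n → + 3 ℤ.* x ≡ (x ℤ.+ n) ℤ.* + 2 ℤ.+ ((y ℤ.+ n) ℤ.* -1ℤ ℤ.+ (n ℤ.- (x ℤ.+ y)) ℤ.* -1ℤ)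
          lx = ℤS.solve-∀
          ly : ∀ x y n → + 3 ℤ.* y ≡ (x ℤ.+ n) ℤ.* -1ℤ ℤ.+ ((y ℤ.+ n) ℤ.* + 2 ℤ.+ (n ℤ.- (x ℤ.+ y)) ℤ.* -1ℤ)
          ly = ℤS.solve-∀
          ln : ∀ x y n → + 3 ℤ.* n ≡ (x ℤ.+ n) ℤ.* 1ℤ ℤ.+ ((y ℤ.+ n) ℤ.* 1ℤ ℤ.+ (n ℤ.- (x ℤ.+ y)) ℤ.* 1ℤ)
          ln = ℤS.solve-∀
        by-weight (no _) (yes β>0) _ = integral-point (φ.X -1ℤ (+ 2) 1ℤ) (φ.Y -1ℤ (+ 2) 1ℤ) (at-corner {cx = -1ℤ} {+ 2} {β} {α} {γ} {+ 2} { -1ℤ} { -1ℤ} { -1ℤ} vert e₁′ e₂′ corner₃ corner₂ corner₁ β>0 α≥0 γ≥0 (lx x y n) (ly x y n) (ln x y n))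
          where
          lx : ∀ x y n → + 3 ℤ.* x ≡ (y ℤ.+ n) ℤ.* -1ℤ ℤ.+ ((x ℤ.+ n) ℤ.* + 2 ℤ.+ (n ℤ.- (x ℤ.+ y)) ℤ.* -1ℤ)
          lx = ℤS.solve-∀
          ly : ∀ x y n → + 3 ℤ.* y ≡ (y ℤ.+ n) ℤ.* + 2 ℤ.+ ((x ℤ.+ n) ℤ.* -1ℤ ℤ.+ (n ℤ.- (x ℤ.+ y)) ℤ.* -1ℤ)
          ly = ℤS.solve-∀
          ln : ∀ x y n → + 3 ℤ.* n ≡ (y ℤ.+ n) ℤ.* 1ℤ ℤ.+ ((x ℤ.+ n) ℤ.* 1ℤ ℤ.+ (n ℤ.- (x ℤ.+ y)) ℤ.* 1ℤ)
          ln = ℤS.solve-∀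
        by-weight (no _) (no _) (yes γ>0) = integral-point (φ.X -1ℤ -1ℤ 1ℤ) (φ.Y -1ℤ -1ℤ 1ℤ) (at-corner {cx = -1ℤ} { -1ℤ} {γ} {α} {β} {+ 2} { -1ℤ} { -1ℤ} {+ 2} vert e₁′ e₂′ corner₁ corner₂ corner₃ γ>0 α≥0 β≥0 (lx x y n) (ly x y n) (ln x y n))
          where
          lx : ∀ x y n → + 3 ℤ.* x ≡ (n ℤ.- (x ℤ.+ y)) ℤ.* -1ℤ ℤ.+ ((x ℤ.+ n) ℤ.* + 2 ℤ.+ (y ℤ.+ n) ℤ.* -1ℤ)
          lx = ℤS.solve-∀
          ly : ∀ x y n → + 3 ℤ.* y ≡ (n ℤ.- (x ℤ.+ y)) ℤ.* -1ℤ ℤ.+ ((x ℤ.+ n) ℤ.* -1ℤ ℤ.+ (y ℤ.+ n) ℤ.* + 2)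
          ly = ℤS.solve-∀
          ln : ∀ x y n → + 3 ℤ.* n ≡ (n ℤ.- (x ℤ.+ y)) ℤ.* 1ℤ ℤ.+ ((x ℤ.+ n) ℤ.* 1ℤ ℤ.+ (y ℤ.+ n) ℤ.* 1ℤ)
          ln = ℤS.solve-∀
        by-weight (no ¬α) (no ¬β) (no ¬γ) = ⊥-elim (ℤP.<⇒≱ (*-pos {+ 3} (ℤ.+<+ (ℕ.s≤s ℕ.z≤n)) (InCone.n>0 c))
          (lin (Δ (ℤP.≮⇒≥ ¬α) ⊹ Δ (ℤP.≮⇒≥ ¬β) ⊹ Δ (ℤP.≮⇒≥ ¬γ)) (l x y n)))
          where
          l : ∀ x y n → 0ℤ ℤ.- + 3 ℤ.* n ≡ 0ℤ ℤ.- (x ℤ.+ n) ℤ.+ (0ℤ ℤ.- (y ℤ.+ n)) ℤ.+ (0ℤ ℤ.- (n ℤ.- (x ℤ.+ y)))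
          l = ℤS.solve-∀

  cone-≤ : ∀ {m} (vs : Fin m → Point) α β γ →
    (∀ j → ∃ λ u → ∃ λ v → ∃ λ w → 0ℤ ℤ.< w × ι w * proj₁ (vs j) ≡ ι u × ι w * proj₂ (vs j) ≡ ι v × α ℤ.* u ℤ.+ β ℤ.* v ℤ.+ γ ℤ.* w ℤ.≤ 0ℤ) →
    ∀ {x y n} → InCone vs x y n → α ℤ.* x ℤ.+ β ℤ.* y ℤ.+ γ ℤ.* n ℤ.≤ 0ℤ
  cone-≤ vs α β γ at {x} {y} {n} (inCone n>0 {p₁} {p₂} h e₁ e₂) = ι-cancel-≤ (subst₂ _≤_ (cleared α β γ e₁ e₂) (*-zeroʳ (ι n))
    (*-monoˡ-≤-nonNeg (ι n) {{nonNegative (<⇒≤ (ι-mono-< n>0))}} (functional-≤ vs (ι α) (ι β) (ι γ) {0ℚ} {p₁ , p₂} generator h)))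
    where
    generator : ∀ j → ι α * proj₁ (vs j) + ι β * proj₂ (vs j) + ι γ ≤ 0ℚ
    generator j = let u , v , w , w>0 , eu , ev , le = at j in
      *-cancelˡ-≤-pos (ι w) {{positive (ι-mono-< w>0)}} (subst₂ _≤_ (sym (cleared α β γ eu ev)) (sym (*-zeroʳ (ι w))) (ι-mono-≤ le))

  module _ (k i : ℕ) (1≤k : 1 ℕ.≤ k) where
    private
      ws = extremalTriangle k i
      k>0 : 0ℤ ℤ.< + k
      k>0 = ℤ.+<+ 1≤k

      recip≡ : ∀ {k} → 1 ℕ.≤ k → ι (+ k) * recipℕ k ≡ 1ℚ
      recip≡ {suc m} _ = toℚᵘ-injective (ℚᵘP.≃-trans (toℚᵘ-homo-* (ι (+ suc m)) (+ 1 / suc m))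
        (ℚᵘP.≃-trans (ℚᵘP.*-cong (toℚᵘ-fromℚᵘ (mkℚᵘ (+ suc m) 0)) (toℚᵘ-fromℚᵘ (mkℚᵘ (+ 1) m))) (*≡* (l (+ suc m)))))
        where
        l : ∀ d → d ℤ.* 1ℤ ℤ.* 1ℤ ≡ 1ℤ ℤ.* (1ℤ ℤ.* d)
        l = ℤS.solve-∀

      M≡ : ℕ→ℚ (suc k ℕ.* suc i) ≡ ι ((1ℤ ℤ.+ + k) ℤ.* (1ℤ ℤ.+ + i))
      M≡ = cong ι (ℤP.pos-* (suc k) (suc i))

      top₁ : ι (+ k) * 0ℚ ≡ ι 0ℤ
      top₁ = *-zeroʳ (ι (+ k))

      top : InCone ws 0ℤ 1ℤ (+ k)
      top = inCone k>0 (generator∈hull ws zero) top₁ (recip≡ 1≤k)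

      left : InCone ws 0ℤ -1ℤ 1ℤ
      left = inCone 0<1 (generator∈hull ws (suc zero)) refl refl

      right : InCone ws ((1ℤ ℤ.+ + k) ℤ.* (1ℤ ℤ.+ + i)) -1ℤ 1ℤ
      right = inCone 0<1 (generator∈hull ws (suc (suc zero))) (trans (*-identityˡ _) M≡) refl

      at-corners : ∀ α β γ → β ℤ.+ γ ℤ.* + k ℤ.≤ 0ℤ → ℤ.- β ℤ.+ γ ℤ.≤ 0ℤ →
        α ℤ.* ((1ℤ ℤ.+ + k) ℤ.* (1ℤ ℤ.+ + i)) ℤ.- β ℤ.+ γ ℤ.≤ 0ℤ →
        ∀ {x y n} → InCone ws x y n → α ℤ.* x ℤ.+ β ℤ.* y ℤ.+ γ ℤ.* n ℤ.≤ 0ℤ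
      at-corners α β γ a b c = cone-≤ ws α β γ λ
        { zero → 0ℤ , 1ℤ , + k , k>0 , top₁ , recip≡ 1≤k , subst (ℤ._≤ 0ℤ) (l₀ α β γ (+ k)) a
        ; (suc zero) → 0ℤ , -1ℤ , 1ℤ , 0<1 , refl , refl , subst (ℤ._≤ 0ℤ) (l₁ α β γ) b
        ; (suc (suc zero)) → _ , -1ℤ , 1ℤ , 0<1 , trans (*-identityˡ _) M≡ , refl , subst (ℤ._≤ 0ℤ) (l₂ α β γ _) c }
        where
        l₀ : ∀ α β γ k → β ℤ.+ γ ℤ.* k ≡ α ℤ.* 0ℤ ℤ.+ β ℤ.* 1ℤ ℤ.+ γ ℤ.* k
        l₀ = ℤS.solve-∀
        l₁ : ∀ α β γ → ℤ.- β ℤ.+ γ ≡ α ℤ.* 0ℤ ℤ.+ β ℤ.* -1ℤ ℤ.+ γ ℤ.* 1ℤ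
        l₁ = ℤS.solve-∀
        l₂ : ∀ α β γ m → α ℤ.* m ℤ.- β ℤ.+ γ ≡ α ℤ.* m ℤ.+ β ℤ.* -1ℤ ℤ.+ γ ℤ.* 1ℤ
        l₂ = ℤS.solve-∀

    triangle⇒extremal : ∀ {x y n} → InCone ws x y n → Extremal (+ k) (+ i) x y n
    triangle⇒extremal {x} {y} {n} c = InCone.n>0 c ,
      lin (Δ (at-corners -1ℤ 0ℤ 0ℤ ℤP.≤-refl ℤP.≤-refl far-corner c)) (l₁ x y n) ,
      lin (Δ (at-corners 0ℤ -1ℤ -1ℤ (ℤP.≤-trans (ℤP.≤-reflexive (e₁ (+ k))) (ℤP.neg-mono-≤ (nat (suc k)))) ℤP.≤-refl ℤP.≤-refl c)) (l₂ x y n) ,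
      lin (Δ (at-corners 1ℤ ((1ℤ ℤ.+ + i) ℤ.* + k) (ℤ.- (1ℤ ℤ.+ + i)) (ℤP.≤-reflexive (e₂ (+ k) (+ i)))
               (ℤP.≤-trans (ℤP.≤-reflexive (e₃ (+ k) (+ i))) (ℤP.neg-mono-≤ (nat 0 ⊹ nat (suc i) ⊠ nat (suc k)))) (ℤP.≤-reflexive (e₄ (+ k) (+ i))) c))
          (l₃ x y n (+ k) (+ i))
      where
      far-corner : -1ℤ ℤ.* ((1ℤ ℤ.+ + k) ℤ.* (1ℤ ℤ.+ + i)) ℤ.- 0ℤ ℤ.+ 0ℤ ℤ.≤ 0ℤ
      far-corner = ℤP.≤-trans (ℤP.≤-reflexive (e₀ ((1ℤ ℤ.+ + k) ℤ.* (1ℤ ℤ.+ + i)))) (ℤP.neg-mono-≤ (nat (suc k) ⊠ nat (suc i)))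
        where
        e₀ : ∀ m → -1ℤ ℤ.* m ℤ.- 0ℤ ℤ.+ 0ℤ ≡ ℤ.- m
        e₀ = ℤS.solve-∀
      e₁ : ∀ k → -1ℤ ℤ.+ -1ℤ ℤ.* k ≡ ℤ.- (1ℤ ℤ.+ k)
      e₁ = ℤS.solve-∀
      e₂ : ∀ k i → (1ℤ ℤ.+ i) ℤ.* k ℤ.+ ℤ.- (1ℤ ℤ.+ i) ℤ.* k ≡ 0ℤ
      e₂ = ℤS.solve-∀
      e₃ : ∀ k i → ℤ.- ((1ℤ ℤ.+ i) ℤ.* k) ℤ.+ ℤ.- (1ℤ ℤ.+ i) ≡ ℤ.- (0ℤ ℤ.+ (1ℤ ℤ.+ i) ℤ.* (1ℤ ℤ.+ k))
      e₃ = ℤS.solve-∀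
      e₄ : ∀ k i → 1ℤ ℤ.* ((1ℤ ℤ.+ k) ℤ.* (1ℤ ℤ.+ i)) ℤ.- (1ℤ ℤ.+ i) ℤ.* k ℤ.+ ℤ.- (1ℤ ℤ.+ i) ≡ 0ℤ
      e₄ = ℤS.solve-∀
      l₁ : ∀ x y n → x ℤ.- 0ℤ ≡ 0ℤ ℤ.- (-1ℤ ℤ.* x ℤ.+ 0ℤ ℤ.* y ℤ.+ 0ℤ ℤ.* n)
      l₁ = ℤS.solve-∀
      l₂ : ∀ x y n → y ℤ.- ℤ.- n ≡ 0ℤ ℤ.- (0ℤ ℤ.* x ℤ.+ -1ℤ ℤ.* y ℤ.+ -1ℤ ℤ.* n)
      l₂ = ℤS.solve-∀
      l₃ : ∀ x y n k i → (1ℤ ℤ.+ i) ℤ.* (n ℤ.- k ℤ.* y) ℤ.- x ≡ 0ℤ ℤ.- (1ℤ ℤ.* x ℤ.+ (1ℤ ℤ.+ i) ℤ.* k ℤ.* y ℤ.+ ℤ.- (1ℤ ℤ.+ i) ℤ.* n)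
      l₃ = ℤS.solve-∀

    extremal⇒triangle : ∀ {x y n} → Extremal (+ k) (+ i) x y n → InCone ws x y n
    extremal⇒triangle = ExtremalCorners.extremal⊆C (hullCone ws) (ℤP.<⇒≤ k>0) (nat i) top left right

  -- Affine unimodular equivalence as equality of cones.

  SameCone : ∀ {m m′} → (Fin m → Point) → (Fin m′ → Point) → Frame → Set
  SameCone vs ws φ = (∀ x y n → InCone vs (X x y n) (Y x y n) n → InCone ws x y n)
                   × (∀ x y n → InCone ws x y n → InCone vs (X x y n) (Y x y n) n)
    where open Frame φ

  unimodularFrame : Unimodular → ℤ × ℤ → Frame
  unimodularFrame (mkU a b c d (inj₁ det≡1)) (e , f) = frame a b c d e f 1ℤ det≡1 refl
  unimodularFrame (mkU a b c d (inj₂ det≡-1)) (e , f) = frame a b c d e f -1ℤ det≡-1 refl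

  frameUnimodular : Frame → Unimodular
  frameUnimodular (frame a b c d _ _ s det≡s s²≡1) = mkU a b c d ([ (λ e → inj₁ (trans det≡s e)) , (λ e → inj₂ (trans det≡s e)) ]′ (sign s (ℕP.m*n≡1⇒m≡1 ℤ.∣ s ∣ ℤ.∣ s ∣ (trans (sym (ℤP.abs-* s s)) (cong ℤ.∣_∣ s²≡1)))))
    where
    sign : ∀ s → ℤ.∣ s ∣ ≡ 1 → s ≡ 1ℤ ⊎ s ≡ -1ℤ
    sign (+ _) refl = inj₁ refl
    sign -[1+ _ ] refl = inj₂ refl

  module _ {m m′ : ℕ} (vs : Fin m → Point) (ws : Fin m′ → Point) where
    private
      module V = Interior (hullCone vs) using (cast)
      module W = Interior (hullCone ws) using (scale; unscale; cast)

    module _ (φ : Frame) where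
      open Frame φ
      private
        module ψ = Frame (φ ⁻¹)

      image : Point → Point
      image (q₁ , q₂) = ι a * q₁ + ι b * q₂ + ι e , ι c * q₁ + ι d * q₂ + ι f

      image-equivalence : SameCone vs ws φ → ∀ p → InHull vs p ⇔ (Σ Point λ q → InHull ws q × p ≡ image q)
      image-equivalence (to , from) (p₁ , p₂) = mk⇔ (λ h → forth (rational⁺ vs h)) λ { ((q₁ , q₂) , h , eq) → back eq (rational⁺ ws h) }
        where
        forth : (∃ λ u → ∃ λ v → ∃ λ n → InCone vs u v n × ι n * p₁ ≡ ι u × ι n * p₂ ≡ ι v) → Σ Point λ q → InHull ws q × (p₁ , p₂) ≡ image q
        forth (u , v , n , cone , e₁ , e₂) = result (to (ψ.X u v n) (ψ.Y u v n) n (V.cast (sym (X-right φ u v n)) (sym (Y-right φ u v n)) refl cone))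
          where
          result : InCone ws (ψ.X u v n) (ψ.Y u v n) n → Σ Point λ q → InHull ws q × (p₁ , p₂) ≡ image q
          result (inCone n>0 {q₁} {q₂} h f₁ f₂) = (q₁ , q₂) , h , cong₂ _,_
            (*-cancel (ι-mono-< n>0) (trans e₁ (trans (cong ι (sym (X-right φ u v n))) (sym (cleared a b e {ψ.X u v n} {ψ.Y u v n} {n} f₁ f₂)))))
            (*-cancel (ι-mono-< n>0) (trans e₂ (trans (cong ι (sym (Y-right φ u v n))) (sym (cleared c d f {ψ.X u v n} {ψ.Y u v n} {n} f₁ f₂)))))
        back : ∀ {q₁ q₂} → (p₁ , p₂) ≡ image (q₁ , q₂) → (∃ λ u → ∃ λ v → ∃ λ n → InCone ws u v n × ι n * q₁ ≡ ι u × ι n * q₂ ≡ ι v) → InHull vs (p₁ , p₂)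
        back {q₁} {q₂} eq (u , v , n , cone , e₁ , e₂) = result (from u v n cone)
          where
          result : InCone vs (X u v n) (Y u v n) n → InHull vs (p₁ , p₂)
          result (inCone n>0 {r₁} {r₂} h f₁ f₂) = subst (InHull vs) (trans (cong₂ _,_
            (*-cancel (ι-mono-< n>0) (trans f₁ (sym (cleared a b e {u} {v} {n} e₁ e₂))))
            (*-cancel (ι-mono-< n>0) (trans f₂ (sym (cleared c d f {u} {v} {n} e₁ e₂))))) (sym eq)) h

      -- A preimage q comes with a denominator l of its own. The inverse frame shows that its cone
      -- vector (u, v, l) is proportional to (x, y, n), so scaling by n and unscaling by l gives the
      -- wanted vector.
      sameCone : (∀ p → InHull vs p ⇔ (Σ Point λ q → InHull ws q × p ≡ image q)) → SameCone vs ws φ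
      sameCone equiv = to , from
        where
        from : ∀ x y n → InCone ws x y n → InCone vs (X x y n) (Y x y n) n
        from x y n (inCone n>0 {q₁} {q₂} h e₁ e₂) = inCone n>0 (Equivalence.from (equiv (image (q₁ , q₂))) ((q₁ , q₂) , h , refl))
          (cleared a b e {x} {y} {n} e₁ e₂) (cleared c d f {x} {y} {n} e₁ e₂)
        to : ∀ x y n → InCone vs (X x y n) (Y x y n) n → InCone ws x y n
        to x y n (inCone n>0 {p₁} {p₂} h e₁ e₂) = preimage (Equivalence.to (equiv (p₁ , p₂)) h)
          where
          preimage : (Σ Point λ q → InHull ws q × (p₁ , p₂) ≡ image q) → InCone ws x y n
          preimage ((q₁ , q₂) , hq , eq) = rescale (rational⁺ ws hq)
            where
            rescale : (∃ λ u → ∃ λ v → ∃ λ l → InCone ws u v l × ι l * q₁ ≡ ι u × ι l * q₂ ≡ ι v) → InCone ws x y n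
            rescale (u , v , l , cone , f₁ , f₂) = W.unscale (InCone.n>0 cone) (W.cast
              (proportional ψ.a ψ.b ψ.e (X-left φ u v l) (X-left φ x y n)) (proportional ψ.c ψ.d ψ.f (Y-left φ u v l) (Y-left φ x y n))
              (ℤP.*-comm n l) (W.scale n>0 cone))
              where
              cross : ∀ {p z z′} → ι n * p ≡ ι z → ι l * p ≡ ι z′ → n ℤ.* z′ ≡ l ℤ.* z
              cross {p} {z} {z′} e e′ = ι-injective (trans (ι-* n z′) (trans (cong (ι n *_) (sym e′))
                (trans (swap (ι n) (ι l) p) (trans (cong (ι l *_) e) (sym (ι-* l z))))))
                where
                swap : ∀ n l p → n * (l * p) ≡ l * (n * p)
                swap = solve-∀ ℚ-ring
              crossX : n ℤ.* X u v l ≡ l ℤ.* X x y n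
              crossX = cross e₁ (trans (cong (λ p → ι l * proj₁ p) eq) (cleared a b e {u} {v} {l} f₁ f₂))
              crossY : n ℤ.* Y u v l ≡ l ℤ.* Y x y n
              crossY = cross e₂ (trans (cong (λ p → ι l * proj₂ p) eq) (cleared c d f {u} {v} {l} f₁ f₂))
              proportional : ∀ α β γ {w z} → α ℤ.* X u v l ℤ.+ β ℤ.* Y u v l ℤ.+ γ ℤ.* l ≡ w →
                α ℤ.* X x y n ℤ.+ β ℤ.* Y x y n ℤ.+ γ ℤ.* n ≡ z → n ℤ.* w ≡ l ℤ.* z
              proportional α β γ refl refl = trans (spread n α β γ (X u v l) (Y u v l) l)
                (trans (cong₂ (λ s t → α ℤ.* s ℤ.+ β ℤ.* t ℤ.+ γ ℤ.* (n ℤ.* l)) crossX crossY)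
                  (sym (trans (spread l α β γ (X x y n) (Y x y n) n) (cong (λ t → α ℤ.* (l ℤ.* X x y n) ℤ.+ β ℤ.* (l ℤ.* Y x y n) ℤ.+ γ ℤ.* t) (ℤP.*-comm l n)))))
                where
                spread : ∀ n α β γ u v l → n ℤ.* (α ℤ.* u ℤ.+ β ℤ.* v ℤ.+ γ ℤ.* l) ≡ α ℤ.* (n ℤ.* u) ℤ.+ β ℤ.* (n ℤ.* v) ℤ.+ γ ℤ.* (n ℤ.* l)
                spread = ℤS.solve-∀

    unimodular⇒sameCone : AffUnimodEquiv vs ws → Σ Frame (SameCone vs ws)
    unimodular⇒sameCone (U@(mkU _ _ _ _ (inj₁ _)) , z , equiv) = unimodularFrame U z , sameCone (unimodularFrame U z) equiv
    unimodular⇒sameCone (U@(mkU _ _ _ _ (inj₂ _)) , z , equiv) = unimodularFrame U z , sameCone (unimodularFrame U z) equiv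

    sameCone⇒unimodular : Σ Frame (SameCone vs ws) → AffUnimodEquiv vs ws
    sameCone⇒unimodular (φ , same) = frameUnimodular φ , (Frame.e φ , Frame.f φ) , image-equivalence φ same

  module _ {m : ℕ} (vs : Fin m → Point) {k i : ℕ} (1≤k : 1 ℕ.≤ k) where

    extremal⇒unimodular : IsExtremal (hullCone vs) k i → AffUnimodEquiv vs (extremalTriangle k i)
    extremal⇒unimodular (χ , to , from) = sameCone⇒unimodular vs (extremalTriangle k i)
      (χ , (λ x y n c → extremal⇒triangle k i 1≤k (to {x} {y} {n} c)) , (λ x y n c → from {x} {y} {n} (triangle⇒extremal k i 1≤k c)))

    unimodular⇒extremal : AffUnimodEquiv vs (extremalTriangle k i) → IsExtremal (hullCone vs) k i
    unimodular⇒extremal aff = let φ , to , from = unimodular⇒sameCone vs (extremalTriangle k i) aff in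
      φ , (λ {x} {y} {n} c → triangle⇒extremal k i 1≤k (to x y n c)) , (λ {x} {y} {n} c → from x y n (extremal⇒triangle k i 1≤k c))

-- The theorem.

open LatticeGeometry using (Config; reframe; length-B-reframe; Conclusion; classification; IsExtremal; flat-bound; module ExtremalCount)
open RationalPolygons using (hullCone; config; summit; tripled⇒integral; extremal⇒unimodular; unimodular⇒extremal)
open import Data.Nat using (_+_; _*_; _≤_)
open import Data.Integer using (ℤ)
open import Data.Fin using (Fin)

theorem1p1 : (n : ℕ) (vs : Fin n → Point) (k i b : ℕ)
    → IsDenominator vs k → 2 ≤ k
    → (I : List (ℤ × ℤ)) → Unique I → ((z : ℤ × ℤ) → (z ∈ I) ⇔ Interior vs (lat z))
    → length I ≡ i → 1 ≤ i
    → (B : List (ℤ × ℤ)) → Unique B → ((z : ℤ × ℤ) → (z ∈ B) ⇔ Boundary vs (lat z))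
    → length B ≡ b
    → (b ≤ suc k * suc i + 3)
    × ((b ≡ suc k * suc i + 3) ⇔ AffUnimodEquiv vs (extremalTriangle k i))
theorem1p1 n vs k _ _ (1≤k , integral , minimal) 2≤k I I! I⇔ refl 1≤i B B! B⇔ refl =
  proj₁ forward , mk⇔ (λ eq → extremal⇒unimodular vs {k} {length I} 1≤k (proj₂ forward eq)) (λ aff → converse (unimodular⇒extremal vs {k} {length I} 1≤k aff))
  where
  K = config vs I I! I⇔ B B! B⇔
  Bound = suc k * suc (length I) + 3

  from-classification : Conclusion K → length B ≤ Bound × (length B ≡ Bound → IsExtremal (hullCone vs) k (length I))
  from-classification (inj₁ flat) = flat-bound K 1≤i flat (summit vs 1≤k integral (proj₂ (inside I 1≤i λ p → p)))
    where
    inside : ∀ L → 1 ≤ length L → (∀ {z} → z ∈ L → z ∈ I) → ∃ λ p → InHull vs p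
    inside (z ∷ _) _ sub = lat z , proj₁ (Equivalence.to (I⇔ z) (sub (here refl)))
  from-classification (inj₂ (inj₁ le)) = ℕP.<⇒≤ small , λ eq → contradiction eq (ℕP.<⇒≢ small)
    where
    -- For k ≥ 2 the bound is at least 3 (i + 1) + 3 = (3 i + 5) + 1.
    small : length B ℕ.< Bound
    small = ℕP.≤-trans (ℕ.s≤s le) (subst (_≤ Bound) (l (length I)) (ℕP.+-monoˡ-≤ 3 (ℕP.*-monoˡ-≤ (suc (length I)) (ℕ.s≤s 2≤k))))
      where
      l : ∀ i → 3 * suc i + 3 ≡ suc (3 * i + 5)
      l = ℕS.solve-∀
  from-classification (inj₂ (inj₂ (_ , _ , T))) =
    -- The exceptional triangle has integral vertices, so minimality of the denominator would give k
    -- ≤ 1.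
    contradiction (ℕP.≤-trans 2≤k (minimal 1 ℕP.≤-refl (tripled⇒integral vs T))) λ { (ℕ.s≤s ()) }

  forward : length B ≤ Bound × (length B ≡ Bound → IsExtremal (hullCone vs) k (length I))
  forward = from-classification (classification (length I) K ℕP.≤-refl 1≤i)

  converse : IsExtremal (hullCone vs) k (length I) → length B ≡ Bound
  converse (χ , to , from) = trans (sym (length-B-reframe K χ))
    (ExtremalCount.count (reframe K χ) 2≤k (λ {x} {y} {n} → to {x} {y} {n}) (λ {x} {y} {n} → from {x} {y} {n}))
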